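{- The following hold, where $f^\infty$ denotes the infinite loop of a problem $f$: \begin{enumerate} \item $\mathsf{C}_{2^{\mathbb N}}^\infty\equiv_{\mathrm W}\mathsf{C}_{2^{\mathbb N}}$ and $\mathsf{C}_{\mathbb N^{\mathbb N}}^\infty\equiv_{\mathrm W}\mathsf{C}_{\mathbb N^{\mathbb N}}$; \item $\mathsf{C}_{\mathbb N}<_{\mathrm W}\lim\equiv_{\mathrm W}\mathsf{C}_{\mathbb N}^\infty<_{\mathrm W}\lim^\infty$. \end{enumerate}
   Context: Problems. A represented space $(X,\delta_X)$ is a set $X$ with a surjective partial map $\delta_X:\subseteq\mathbb N^{\mathbb N}\to X$. A partial function $F:\subseteq\mathbb N^{\mathbb N}\to\mathbb N^{\mathbb N}$ is computable if there is a computable monotone (w.r.t. the prefix order) word function $\varphi:\mathbb N^*\to\mathbb N^*$ with $F(p)=\sup_{w\sqsubseteq p}\varphi(w)$ for all $p\in\mathrm{dom}(F)$. For a partial multivalued function $f:\subseteq X\rightrightarrows Y$ between represented spaces, $F:\subseteq\mathbb N^{\mathbb N}\to\mathbb N^{\mathbb N}$ is a realizer of $f$, written $F\vdash f$, if $\delta_YF(p)\in f\delta_X(p)$ for all $p\in\mathrm{dom}(f\delta_X)$. A problem is a multivalued function with a realizer. Composition: $g\circ f(x)=\{z:(\exists y\in f(x))\,z\in g(y)\}$ with $\mathrm{dom}(g\circ f)=\{x\in\mathrm{dom}(f):f(x)\subseteq\mathrm{dom}(g)\}$. The realizer version of $f$ is $f^{\mathrm r}:=\delta_Y^{ -1}\circ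 f\circ\delta_X:\subseteq\mathbb N^{\mathbb N}\rightrightarrows\mathbb N^{\mathbb N}$. Tupling. $\langle q,p\rangle:=q(0)p(0)q(1)p(1)\dots$, and $\langle p_0,p_1,p_2,\dots\rangle$ is the standard countable tupling, e.g. $\langle p_0,p_1,\dots\rangle(\langle i,j\rangle)=p_i(j)$. $\langle\mathrm{id}\times f\rangle$ is the problem $\langle q,p\rangle\mapsto\{\langle q,r\rangle:r\in f(p)\}$. Universal function. $\Phi$ is a fixed standard total representation of a set of continuous partial functions on $\mathbb N^{\mathbb N}$ (with natural domains), where a name $q$ encodes the graph of a monotone word function approximating $\Phi_q$; $\mathsf U_q:=\Phi_q$, and $\mathsf U\langle q,p\rangle:=\mathsf U_q(p)$ is a computable partial function. The smn-theorem holds: for every computable (continuous) $F:\subseteq\mathbb N^{\mathbb N}\to\mathbb N^{\mathbb N}$ there is a total computable (continuous) $S$ with $\mathsf U_{S(q)}(p)=F\langle q,p\rangle$ for all $\langle q,p\rangle\in\mathrm{dom}(F)$. Infinite loop. For a problem $f:\subseteq\mathbb N^{\mathbb N}\rightrightarrows\mathbb N^{\mathbb N}$, $f^\infty(q_0):=\{\langle q_0,q_1,q_2,\dots\rangle:(\forall i)\ q_{i+1}\in\mathsf U\circ\langle\mathrm{id}\times f\rangle(q_i)\}$, with $\mathrm{dom}(f^\infty)$ the set of all $q_0$ such that $A_0:=\{q_0\}\subseteq\mathrm{dom}(\mathsf U\circ\langle\mathrm{id}\times f\rangle)$ and $A_{i+1}:=\mathsf U\circ\langle\mathrm{id}\times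 f\rangle(A_i)\subseteq\mathrm{dom}(\mathsf U\circ\langle\mathrm{id}\times f\rangle)$ for all $i$. For arbitrary $f$, $f^\infty:=(f^{\mathrm r})^\infty$. Weihrauch reducibility. $f\le_{\mathrm W}g$ if there are computable $H,K:\subseteq\mathbb N^{\mathbb N}\to\mathbb N^{\mathbb N}$ with $H\langle\mathrm{id},GK\rangle\vdash f$ whenever $G\vdash g$. $\equiv_{\mathrm W}$ is the induced equivalence; $f<_{\mathrm W}g$ means $f\le_{\mathrm W}g$ and $g\not\le_{\mathrm W}f$. Specific problems. $\mathsf C_X:\subseteq\mathcal A_-(X)\rightrightarrows X$, $B\mapsto B$, with domain the nonempty closed sets, where $\mathcal A_-(X)$ is the space of closed subsets of $X$ represented by negative information (a name of $B$ is an enumeration of basic open sets whose union is $X\setminus B$; basic open sets are singletons for $X=\mathbb N$ and cylinder sets for $X=2^{\mathbb N},\mathbb N^{\mathbb N}$). $\lim:\subseteq\mathbb N^{\mathbb N}\to\mathbb N^{\mathbb N}$, $\langle p_0,p_1,\dots\rangle\mapsto\lim_{i\to\infty}p_i$, is the limit map of Baire space, defined on convergent sequences. -}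

module Defs where

open import Data.Bool.Base using (Bool; true; false; if_then_else_)
open import Data.Fin.Base using (Fin)
open import Data.List.Base
  using (List; []; _∷_; map; length; foldl; inits; module Inits; applyUpTo)
open import Data.List.Properties using (map-cong; map-∘; ∷-injectiveˡ; ∷-injectiveʳ)
open import Data.List.Relation.Binary.Prefix.Heterogeneous using (Prefix; []; _∷_)
open import Data.List.Relation.Binary.Prefix.Heterogeneous.Properties using (prefix?)
open import Data.Nat.Base using (ℕ; zero; suc; _+_; _≤_; _<_; z≤n; s≤s)
open import Data.Nat.Properties using (_≟_; +-suc; +-identityʳ; +-comm; ≤-refl; m≤n+m; ≤-trans)
open import Data.Product.Base using (∃; ∃₂; _×_; _,_; proj₁; proj₂)
open import Data.Vec.Base using (Vec; []; _∷_; lookup)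
open import Function.Base using (_∘_)
open import Function.Bundles using (_⇔_; mk⇔; Equivalence)
open import Function.Properties.Equivalence using () renaming
  (refl to ⇔-refl; sym to ⇔-sym; trans to ⇔-trans)
open import Level using (Level; 0ℓ; _⊔_) renaming (suc to lsuc)
open import Relation.Binary.Bundles using (Setoid)
open import Relation.Binary.Definitions using (_Respects_; _Respectsˡ_; _Respectsʳ_)
open import Relation.Binary.PropositionalEquality
  using (_≡_; refl; sym; trans; cong; cong₂; subst; subst₂; _≗_; _→-setoid_; setoid)
open import Relation.Nullary.Decidable using (does; yes; no; dec-true)
open import Relation.Nullary.Negation.Core using (¬_)
open import Relation.Unary using (Pred)

private
  variable
    a b c ℓ ℓ₁ ℓ₂ ℓ₃ r s : Level

------------------------------------------------------------------------
-- Partial recursive functions on ℕ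

data Rec : ℕ → Set where
  zero : ∀ {n} → Rec n
  succ : Rec 1
  proj : ∀ {n} → Fin n → Rec n
  comp : ∀ {m n} → Rec m → Vec (Rec n) m → Rec n
  prec : ∀ {n} → Rec n → Rec (suc (suc n)) → Rec (suc n)
  mu   : ∀ {n} → Rec (suc n) → Rec n

mutual

  data _[_]⇓_ : ∀ {n} → Rec n → Vec ℕ n → ℕ → Set where
    zero⇓ : ∀ {n} {xs : Vec ℕ n} → zero [ xs ]⇓ 0
    succ⇓ : ∀ {x} → succ [ x ∷ [] ]⇓ suc x
    proj⇓ : ∀ {n} {xs : Vec ℕ n} i → proj i [ xs ]⇓ lookup xs i
    comp⇓ : ∀ {m n} {f : Rec m} {gs : Vec (Rec n) m} {xs ys z} →
            gs [ xs ]⇓* ys → f [ ys ]⇓ z → comp f gs [ xs ]⇓ z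
    prec-zero⇓ : ∀ {n} {f : Rec n} {g xs y} →
                 f [ xs ]⇓ y → prec f g [ 0 ∷ xs ]⇓ y
    prec-suc⇓  : ∀ {n} {f : Rec n} {g k xs y z} →
                 prec f g [ k ∷ xs ]⇓ y → g [ k ∷ y ∷ xs ]⇓ z →
                 prec f g [ suc k ∷ xs ]⇓ z
    mu⇓   : ∀ {n} {f : Rec (suc n)} {xs k} →
            f [ k ∷ xs ]⇓ 0 →
            (∀ i → i < k → ∃ λ y → f [ i ∷ xs ]⇓ suc y) →
            mu f [ xs ]⇓ k

  data _[_]⇓*_ {n} : ∀ {m} → Vec (Rec n) m → Vec ℕ n → Vec ℕ m → Set where
    []  : ∀ {xs} → [] [ xs ]⇓* []
    _∷_ : ∀ {m f} {fs : Vec (Rec n) m} {xs y ys} →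
          f [ xs ]⇓ y → fs [ xs ]⇓* ys → (f ∷ fs) [ xs ]⇓* (y ∷ ys)

------------------------------------------------------------------------
-- Cantor pairing and the induced bijective coding of words

triangle : ℕ → ℕ
triangle zero    = 0
triangle (suc n) = suc n + triangle n

pair : ℕ → ℕ → ℕ
pair i j = triangle (i + j) + j

next : ℕ × ℕ → ℕ × ℕ
next (zero  , j) = suc j , 0
next (suc i , j) = i , suc j

unpair : ℕ → ℕ × ℕ
unpair zero    = 0 , 0
unpair (suc n) = next (unpair n)

unpair-pair : ∀ i j → unpair (pair i j) ≡ (i , j)
unpair-pair i j = go (i + j) i j refl
  where
  go : ∀ n i j → i + j ≡ n → unpair (pair i j) ≡ (i , j)
  go n i (suc j) eq =
    trans (cong unpair (trans (+-suc (triangle (i + suc j)) j)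
                              (cong (λ m → suc (triangle m + j)) (+-suc i j))))
          (cong next (go n (suc i) j (trans (sym (+-suc i j)) eq)))
  go n zero zero eq = refl
  go (suc n) (suc i) zero eq
    rewrite +-identityʳ i | +-identityʳ (i + triangle i) =
    trans (cong (next ∘ unpair) (+-comm i (triangle i)))
          (cong next (go n 0 i (cong-pred eq)))
    where
    cong-pred : ∀ {m k} → suc m ≡ suc k → m ≡ k
    cong-pred refl = refl

Word : Set
Word = List ℕ

encode : Word → ℕ
encode []      = 0
encode (n ∷ w) = suc (pair n (encode w))

-- The first argument is fuel: the second component of unpair m is at most m.
decodeWith : ℕ → ℕ → Word
decodeWith _       zero    = []
decodeWith zero    (suc _) = []
decodeWith (suc k) (suc m) = proj₁ (unpair m) ∷ decodeWith k (proj₂ (unpair m))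

decode : ℕ → Word
decode n = decodeWith n n

decode-encode : ∀ w → decode (encode w) ≡ w
decode-encode w = go (encode w) w ≤-refl
  where
  go : ∀ k w → encode w ≤ k → decodeWith k (encode w) ≡ w
  go _       []      _ = refl
  go (suc k) (n ∷ w) (s≤s le) rewrite unpair-pair n (encode w) =
    cong (n ∷_) (go k w (≤-trans (m≤n+m (encode w) (triangle (n + encode w))) le))

------------------------------------------------------------------------
-- Words, sequences and the prefix order

Seq : Set
Seq = ℕ → ℕ

baire : Setoid 0ℓ 0ℓ
baire = ℕ →-setoid ℕ

_↾_ : {A : Set} → (ℕ → A) → ℕ → List A
p ↾ n = applyUpTo p n

infix 4 _⊑_ _⊏_

_⊑_ : Word → Word → Set
_⊑_ = Prefix (_≡_ {A = ℕ})

_⊏_ : {A : Set} → List A → (ℕ → A) → Set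
w ⊏ p = w ≡ p ↾ length w

↾-cong : {A : Set} {p q : ℕ → A} → p ≗ q → ∀ n → p ↾ n ≡ q ↾ n
↾-cong eq zero    = refl
↾-cong eq (suc n) = cong₂ _∷_ (eq 0) (↾-cong (eq ∘ suc) n)

↾-injective : {A : Set} {p q : ℕ → A} → ∀ n → p ↾ n ≡ q ↾ n → ∀ i → i < n → p i ≡ q i
↾-injective (suc n) eq zero    _        = ∷-injectiveˡ eq
↾-injective (suc n) eq (suc i) (s≤s lt) = ↾-injective n (∷-injectiveʳ eq) i lt

⊏-resp : {A : Set} {w : List A} → (w ⊏_) Respects _≗_
⊏-resp {w = w} eq w⊏p = trans w⊏p (↾-cong eq (length w))

-- The infinite sequence r is the supremum of the words φ w with w a prefix of p.
IsSup : (Word → Word) → Seq → Seq → Set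
IsSup φ p r = (∀ n → φ (p ↾ n) ⊏ r) × (∀ k → ∃ λ n → k ≤ length (φ (p ↾ n)))

IsSup-resp : ∀ φ ψ p q {r s} → φ ≗ ψ → p ≗ q → r ≗ s → IsSup φ p r → IsSup ψ q s
IsSup-resp φ ψ p q φ≗ψ p≗q r≗s (bound , long) =
  (λ n → subst (_⊏ _) (eq n) (⊏-resp {w = φ (p ↾ n)} r≗s (bound n))) ,
  (λ k → proj₁ (long k) , subst (λ w → k ≤ length w) (eq _) (proj₂ (long k)))
  where
  eq : ∀ n → φ (p ↾ n) ≡ ψ (q ↾ n)
  eq n = trans (φ≗ψ (p ↾ n)) (cong ψ (↾-cong p≗q n))

IsSup-unique : ∀ φ p {r s} → IsSup φ p r → IsSup φ p s → r ≗ s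
IsSup-unique φ p (r-bound , long) (s-bound , _) i with long (suc i)
... | n , i<len = ↾-injective _ (trans (sym (r-bound n)) (s-bound n)) i i<len

Monotone : (Word → Word) → Set
Monotone φ = ∀ {v w} → v ⊑ w → φ v ⊑ φ w

ComputableWordFun : (Word → Word) → Set
ComputableWordFun φ = ∃ λ (e : Rec 1) → ∀ w → e [ encode w ∷ [] ]⇓ encode (φ w)

------------------------------------------------------------------------
-- Tupling

⟨_,_⟩ : Seq → Seq → Seq
⟨ q , p ⟩ zero    = q 0
⟨ q , p ⟩ (suc n) = ⟨ p , q ∘ suc ⟩ n

⟪_⟫ : (ℕ → Seq) → Seq
⟪ ps ⟫ n = ps (proj₁ (unpair n)) (proj₂ (unpair n))

⟨⟩-cong : ∀ q q′ p p′ → q ≗ q′ → p ≗ p′ → ⟨ q , p ⟩ ≗ ⟨ q′ , p′ ⟩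
⟨⟩-cong q q′ p p′ eq eq′ zero    = eq 0
⟨⟩-cong q q′ p p′ eq eq′ (suc n) = ⟨⟩-cong p p′ (q ∘ suc) (q′ ∘ suc) eq′ (eq ∘ suc) n

⟨⟩-injective : ∀ q q′ p p′ → ⟨ q , p ⟩ ≗ ⟨ q′ , p′ ⟩ → q ≗ q′ × p ≗ p′
⟨⟩-injective q q′ p p′ eq = go q q′ p p′ eq , go p p′ (q ∘ suc) (q′ ∘ suc) (eq ∘ suc)
  where
  go : ∀ q q′ p p′ → ⟨ q , p ⟩ ≗ ⟨ q′ , p′ ⟩ → q ≗ q′
  go q q′ p p′ eq zero    = eq 0
  go q q′ p p′ eq (suc n) = go (q ∘ suc) (q′ ∘ suc) (p ∘ suc) (p′ ∘ suc) (eq ∘ suc ∘ suc) n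

⟪⟫-injective : ∀ ps qs → ⟪ ps ⟫ ≗ ⟪ qs ⟫ → ∀ i → ps i ≗ qs i
⟪⟫-injective ps qs eq i j with eq (pair i j)
... | e rewrite unpair-pair i j = e

------------------------------------------------------------------------
-- Partial multivalued functions

-- The graph determines the function: the domain consists of the points with at
-- least one value.
record MultiFun (A : Setoid a ℓ₁) (B : Setoid b ℓ₂) (r : Level)
       : Set (a ⊔ b ⊔ ℓ₁ ⊔ ℓ₂ ⊔ lsuc r) where
  private
    module A = Setoid A
    module B = Setoid B
  field
    graph : A.Carrier → B.Carrier → Set r
    respˡ : graph Respectsˡ A._≈_
    respʳ : graph Respectsʳ B._≈_

  dom : Pred A.Carrier (b ⊔ r)
  dom x = ∃ λ y → graph x y

open MultiFun public

record PartialFun (A : Setoid a ℓ₁) (B : Setoid b ℓ₂) (r : Level)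
       : Set (a ⊔ b ⊔ ℓ₁ ⊔ ℓ₂ ⊔ lsuc r) where
  field
    multi  : MultiFun A B r
    single : ∀ {x y z} → graph multi x y → graph multi x z → Setoid._≈_ B y z

open PartialFun public

infixr 9 _∘ₘ_ _∘ₚ_

_∘ₘ_ : {A : Setoid a ℓ₁} {B : Setoid b ℓ₂} {C : Setoid c ℓ₃} →
       MultiFun B C s → MultiFun A B r → MultiFun A C (b ⊔ c ⊔ r ⊔ s)
_∘ₘ_ {A = A} g f = record
  { graph = λ x z → (∀ y → graph f x y → dom g y) × (∃ λ y → graph f x y × graph g y z)
  ; respˡ = λ x≈x′ (inc , y , fxy , gyz) →
      (λ y′ fx′y′ → inc y′ (respˡ f (Setoid.sym A x≈x′) fx′y′)) ,
      y , respˡ f x≈x′ fxy , gyz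
  ; respʳ = λ z≈z′ (inc , y , fxy , gyz) → inc , y , fxy , respʳ g z≈z′ gyz
  }

_∘ₚ_ : {A : Setoid a ℓ₁} {B : Setoid b ℓ₂} {C : Setoid c ℓ₃} →
       PartialFun B C s → PartialFun A B r → PartialFun A C (b ⊔ c ⊔ r ⊔ s)
_∘ₚ_ {C = C} g f = record
  { multi  = multi g ∘ₘ multi f
  ; single = λ (_ , y , fxy , gyz) (_ , y′ , fxy′ , gy′z′) →
      single g gyz (respˡ (multi g) (single f fxy′ fxy) gy′z′)
  }

inverse : {A : Setoid a ℓ₁} {B : Setoid b ℓ₂} → MultiFun A B r → MultiFun B A r
inverse f = record
  { graph = λ y x → graph f x y
  ; respˡ = respʳ f
  ; respʳ = respˡ f
  }

⟨id,_⟩ : PartialFun baire baire r → PartialFun baire baire r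
⟨id, F ⟩ = record
  { multi = record
    { graph = λ p y → ∃ λ r → graph (multi F) p r × y ≗ ⟨ p , r ⟩
    ; respˡ = λ {_} {p} {p′} p≗p′ (r , Fpr , eq) →
        r , respˡ (multi F) p≗p′ Fpr ,
        λ n → trans (eq n) (⟨⟩-cong p p′ r r p≗p′ (λ _ → refl) n)
    ; respʳ = λ y≗y′ (r , Fpr , eq) → r , Fpr , λ n → trans (sym (y≗y′ n)) (eq n)
    }
  ; single = λ {p} (r , Fpr , eq) (r′ , Fpr′ , eq′) n →
      trans (eq n) (trans (⟨⟩-cong p p r r′ (λ _ → refl) (single F Fpr Fpr′) n)
                          (sym (eq′ n)))
  }

⟨id×_⟩ : MultiFun baire baire r → MultiFun baire baire r
⟨id× f ⟩ = record
  { graph = λ x y → ∃ λ q → ∃₂ λ p r → x ≗ ⟨ q , p ⟩ × graph f p r × y ≗ ⟨ q , r ⟩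
  ; respˡ = λ x≗x′ (q , p , r , eq , fpr , eq′) →
      q , p , r , (λ n → trans (sym (x≗x′ n)) (eq n)) , fpr , eq′
  ; respʳ = λ y≗y′ (q , p , r , eq , fpr , eq′) →
      q , p , r , eq , fpr , (λ n → trans (sym (y≗y′ n)) (eq′ n))
  }

------------------------------------------------------------------------
-- Computable partial functions on Baire space

-- φ need only be correct on the domain of F; F may be a proper restriction.
Computable : PartialFun baire baire r → Set r
Computable F = ∃ λ φ → Monotone φ × ComputableWordFun φ ×
                       (∀ {p r} → graph (multi F) p r → IsSup φ p r)

------------------------------------------------------------------------
-- The universal function

extend : Word → Word → Word
extend u v = if does (prefix? _≟_ u v) then v else u

-- Turns an arbitrary word function into a monotone one by discarding every value
-- that does not extend the last value kept.
monotonise : (Word → Word) → Word → Word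
monotonise ψ w = foldl extend [] (map ψ (inits w))

foldl-inits : ∀ (ψ : Word → Word) u (n : ℕ) w →
              foldl extend u (map ψ (inits (n ∷ w))) ≡
              foldl extend (extend u (ψ [])) (map (ψ ∘ (n ∷_)) (inits w))
foldl-inits ψ u n w = cong (foldl extend (extend u (ψ []))) (sym (map-∘ {g = ψ} {f = n ∷_} (inits w)))

extend-⊑ : ∀ {u v} → u ⊑ v → extend u v ≡ v
extend-⊑ {u} {v} u⊑v rewrite dec-true (prefix? _≟_ u v) u⊑v = refl

monotonise-monotone : ∀ ψ → Monotone (monotonise ψ)
monotonise-monotone ψ = go ψ []
  where
  ⊑-refl : ∀ {u} → u ⊑ u
  ⊑-refl {[]}    = []
  ⊑-refl {_ ∷ _} = refl ∷ ⊑-refl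

  ⊑-trans : ∀ {u v w} → u ⊑ v → v ⊑ w → u ⊑ w
  ⊑-trans []         _          = []
  ⊑-trans (refl ∷ e) (refl ∷ f) = refl ∷ ⊑-trans e f

  ⊑-extend : ∀ u v → u ⊑ extend u v
  ⊑-extend u v with prefix? _≟_ u v
  ... | yes u⊑v = u⊑v
  ... | no  _   = ⊑-refl

  ⊑-foldl : ∀ u vs → u ⊑ foldl extend u vs
  ⊑-foldl u []       = ⊑-refl
  ⊑-foldl u (v ∷ vs) = ⊑-trans (⊑-extend u v) (⊑-foldl (extend u v) vs)

  go : ∀ ψ u {v w} → v ⊑ w →
       foldl extend u (map ψ (inits v)) ⊑ foldl extend u (map ψ (inits w))
  go ψ u {w = w} [] = ⊑-foldl (extend u (ψ [])) (map ψ (Inits.tail w))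
  go ψ u {n ∷ v} {n ∷ w} (refl ∷ e) =
    subst₂ _⊑_ (sym (foldl-inits ψ u n v)) (sym (foldl-inits ψ u n w))
      (go (ψ ∘ (n ∷_)) (extend u (ψ [])) e)

monotonise-fixes : ∀ {ψ} → Monotone ψ → monotonise ψ ≗ ψ
monotonise-fixes mono w = go w mono []
  where
  go : ∀ {ψ u} w → Monotone ψ → u ⊑ ψ [] → foldl extend u (map ψ (inits w)) ≡ ψ w
  go []          mono u⊑ψ = extend-⊑ u⊑ψ
  go {ψ} {u} (n ∷ w) mono u⊑ψ =
    trans (foldl-inits ψ u n w)
          (go w (λ v⊑w → mono (refl ∷ v⊑w))
                (subst (_⊑ ψ (n ∷ [])) (sym (extend-⊑ u⊑ψ)) (mono [])))

-- A name q is read as the table of a word function, with q (encode w) the code of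
-- its value at w.  Every table of a monotone function occurs, and monotonising
-- makes every q a name.
approx : Seq → Word → Word
approx q = monotonise (λ w → decode (q (encode w)))

approx-cong : ∀ {q q′} → q ≗ q′ → approx q ≗ approx q′
approx-cong eq w = cong (foldl extend []) (map-cong (λ v → cong decode (eq (encode v))) (inits w))

-- Φ_q has its natural domain: U ⟨q,p⟩ is defined whenever the supremum is infinite.
U : PartialFun baire baire 0ℓ
U = record
  { multi = record
    { graph = λ x r → ∃₂ λ q p → x ≗ ⟨ q , p ⟩ × IsSup (approx q) p r
    ; respˡ = λ x≗x′ (q , p , eq , sup) →
        q , p , (λ n → trans (sym (x≗x′ n)) (eq n)) , sup
    ; respʳ = λ r≗r′ (q , p , eq , sup) →
        q , p , eq , IsSup-resp (approx q) (approx q) p p (λ _ → refl) (λ _ → refl) r≗r′ sup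
    }
  ; single = λ (q , p , eq , sup) (q′ , p′ , eq′ , sup′) →
      let q′≗q , p′≗p = ⟨⟩-injective q′ q p′ p (λ n → trans (sym (eq′ n)) (eq n))
      in IsSup-unique (approx q) p sup
           (IsSup-resp (approx q′) (approx q) p′ p (approx-cong q′≗q) p′≗p (λ _ → refl) sup′)
  }

------------------------------------------------------------------------
-- Represented spaces and problems

record RepresentedSpace (c ℓ : Level) : Set (lsuc (c ⊔ ℓ)) where
  field
    space      : Setoid c ℓ
    δ          : PartialFun baire space 0ℓ
    surjective : ∀ x → ∃ λ p → graph (multi δ) p x

open RepresentedSpace public

record Problem (X : RepresentedSpace a ℓ₁) (Y : RepresentedSpace b ℓ₂) (r : Level)
       : Set (a ⊔ b ⊔ ℓ₁ ⊔ ℓ₂ ⊔ lsuc r) where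
  constructor problem
  field
    fun : MultiFun (space X) (space Y) r

open Problem public

module _ {X : RepresentedSpace a ℓ₁} {Y : RepresentedSpace b ℓ₂} where

  infix 4 _⊢_

  _⊢_ : PartialFun baire baire 0ℓ → Problem X Y r → Set (a ⊔ b ⊔ r)
  F ⊢ f = ∀ p → dom fδ p → ∃ λ y → graph (multi (δ Y ∘ₚ F)) p y × graph fδ p y
    where fδ = fun f ∘ₘ multi (δ X)

  realizerVersion : Problem X Y r → MultiFun baire baire (a ⊔ b ⊔ r)
  realizerVersion f = inverse (multi (δ Y)) ∘ₘ fun f ∘ₘ multi (δ X)

------------------------------------------------------------------------
-- Weihrauch reducibility

module _ {a ℓ₁ b ℓ₂ a′ ℓ₃ b′ ℓ₄ : Level}
         {X : RepresentedSpace a ℓ₁} {Y : RepresentedSpace b ℓ₂}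
         {X′ : RepresentedSpace a′ ℓ₃} {Y′ : RepresentedSpace b′ ℓ₄} where

  infix 4 _≤W_

  _≤W_ : Problem X Y r → Problem X′ Y′ s → Set (lsuc 0ℓ ⊔ a ⊔ b ⊔ r ⊔ a′ ⊔ b′ ⊔ s)
  f ≤W g = ∃₂ λ (H K : PartialFun baire baire 0ℓ) → Computable H × Computable K ×
           (∀ G → G ⊢ g → H ∘ₚ ⟨id, G ∘ₚ K ⟩ ⊢ f)

module _ {a ℓ₁ b ℓ₂ a′ ℓ₃ b′ ℓ₄ : Level}
         {X : RepresentedSpace a ℓ₁} {Y : RepresentedSpace b ℓ₂}
         {X′ : RepresentedSpace a′ ℓ₃} {Y′ : RepresentedSpace b′ ℓ₄} where

  infix 4 _≡W_ _<W_

  _≡W_ : Problem X Y r → Problem X′ Y′ s → Set (lsuc 0ℓ ⊔ a ⊔ b ⊔ r ⊔ a′ ⊔ b′ ⊔ s)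
  f ≡W g = f ≤W g × g ≤W f

  _<W_ : Problem X Y r → Problem X′ Y′ s → Set (lsuc 0ℓ ⊔ a ⊔ b ⊔ r ⊔ a′ ⊔ b′ ⊔ s)
  f <W g = f ≤W g × ¬ (g ≤W f)

------------------------------------------------------------------------
-- ℕ, Cantor space and Baire space

record BasedSpace : Set₁ where
  field
    represented : RepresentedSpace 0ℓ 0ℓ
  open Setoid (space represented) public using (Carrier; _≈_)
  field
    base      : ℕ → Pred Carrier 0ℓ
    base-resp : ∀ k → base k Respects _≈_

open BasedSpace public using (represented)

ℕᴿ : BasedSpace
ℕᴿ = record
  { represented = record
    { space = setoid ℕ
    ; δ = record
      { multi = record
        { graph = λ p n → p 0 ≡ n
        ; respˡ = λ p≗q eq → trans (sym (p≗q 0)) eq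
        ; respʳ = λ m≡n eq → trans eq m≡n
        }
      ; single = λ eq eq′ → trans (sym eq) eq′
      }
    ; surjective = λ n → (λ _ → n) , refl
    }
  ; base = λ k n → n ≡ k
  ; base-resp = λ k m≡n eq → trans (sym m≡n) eq
  }

bit : Bool → ℕ
bit false = 0
bit true  = 1

nonzero : ℕ → Bool
nonzero zero    = false
nonzero (suc _) = true

bit-injective : ∀ {x y} → bit x ≡ bit y → x ≡ y
bit-injective {false} {false} _ = refl
bit-injective {true}  {true}  _ = refl

2^ℕ : BasedSpace
2^ℕ = record
  { represented = record
    { space = ℕ →-setoid Bool
    ; δ = record
      { multi = record
        { graph = λ p x → p ≗ bit ∘ x
        ; respˡ = λ p≗q eq n → trans (sym (p≗q n)) (eq n)
        ; respʳ = λ x≗y eq n → trans (eq n) (cong bit (x≗y n))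
        }
      ; single = λ eq eq′ n → bit-injective (trans (sym (eq n)) (eq′ n))
      }
    ; surjective = λ x → bit ∘ x , λ _ → refl
    }
    -- Every binary word occurs, since nonzero (bit x) ≡ x.
  ; base = λ k x → map nonzero (decode k) ⊏ x
  ; base-resp = λ k → ⊏-resp {w = map nonzero (decode k)}
  }

ℕ^ℕ : BasedSpace
ℕ^ℕ = record
  { represented = record
    { space = baire
    ; δ = record
      { multi = record
        { graph = _≗_
        ; respˡ = λ p≗q eq n → trans (sym (p≗q n)) (eq n)
        ; respʳ = λ x≗y eq n → trans (eq n) (x≗y n)
        }
      ; single = λ eq eq′ n → trans (sym (eq n)) (eq′ n)
      }
    ; surjective = λ x → x , λ _ → refl
    }
  ; base = λ k x → decode k ⊏ x
  ; base-resp = λ k → ⊏-resp {w = decode k}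
  }

------------------------------------------------------------------------
-- Closed sets by negative information, and closed choice

module Negative (X : BasedSpace) where
  open BasedSpace X hiding (represented)

  -- Entries suc k enumerate the basic open set number k and entries 0 enumerate
  -- nothing, so that the empty union has a name.
  Enumerated : Seq → Pred Carrier 0ℓ
  Enumerated p x = ∃₂ λ n k → p n ≡ suc k × base k x

  Names : Seq → Pred Carrier 0ℓ → Set
  Names p B = ∀ x → B x ⇔ (¬ Enumerated p x)

  -- The base is countable, so the open sets are exactly the enumerated unions.
  record Closed : Set₁ where
    field
      _∋_         : Pred Carrier 0ℓ
      enumeration : ∃ λ p → Names p _∋_

  open Closed public

  enumerated-resp : ∀ {p q x y} → p ≗ q → x ≈ y → Enumerated p x → Enumerated q y
  enumerated-resp p≗q x≈y (n , k , eq , bx) =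
    n , k , trans (sym (p≗q n)) eq , base-resp k x≈y bx

  names-resp : ∀ {p q B} → p ≗ q → Names p B → Names q B
  names-resp p≗q names x = ⇔-trans (names x) (mk⇔
    (λ ¬e e → ¬e (enumerated-resp (λ n → sym (p≗q n)) (Setoid.refl (space (represented X))) e))
    (λ ¬e e → ¬e (enumerated-resp p≗q (Setoid.refl (space (represented X))) e)))

  closedSets : Setoid (lsuc 0ℓ) 0ℓ
  closedSets = record
    { Carrier = Closed
    ; _≈_ = λ A B → ∀ x → (A ∋ x) ⇔ (B ∋ x)
    ; isEquivalence = record
      { refl  = λ _ → ⇔-refl
      ; sym   = λ eq x → ⇔-sym (eq x)
      ; trans = λ eq eq′ x → ⇔-trans (eq x) (eq′ x)
      }
    }

  𝒜₋ : RepresentedSpace (lsuc 0ℓ) 0ℓ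
  𝒜₋ = record
    { space = closedSets
    ; δ = record
      { multi = record
        { graph = λ p B → Names p (B ∋_)
        ; respˡ = λ {B} p≗q names → names-resp {B = B ∋_} p≗q names
        ; respʳ = λ A≈B names x → ⇔-trans (⇔-sym (A≈B x)) (names x)
        }
      ; single = λ names names′ x → ⇔-trans (names x) (⇔-sym (names′ x))
      }
    ; surjective = enumeration
    }

  choice : Problem 𝒜₋ (represented X) 0ℓ
  choice = problem record
    { graph = _∋_
    ; respˡ = λ {x} A≈B → Equivalence.to (A≈B x)
    ; respʳ = λ {B} {x} {y} x≈y B∋x →
        let names = proj₂ (enumeration B)
        in Equivalence.from (names y) λ e → Equivalence.to (names x) B∋x
             (enumerated-resp (λ _ → refl) (Setoid.sym (space (represented X)) x≈y) e)
    }

C : (X : BasedSpace) → Problem (Negative.𝒜₋ X) (represented X) 0ℓ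
C X = Negative.choice X

------------------------------------------------------------------------
-- The limit map

ConvergesTo : (ℕ → Seq) → Seq → Set
ConvergesTo ps r = ∀ k → ∃ λ m → ∀ i → m ≤ i → ps i ↾ k ≡ r ↾ k

lim : Problem (represented ℕ^ℕ) (represented ℕ^ℕ) 0ℓ
lim = problem record
  { graph = λ p r → ∃ λ ps → p ≗ ⟪ ps ⟫ × ConvergesTo ps r
  ; respˡ = λ p≗q (ps , eq , conv) → ps , (λ n → trans (sym (p≗q n)) (eq n)) , conv
  ; respʳ = λ r≗s (ps , eq , conv) → ps , eq , λ k →
      proj₁ (conv k) , λ i m≤i → trans (proj₂ (conv k) i m≤i) (↾-cong r≗s k)
  }

------------------------------------------------------------------------
-- The infinite loop

loopStep : MultiFun baire baire r → MultiFun baire baire r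
loopStep f = multi U ∘ₘ ⟨id× f ⟩

-- Stage R q₀ i is the set of points reached from q₀ after i steps.
data Stage (R : MultiFun baire baire r) (q₀ : Seq) : ℕ → Pred Seq r where
  start : ∀ {q} → q ≗ q₀ → Stage R q₀ 0 q
  step  : ∀ {i p q} → Stage R q₀ i p → graph R p q → Stage R q₀ (suc i) q

Stage-resp : ∀ {R : MultiFun baire baire r} {p₀ q₀ i q} →
             p₀ ≗ q₀ → Stage R p₀ i q → Stage R q₀ i q
Stage-resp eq (start q≗p₀) = start (λ n → trans (q≗p₀ n) (eq n))
Stage-resp eq (step st e)  = step (Stage-resp eq st) e

loop : MultiFun baire baire r → MultiFun baire baire r
loop f = record
  { graph = λ q₀ r →
      (∀ i q → Stage R q₀ i q → dom R q) ×
      (∃ λ qs → qs 0 ≗ q₀ × (∀ i → graph R (qs i) (qs (suc i))) × r ≗ ⟪ qs ⟫)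
  ; respˡ = λ p₀≗q₀ (safe , qs , eq , run , res) →
      (λ i q st → safe i q (Stage-resp (λ n → sym (p₀≗q₀ n)) st)) ,
      qs , (λ n → trans (eq n) (p₀≗q₀ n)) , run , res
  ; respʳ = λ r≗s (safe , qs , eq , run , res) →
      safe , qs , eq , run , (λ n → trans (sym (r≗s n)) (res n))
  }
  where R = loopStep f

infix 10 _^∞

-- For problems on Baire space, such as lim, the realizer version has the same
-- graph as the problem itself.
_^∞ : {X : RepresentedSpace a ℓ₁} {Y : RepresentedSpace b ℓ₂} → Problem X Y r →
      Problem (represented ℕ^ℕ) (represented ℕ^ℕ) (a ⊔ b ⊔ r)
f ^∞ = problem (loop (realizerVersion f))

{-# OPTIONS --safe #-}
module Submission where

-- A problem reduces to its infinite loop once a program can output itself next to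
-- the data for the following round.  Such programs exist because a name is the table
-- of a word function: the entry at a word w only has to produce |w| symbols, hence
-- only involves earlier entries, and the table is defined by recursion.
--
-- Conversely, all rounds of a loop over closed choice on a sequence space are merged
-- into a single closed set of sequences of choices: that some column violates the
-- constraint of its round is visible from finite information.  For choice on the
-- numbers, the choices are guessed from finite information instead; the guess of
-- each round changes finitely often, so lim finds them.
--
-- Both separations are finite extension arguments.  For choice on the numbers, every
-- number is eventually excluded, as an answer that can no longer be excluded would
-- make the limit map continuous.  Two rounds of lim decide whether a sequence has
-- infinitely many zeros, whereas the approximations to a single use of lim are
-- forced to deny this infinitely often along a sequence that has them.

open import Data.Empty using (⊥)
open import Data.Bool.Base using (true; false)
open import Axiom.ExcludedMiddle using (ExcludedMiddle)
open import Data.Fin.Base using (Fin; zero; suc)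
open import Data.List.Base using (List; []; _∷_; length; foldl; inits; map)
open import Data.List.Properties using (length-applyUpTo; map-id; ∷-injectiveˡ; ∷-injectiveʳ)
open import Data.List.Relation.Binary.Prefix.Heterogeneous using ([]; _∷_)
open import Data.List.Relation.Binary.Prefix.Heterogeneous.Properties using (prefix?)
open import Data.Nat.Base
open import Data.Nat.Properties
open import Data.Product.Base using (∃; ∃₂; _×_; _,_; proj₁; proj₂)
open import Data.Sum.Base using (_⊎_; inj₁; inj₂)
open import Data.Unit.Base using (⊤; tt)
open import Data.Vec.Base as Vec using (Vec; []; _∷_)
open import Data.Vec.Properties using (tabulate∘lookup)
open import Function.Base using (_∘_; id; case_of_)
open import Function.Bundles using (_⇔_; mk⇔; Equivalence)
open import Level using (Level; 0ℓ)
open import Relation.Binary.Bundles using (Setoid)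
open import Relation.Binary.PropositionalEquality
  using (_≡_; refl; sym; trans; cong; cong₂; subst; subst₂; _≗_; module ≡-Reasoning)
open import Relation.Nullary.Decidable using (does; yes; no)
open import Relation.Nullary.Negation.Core using (¬_; contradiction)
open import Defs

-- Recursive functions of numbers and words

-- The loop outputs its points `q_i`, not the answers given on the way. A reduction to a loop
-- therefore has to hide each answer in the next instance while keeping that instance solvable. For
-- `lim` the answer is repeated as every row. On a sequence space it is written into excluded
-- cylinders that miss it. On the numbers it becomes an excluded number that the next round would
-- reject anyway.
--
-- The domain of a loop concerns every sequence of correct answers. To show membership, an invariant
-- must survive all answers and not just chosen ones. To use membership, any correct answers,
-- however they were found, can be fed to the loop and its programs are defined on them. This is why
-- a reduction of a loop to another problem only has to find answers: the points are then recomputed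
-- by rerunning the programs on finite words.
--
-- Excluded middle supplies the least number missing from an enumeration and the truth values that
-- serve as instances in the separations.

data Ty : Set where
  nat word : Ty

Val : Ty → Set
Val nat  = ℕ
Val word = Word

⌜_⌝ : ∀ {A} → Val A → ℕ
⌜_⌝ {nat}  n = n
⌜_⌝ {word} w = encode w

Env : List Ty → Set
Env []      = ⊤
Env (A ∷ Γ) = Val A × Env Γ

codes : ∀ {Γ} → Env Γ → Vec ℕ (length Γ)
codes {[]}    _       = []
codes {A ∷ Γ} (a , γ) = ⌜_⌝ {A} a ∷ codes γ

-- The context is typed, while programs only see codes. The combinators below follow the shape of
-- expressions with de Bruijn variables `v₀`, `v₁`, ..., so a function is shown recursive by writing
-- its definition a second time.
record Recursive {Γ : List Ty} {A : Ty} (f : Env Γ → Val A) : Set where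
  constructor recursive
  field
    program : Rec (length Γ)
    correct : ∀ γ → program [ codes γ ]⇓ ⌜_⌝ {A} (f γ)

private
  variable
    Γ : List Ty
    A B : Ty
    a b c ℓ ℓ₁ ℓ₂ ℓ₃ ℓ₄ : Level

iter : {A : Set} → A → (ℕ → A → A) → ℕ → A
iter z s zero    = z
iter z s (suc n) = s n (iter z s n)

caseℕ : {A : Set} → ℕ → A → (ℕ → A) → A
caseℕ zero    z s = z
caseℕ (suc n) z s = s n

projections : ∀ {m n} (σ : Fin m → Fin n) xs →
              Vec.tabulate (λ i → proj (σ i)) [ xs ]⇓* Vec.tabulate (λ i → Vec.lookup xs (σ i))
projections {zero}  σ xs = []
projections {suc m} σ xs = proj⇓ (σ zero) ∷ projections (σ ∘ suc) xs

weakenings : ∀ {n} (xs : Vec ℕ n) x → Vec.tabulate (λ i → proj (suc i)) [ x ∷ xs ]⇓* xs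
weakenings xs x = subst (Vec.tabulate (λ i → proj (suc i)) [ x ∷ xs ]⇓*_) (tabulate∘lookup xs)
                        (projections suc (x ∷ xs))

weakenings₂ : ∀ {n} (xs : Vec ℕ n) x y → Vec.tabulate (λ i → proj (suc (suc i))) [ x ∷ y ∷ xs ]⇓* xs
weakenings₂ xs x y = subst (Vec.tabulate (λ i → proj (suc (suc i))) [ x ∷ y ∷ xs ]⇓*_) (tabulate∘lookup xs)
                           (projections (λ i → suc (suc i)) (x ∷ y ∷ xs))

identities : ∀ {n} (xs : Vec ℕ n) → Vec.tabulate proj [ xs ]⇓* xs
identities xs = subst (Vec.tabulate proj [ xs ]⇓*_) (tabulate∘lookup xs) (projections id xs)

ext : ∀ {f g : Env Γ → Val A} → (∀ γ → f γ ≡ g γ) → Recursive f → Recursive g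
ext {Γ} {A} eq (recursive e c) = recursive e λ γ → subst (λ a → e [ codes γ ]⇓ ⌜_⌝ {A} a) (eq γ) (c γ)

wk : ∀ {f : Env Γ → Val A} → Recursive f → Recursive {B ∷ Γ} (f ∘ proj₂)
wk (recursive e c) = recursive (comp e (Vec.tabulate (λ i → proj (suc i))))
                               λ (b , γ) → comp⇓ (weakenings (codes γ) _) (c γ)

v₀ : Recursive {A ∷ Γ} {A} proj₁
v₀ = recursive (proj zero) λ _ → proj⇓ zero

zeroᵣ : Recursive {Γ} {nat} λ _ → 0
zeroᵣ = recursive zero λ _ → zero⇓

sucᵣ : ∀ {f} → Recursive {Γ} {nat} f → Recursive {Γ} {nat} λ γ → suc (f γ)
sucᵣ (recursive e c) = recursive (comp succ (e ∷ [])) λ γ → comp⇓ (c γ ∷ []) succ⇓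

iterᵣ : ∀ {n} {z : Env Γ → Val A} {s} → Recursive {Γ} {nat} n → Recursive z →
        Recursive {nat ∷ A ∷ Γ} {A} s →
        Recursive {Γ} {A} λ γ → iter (z γ) (λ k a → s (k , a , γ)) (n γ)
iterᵣ {Γ} {A} {n} {z} {s} (recursive en cn) (recursive ez cz) (recursive es cs) =
  recursive (comp (prec ez es) (en ∷ Vec.tabulate proj))
            λ γ → comp⇓ (cn γ ∷ identities (codes γ)) (go γ (n γ))
  where
  go : ∀ γ k → prec ez es [ k ∷ codes γ ]⇓ ⌜_⌝ {A} (iter (z γ) (λ k a → s (k , a , γ)) k)
  go γ zero    = prec-zero⇓ (cz γ)
  go γ (suc k) = prec-suc⇓ (go γ k) (cs (k , _ , γ))

wk₁ : ∀ {C} {f : Env (B ∷ Γ) → Val A} → Recursive f → Recursive {B ∷ C ∷ Γ} λ (b , _ , γ) → f (b , γ)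
wk₁ {B = B} {C = C} (recursive e c) = recursive
  (comp e (proj zero ∷ Vec.tabulate (λ i → proj (suc (suc i)))))
  λ (b , a , γ) → comp⇓ (proj⇓ zero ∷ weakenings₂ (codes γ) _ _) (c (b , γ))

-- Case distinction is iteration with a step that ignores the accumulator: only the last index
-- survives.
caseᵣ : ∀ {n} {z : Env Γ → Val A} {s} → Recursive {Γ} {nat} n → Recursive z →
        Recursive {nat ∷ Γ} {A} s →
        Recursive {Γ} {A} λ γ → caseℕ (n γ) (z γ) (λ k → s (k , γ))
caseᵣ {n = n} {z} {s} rn rz rs = ext (λ γ → go (n γ) γ) (iterᵣ rn rz (wk₁ rs))
  where
  go : ∀ k γ → iter (z γ) (λ k a → s (k , γ)) k ≡ caseℕ k (z γ) (λ k → s (k , γ))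
  go zero    γ = refl
  go (suc k) γ = refl

letᵣ : ∀ {a} {f : Env (A ∷ Γ) → Val B} → Recursive {Γ} {A} a → Recursive f →
       Recursive {Γ} {B} λ γ → f (a γ , γ)
letᵣ (recursive e c) (recursive e′ c′) =
  recursive (comp e′ (e ∷ Vec.tabulate proj)) λ γ → comp⇓ (c γ ∷ identities (codes γ)) (c′ (_ , γ))

record Arguments {Γ Δ : List Ty} (σ : Env Γ → Env Δ) : Set where
  constructor arguments
  field
    programs : Vec (Rec (length Γ)) (length Δ)
    correct  : ∀ γ → programs [ codes γ ]⇓* codes (σ γ)

infixr 5 _∷ₐ_

[]ₐ : Arguments {Γ} {[]} λ _ → tt
[]ₐ = arguments [] λ _ → []

_∷ₐ_ : ∀ {Δ f} {σ : Env Γ → Env Δ} → Recursive {Γ} {A} f → Arguments σ → Arguments {Γ} {A ∷ Δ} λ γ → f γ , σ γ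
recursive e c ∷ₐ arguments es cs = arguments (e ∷ es) λ γ → c γ ∷ cs γ

callᵣ : ∀ {Δ f} {σ : Env Γ → Env Δ} → Recursive {Δ} {A} f → Arguments σ → Recursive {Γ} {A} λ γ → f (σ γ)
callᵣ {σ = σ} (recursive e c) (arguments es cs) = recursive (comp e es) λ γ → comp⇓ (cs γ) (c (σ γ))

v₁ : Recursive {B ∷ A ∷ Γ} {A} (proj₁ ∘ proj₂)
v₁ = wk v₀

v₂ : ∀ {C} → Recursive {C ∷ B ∷ A ∷ Γ} {A} (proj₁ ∘ proj₂ ∘ proj₂)
v₂ = wk v₁

v₃ : ∀ {C D} → Recursive {D ∷ C ∷ B ∷ A ∷ Γ} {A} (proj₁ ∘ proj₂ ∘ proj₂ ∘ proj₂)
v₃ = wk v₂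

-- Arithmetic

π₁ π₂ : ℕ → ℕ
π₁ n = proj₁ (unpair n)
π₂ n = proj₂ (unpair n)

π₁-pair : ∀ i j → π₁ (pair i j) ≡ i
π₁-pair i j = cong proj₁ (unpair-pair i j)

π₂-pair : ∀ i j → π₂ (pair i j) ≡ j
π₂-pair i j = cong proj₂ (unpair-pair i j)

pair-next : ∀ x → pair (proj₁ (next x)) (proj₂ (next x)) ≡ suc (pair (proj₁ x) (proj₂ x))
pair-next (zero , j)  rewrite +-identityʳ j = cong suc (trans (+-identityʳ (j + triangle j)) (+-comm j (triangle j)))
pair-next (suc i , j) rewrite +-suc i j = cong suc (+-suc (i + j + triangle (i + j)) j)

pair-π : ∀ n → pair (π₁ n) (π₂ n) ≡ n
pair-π zero    = refl
pair-π (suc n) = trans (pair-next (unpair n)) (cong suc (pair-π n))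

-- The sum of the two components of `unpair n`, found without carrying pairs through the recursion.
-- The position on diagonal `d` is `n ∸ triangle d`; the next number starts a new diagonal exactly
-- when this position has reached `d`.
diagonal : ℕ → ℕ
diagonal = iter 0 λ n d → caseℕ (d ∸ (n ∸ triangle d)) (suc d) λ _ → d

diagonal-π : ∀ n → diagonal n ≡ π₁ n + π₂ n
diagonal-π zero = refl
diagonal-π (suc n)
  with unpair n | diagonal n | diagonal-π n | pair-π n
... | i , j | _ | refl | refl rewrite m+n∸m≡n (triangle (i + j)) j | m+n∸n≡m i j = go i
  where
  go : ∀ i → caseℕ i (suc (i + j)) (λ _ → i + j) ≡ proj₁ (next (i , j)) + proj₂ (next (i , j))
  go zero    = cong suc (sym (+-identityʳ j))
  go (suc i) = sym (+-suc i j)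

π₂-diagonal : ∀ n → n ∸ triangle (diagonal n) ≡ π₂ n
π₂-diagonal n rewrite diagonal-π n = begin
  n ∸ triangle (π₁ n + π₂ n)                    ≡⟨ cong (_∸ triangle (π₁ n + π₂ n)) (pair-π n) ⟨
  pair (π₁ n) (π₂ n) ∸ triangle (π₁ n + π₂ n)   ≡⟨ m+n∸m≡n (triangle (π₁ n + π₂ n)) (π₂ n) ⟩
  π₂ n                                          ∎
  where open ≡-Reasoning

π₁-diagonal : ∀ n → diagonal n ∸ π₂ n ≡ π₁ n
π₁-diagonal n rewrite diagonal-π n = m+n∸n≡m (π₁ n) (π₂ n)

predᵣ : ∀ {f} → Recursive {Γ} {nat} f → Recursive {Γ} {nat} λ γ → pred (f γ)
predᵣ {f = f} rf = ext (λ γ → go (f γ)) (caseᵣ rf zeroᵣ v₀)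
  where
  go : ∀ n → caseℕ n 0 (λ k → k) ≡ pred n
  go zero    = refl
  go (suc n) = refl

infixl 6 _+ᵣ_ _∸ᵣ_

_+ᵣ_ : ∀ {f g} → Recursive {Γ} {nat} f → Recursive {Γ} {nat} g → Recursive {Γ} {nat} λ γ → f γ + g γ
_+ᵣ_ {f = f} {g} rf rg = ext (λ γ → go (f γ) (g γ)) (iterᵣ rf rg (sucᵣ v₁))
  where
  go : ∀ m n → iter n (λ _ a → suc a) m ≡ m + n
  go zero    n = refl
  go (suc m) n = cong suc (go m n)

_∸ᵣ_ : ∀ {f g} → Recursive {Γ} {nat} f → Recursive {Γ} {nat} g → Recursive {Γ} {nat} λ γ → f γ ∸ g γ
_∸ᵣ_ {f = f} {g} rf rg = ext (λ γ → go (f γ) (g γ)) (iterᵣ rg rf (predᵣ v₁))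
  where
  go : ∀ m n → iter m (λ _ a → pred a) n ≡ m ∸ n
  go m zero    = refl
  go m (suc n) = trans (cong pred (go m n)) (pred[m∸n]≡m∸[1+n] m n)

triangleᵣ : ∀ {f} → Recursive {Γ} {nat} f → Recursive {Γ} {nat} λ γ → triangle (f γ)
triangleᵣ {f = f} rf = ext (λ γ → go (f γ)) (iterᵣ rf zeroᵣ (sucᵣ v₀ +ᵣ v₁))
  where
  go : ∀ n → iter 0 (λ k a → suc k + a) n ≡ triangle n
  go zero    = refl
  go (suc n) = cong (suc n +_) (go n)

diagonalᵣ : ∀ {f} → Recursive {Γ} {nat} f → Recursive {Γ} {nat} λ γ → diagonal (f γ)
diagonalᵣ rf = iterᵣ rf zeroᵣ (caseᵣ (v₁ ∸ᵣ (v₀ ∸ᵣ triangleᵣ v₁)) (sucᵣ v₁) v₂)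

π₂ᵣ : ∀ {f} → Recursive {Γ} {nat} f → Recursive {Γ} {nat} λ γ → π₂ (f γ)
π₂ᵣ {f = f} rf = ext (λ γ → π₂-diagonal (f γ)) (rf ∸ᵣ triangleᵣ (diagonalᵣ rf))

π₁ᵣ : ∀ {f} → Recursive {Γ} {nat} f → Recursive {Γ} {nat} λ γ → π₁ (f γ)
π₁ᵣ {f = f} rf = ext (λ γ → π₁-diagonal (f γ)) (diagonalᵣ rf ∸ᵣ π₂ᵣ rf)

pairᵣ : ∀ {f g} → Recursive {Γ} {nat} f → Recursive {Γ} {nat} g → Recursive {Γ} {nat} λ γ → pair (f γ) (g γ)
pairᵣ rf rg = triangleᵣ (rf +ᵣ rg) +ᵣ rg

-- Words

n≤triangle : ∀ n → n ≤ triangle n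
n≤triangle zero    = z≤n
n≤triangle (suc n) = m≤m+n (suc n) (triangle n)

i≤pair : ∀ i j → i ≤ pair i j
i≤pair i j = ≤-trans (m≤m+n i j) (≤-trans (n≤triangle (i + j)) (m≤m+n (triangle (i + j)) j))

j≤pair : ∀ i j → j ≤ pair i j
j≤pair i j = m≤n+m j (triangle (i + j))

triangle-mono : ∀ {m n} → m ≤ n → triangle m ≤ triangle n
triangle-mono z≤n       = z≤n
triangle-mono (s≤s m≤n) = +-mono-≤ (s≤s m≤n) (triangle-mono m≤n)

pair-mono : ∀ {i i′ j j′} → i ≤ i′ → j ≤ j′ → pair i j ≤ pair i′ j′
pair-mono i≤ j≤ = +-mono-≤ (triangle-mono (+-mono-≤ i≤ j≤)) j≤

π₁≤ : ∀ n → π₁ n ≤ n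
π₁≤ n = subst (π₁ n ≤_) (pair-π n) (i≤pair (π₁ n) (π₂ n))

π₂≤ : ∀ n → π₂ n ≤ n
π₂≤ n = subst (π₂ n ≤_) (pair-π n) (j≤pair (π₁ n) (π₂ n))

encode-decode : ∀ n → encode (decode n) ≡ n
encode-decode n = go n n ≤-refl
  where
  go : ∀ k n → n ≤ k → encode (decodeWith k n) ≡ n
  go k       zero    _        = refl
  go (suc k) (suc n) (s≤s le) =
    cong suc (trans (cong (pair (π₁ n)) (go k (π₂ n) (≤-trans (π₂≤ n) le))) (pair-π n))

length≤encode : ∀ w → length w ≤ encode w
length≤encode []      = z≤n
length≤encode (n ∷ w) = s≤s (≤-trans (length≤encode w) (j≤pair n (encode w)))

-- The coding of words is bijective, so passing between a word and its code needs no program of its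
-- own.
recode : ∀ {f : Env Γ → Val A} {g : Env Γ → Val B} → (∀ γ → ⌜_⌝ {A} (f γ) ≡ ⌜_⌝ {B} (g γ)) →
         Recursive f → Recursive g
recode eq (recursive e c) = recursive e λ γ → subst (e [ codes γ ]⇓_) (eq γ) (c γ)

encodeᵣ : ∀ {w} → Recursive {Γ} {word} w → Recursive {Γ} {nat} λ γ → encode (w γ)
encodeᵣ = recode λ _ → refl

decodeᵣ : ∀ {n} → Recursive {Γ} {nat} n → Recursive {Γ} {word} λ γ → decode (n γ)
decodeᵣ {n = n} = recode λ γ → sym (encode-decode (n γ))

[]ᵣ : Recursive {Γ} {word} λ _ → []
[]ᵣ = recode (λ _ → refl) zeroᵣ

infixr 5 _∷ᵣ_

_∷ᵣ_ : ∀ {n w} → Recursive {Γ} {nat} n → Recursive {Γ} {word} w → Recursive {Γ} {word} λ γ → n γ ∷ w γ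
rn ∷ᵣ rw = recode (λ _ → refl) (sucᵣ (pairᵣ rn (encodeᵣ rw)))

tail : Word → Word
tail []      = []
tail (_ ∷ w) = w

-- Partial values: 0 stands for "undefined" and suc n for the value n.

head? : Word → ℕ
head? []      = 0
head? (n ∷ w) = suc n

at? : Word → ℕ → ℕ
at? []      _       = 0
at? (n ∷ w) zero    = suc n
at? (n ∷ w) (suc i) = at? w i

tailᵣ : ∀ {w} → Recursive {Γ} {word} w → Recursive {Γ} {word} λ γ → tail (w γ)
tailᵣ {w = w} rw = recode (λ γ → go (w γ)) (caseᵣ (encodeᵣ rw) zeroᵣ (π₂ᵣ v₀))
  where
  go : ∀ w → caseℕ (encode w) 0 π₂ ≡ encode (tail w)
  go []      = refl
  go (n ∷ w) = π₂-pair n (encode w)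

head?ᵣ : ∀ {w} → Recursive {Γ} {word} w → Recursive {Γ} {nat} λ γ → head? (w γ)
head?ᵣ {w = w} rw = recode (λ γ → go (w γ)) (caseᵣ (encodeᵣ rw) zeroᵣ (sucᵣ (π₁ᵣ v₀)))
  where
  go : ∀ w → caseℕ (encode w) 0 (suc ∘ π₁) ≡ head? w
  go []      = refl
  go (n ∷ w) = cong suc (π₁-pair n (encode w))

at?ᵣ : ∀ {w i} → Recursive {Γ} {word} w → Recursive {Γ} {nat} i → Recursive {Γ} {nat} λ γ → at? (w γ) (i γ)
at?ᵣ {w = w} {i} rw ri = ext (λ γ → go (w γ) (i γ)) (head?ᵣ (iterᵣ ri rw (tailᵣ v₁)))
  where
  tail-iter : ∀ w i → iter w (λ _ → tail) (suc i) ≡ iter (tail w) (λ _ → tail) i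
  tail-iter w zero    = refl
  tail-iter w (suc i) = cong tail (tail-iter w i)

  go : ∀ w i → head? (iter w (λ _ → tail) i) ≡ at? w i
  go []      zero    = refl
  go []      (suc i) = trans (cong head? (tail-iter [] i)) (go [] i)
  go (n ∷ w) zero    = refl
  go (n ∷ w) (suc i) = trans (cong head? (tail-iter (n ∷ w) i)) (go w i)

-- Cutting at the first undefined value yields a prefix of the intended sequence as soon as the
-- defined values of `g` are right, however many are still missing.
collect : ℕ → (ℕ → ℕ) → Word
collect zero    g = []
collect (suc k) g = caseℕ (g 0) [] λ n → n ∷ collect k (g ∘ suc)

caseℕ-cong : ∀ {A : Set} {m n : ℕ} {z : A} {s t : ℕ → A} → m ≡ n → (∀ k → s k ≡ t k) → caseℕ m z s ≡ caseℕ n z t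
caseℕ-cong {m = zero}  refl eq = refl
caseℕ-cong {m = suc m} refl eq = eq m

collect-cong : ∀ k {g h} → g ≗ h → collect k g ≡ collect k h
collect-cong zero    eq = refl
collect-cong (suc k) eq = caseℕ-cong (eq 0) λ n → cong (n ∷_) (collect-cong k (eq ∘ suc))

collectᵣ : ∀ {k g} → Recursive {Γ} {nat} k → Recursive {nat ∷ Γ} {nat} g →
           Recursive {Γ} {word} λ γ → collect (k γ) λ i → g (i , γ)
collectᵣ {k = k} {g} rk rg = ext (λ γ → subst (λ m → from γ (k γ) ≡ collect (k γ) λ i → g (m + i , γ))
                                              (n∸n≡0 (k γ)) (go γ (k γ) ≤-refl))
  (iterᵣ rk []ᵣ (caseᵣ (letᵣ (wk (wk rk) ∸ᵣ sucᵣ v₀) (wk₁ (wk₁ rg))) []ᵣ (v₀ ∷ᵣ v₂)))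
  where
  from : ∀ γ → ℕ → Word
  -- The word is built from its end: after `m` steps the last `m` indices below `k γ` are treated,
  -- and an undefined value discards all that follows it.
  from γ = iter [] λ m w → caseℕ (g (k γ ∸ suc m , γ)) [] λ n → n ∷ w

  go : ∀ γ m → m ≤ k γ → from γ m ≡ collect m λ i → g (k γ ∸ m + i , γ)
  go γ zero    _   = refl
  go γ (suc m) m<k = caseℕ-cong (cong (λ i → g (i , γ)) (sym (+-identityʳ (k γ ∸ suc m)))) λ n → cong (n ∷_)
    (trans (go γ m (<⇒≤ m<k)) (collect-cong m λ i → cong (λ j → g (j , γ))
      (trans (cong (_+ i) (+-∸-assoc 1 m<k)) (sym (+-suc (k γ ∸ suc m) i)))))

at?-< : ∀ w {i} → i < length w → ∃ λ n → at? w i ≡ suc n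
at?-< (n ∷ w) {zero}  _         = n , refl
at?-< (n ∷ w) {suc i} (s≤s i<w) = at?-< w i<w

at?-≥ : ∀ w {i} → length w ≤ i → at? w i ≡ 0
at?-≥ []      _         = refl
at?-≥ (n ∷ w) (s≤s w≤i) = at?-≥ w w≤i

lengthᵣ : ∀ {w} → Recursive {Γ} {word} w → Recursive {Γ} {nat} λ γ → length (w γ)
lengthᵣ {w = w} rw = ext (λ γ → trans (go (w γ) (encode (w γ))) (m≤n⇒m⊓n≡m (length≤encode (w γ))))
  (iterᵣ (encodeᵣ rw) zeroᵣ (caseᵣ (at?ᵣ (wk (wk rw)) v₀) v₁ (sucᵣ v₁)))
  where
  count : Word → ℕ → ℕ
  count w = iter 0 λ i l → caseℕ (at? w i) l λ _ → suc i

  go : ∀ w k → count w k ≡ length w ⊓ k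
  go w zero    = sym (⊓-zeroʳ (length w))
  go w (suc k) with k <? length w
  ... | yes k<w rewrite proj₂ (at?-< w k<w) = sym (m≥n⇒m⊓n≡n k<w)
  ... | no  k≮w rewrite at?-≥ w (≮⇒≥ k≮w) =
    trans (go w k) (trans (m≤n⇒m⊓n≡m (≮⇒≥ k≮w)) (sym (m≤n⇒m⊓n≡m (m≤n⇒m≤1+n (≮⇒≥ k≮w)))))

tabulateᵣ : ∀ {k g} → Recursive {Γ} {nat} k → Recursive {nat ∷ Γ} {nat} g →
            Recursive {Γ} {word} λ γ → (λ i → g (i , γ)) ↾ k γ
tabulateᵣ {k = k} rk rg = ext (λ γ → go (k γ) _) (collectᵣ rk (sucᵣ rg))
  where
  go : ∀ k f → collect k (suc ∘ f) ≡ f ↾ k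
  go zero    f = refl
  go (suc k) f = cong (f 0 ∷_) (go k (f ∘ suc))

sumBelow : (ℕ → ℕ) → ℕ → ℕ
sumBelow f = iter 0 λ i a → a + f i

sumBelow≡0⇒ : ∀ f n → sumBelow f n ≡ 0 → ∀ {i} → i < n → f i ≡ 0
sumBelow≡0⇒ f (suc n) eq (s≤s i≤n) with m≤n⇒m<n∨m≡n i≤n
... | inj₁ i<n  = sumBelow≡0⇒ f n (m+n≡0⇒m≡0 _ eq) i<n
... | inj₂ refl = m+n≡0⇒n≡0 (sumBelow f n) eq

⇒sumBelow≡0 : ∀ f n → (∀ {i} → i < n → f i ≡ 0) → sumBelow f n ≡ 0
⇒sumBelow≡0 f zero    eq = refl
⇒sumBelow≡0 f (suc n) eq = cong₂ _+_ (⇒sumBelow≡0 f n (eq ∘ m<n⇒m<1+n)) (eq (n<1+n n))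

sumBelowᵣ : ∀ {f n} → Recursive {nat ∷ Γ} {nat} f → Recursive {Γ} {nat} n →
            Recursive {Γ} {nat} λ γ → sumBelow (λ i → f (i , γ)) (n γ)
sumBelowᵣ rf rn = iterᵣ rn zeroᵣ (v₁ +ᵣ wk₁ rf)

distance : ℕ → ℕ → ℕ
distance m n = (m ∸ n) + (n ∸ m)

distance≡0⇒≡ : ∀ {m n} → distance m n ≡ 0 → m ≡ n
distance≡0⇒≡ {m} {n} eq = ≤-antisym (m∸n≡0⇒m≤n (m+n≡0⇒m≡0 (m ∸ n) eq)) (m∸n≡0⇒m≤n (m+n≡0⇒n≡0 (m ∸ n) eq))

≡⇒distance≡0 : ∀ {m n} → m ≡ n → distance m n ≡ 0
≡⇒distance≡0 {m} refl = cong₂ _+_ (n∸n≡0 m) (n∸n≡0 m)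

distanceᵣ : ∀ {f g} → Recursive {Γ} {nat} f → Recursive {Γ} {nat} g →
            Recursive {Γ} {nat} λ γ → distance (f γ) (g γ)
distanceᵣ rf rg = (rf ∸ᵣ rg) +ᵣ (rg ∸ᵣ rf)

-- A recursive prefix test: it vanishes exactly when `u ⊑ v`. If `v` is too short, `at? v i` is 0
-- where `at? u i` is positive.
mismatch : Word → Word → ℕ
mismatch u v = sumBelow (λ i → distance (at? u i) (at? v i)) (length u)

mismatchᵣ : ∀ {u v} → Recursive {Γ} {word} u → Recursive {Γ} {word} v →
            Recursive {Γ} {nat} λ γ → mismatch (u γ) (v γ)
mismatchᵣ ru rv = sumBelowᵣ (distanceᵣ (at?ᵣ (wk ru) v₀) (at?ᵣ (wk rv) v₀)) (lengthᵣ ru)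

-- Prefixes

⊑⇒at? : ∀ {u v i} → u ⊑ v → i < length u → at? u i ≡ at? v i
⊑⇒at? {i = zero}  (refl ∷ _)   _         = refl
⊑⇒at? {i = suc i} (_    ∷ u⊑v) (s≤s i<u) = ⊑⇒at? u⊑v i<u

at?⇒⊑ : ∀ u v → (∀ {i} → i < length u → at? u i ≡ at? v i) → u ⊑ v
at?⇒⊑ []      v       eq = []
at?⇒⊑ (m ∷ u) []      eq = case eq {0} (s≤s z≤n) of λ ()
at?⇒⊑ (m ∷ u) (n ∷ v) eq = suc-injective (eq {0} (s≤s z≤n)) ∷ at?⇒⊑ u v λ i<u → eq (s≤s i<u)

⊑-length : ∀ {u v} → u ⊑ v → length u ≤ length v
⊑-length []        = z≤n
⊑-length (_ ∷ u⊑v) = s≤s (⊑-length u⊑v)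

at?-↾ : ∀ (p : Seq) {n i} → i < n → at? (p ↾ n) i ≡ suc (p i)
at?-↾ p {i = zero}  (s≤s _)   = refl
at?-↾ p {i = suc i} (s≤s i<n) = at?-↾ (p ∘ suc) i<n

⊏⇒at? : ∀ {w p i} → w ⊏ p → i < length w → at? w i ≡ suc (p i)
⊏⇒at? {w} {p} w⊏p i<w rewrite w⊏p = at?-↾ p (subst (_ <_) (length-applyUpTo p (length w)) i<w)

at?⇒< : ∀ w {i n} → at? w i ≡ suc n → i < length w
at?⇒< w {i} eq with i <? length w
... | yes i<w = i<w
... | no  i≮w = case trans (sym eq) (at?-≥ w (≮⇒≥ i≮w)) of λ ()

⊏⇒at?≡ : ∀ {w p i n} → w ⊏ p → at? w i ≡ suc n → n ≡ p i
⊏⇒at?≡ {w} w⊏p eq = suc-injective (trans (sym eq) (⊏⇒at? w⊏p (at?⇒< w eq)))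

at?⇒⊏ : ∀ w {p : Seq} → (∀ {i n} → at? w i ≡ suc n → n ≡ p i) → w ⊏ p
at?⇒⊏ []      eq = refl
at?⇒⊏ (n ∷ w) eq = cong₂ _∷_ (eq {0} refl) (at?⇒⊏ w λ {i} → eq {suc i})

↾-⊏ : ∀ (p : Seq) n → p ↾ n ⊏ p
↾-⊏ p n = cong (p ↾_) (sym (length-applyUpTo p n))

⊑-⊏ : ∀ {u v} {p : Seq} → u ⊑ v → v ⊏ p → u ⊏ p
⊑-⊏ {u} {v} u⊑v v⊏p = at?⇒⊏ u λ eq → ⊏⇒at?≡ v⊏p (trans (sym (⊑⇒at? u⊑v (at?⇒< u eq))) eq)

⊏-⊑ : ∀ {u v} {p : Seq} → u ⊏ p → v ⊏ p → length u ≤ length v → u ⊑ v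
⊏-⊑ {u} {v} u⊏p v⊏p u≤v = at?⇒⊑ u v λ i<u → trans (⊏⇒at? u⊏p i<u) (sym (⊏⇒at? v⊏p (<-≤-trans i<u u≤v)))

↾-⊑ : ∀ (p : Seq) {m n} → m ≤ n → p ↾ m ⊑ p ↾ n
↾-⊑ p {m} {n} m≤n = ⊏-⊑ (↾-⊏ p m) (↾-⊏ p n) (subst₂ _≤_ (sym (length-applyUpTo p m)) (sym (length-applyUpTo p n)) m≤n)

extend-case : ∀ u v → caseℕ (mismatch u v) v (λ _ → u) ≡ extend u v
extend-case u v with prefix? _≟_ u v
... | yes u⊑v = caseℕ-cong {z = v} (⇒sumBelow≡0 _ (length u) λ i<u → ≡⇒distance≡0 (⊑⇒at? u⊑v i<u)) λ _ → refl
... | no  u⋢v with mismatch u v in eq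
...   | zero  = contradiction (at?⇒⊑ u v λ i<u → distance≡0⇒≡ (sumBelow≡0⇒ _ (length u) eq i<u)) u⋢v
...   | suc _ = refl

extendᵣ : ∀ {u v} → Recursive {Γ} {word} u → Recursive {Γ} {word} v →
          Recursive {Γ} {word} λ γ → extend (u γ) (v γ)
extendᵣ {u = u} {v} ru rv = ext (λ γ → extend-case (u γ) (v γ)) (caseᵣ (mismatchᵣ ru rv) rv (wk ru))

nth : Word → ℕ → ℕ
nth w i = pred (at? w i)

nthᵣ : ∀ {w i} → Recursive {Γ} {word} w → Recursive {Γ} {nat} i → Recursive {Γ} {nat} λ γ → nth (w γ) (i γ)
nthᵣ rw ri = predᵣ (at?ᵣ rw ri)

⊏-nth : ∀ w → w ⊏ nth w
⊏-nth w = at?⇒⊏ w λ eq → sym (cong pred eq)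

⊏⇒nth : ∀ {w p i} → w ⊏ p → i < length w → nth w i ≡ p i
⊏⇒nth w⊏p i<w = cong pred (⊏⇒at? w⊏p i<w)

nth-↾ : ∀ (p : Seq) {n i} → i < n → nth (p ↾ n) i ≡ p i
nth-↾ p i<n = cong pred (at?-↾ p i<n)

-- Along a sequence, the fold over all prefixes becomes a one-step recursion, which is the form that
-- `monotoniseᵣ` programs.
monotonise-suc : ∀ ψ p n → monotonise ψ (p ↾ suc n) ≡ extend (monotonise ψ (p ↾ n)) (ψ (p ↾ suc n))
monotonise-suc ψ p n = go ψ [] p n
  where
  go : ∀ ψ u p n → foldl extend u (map ψ (inits (p ↾ suc n))) ≡
                   extend (foldl extend u (map ψ (inits (p ↾ n)))) (ψ (p ↾ suc n))
  go ψ u p zero    = refl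
  go ψ u p (suc n) = trans (foldl-inits ψ u (p 0) ((p ∘ suc) ↾ suc n))
    (trans (go (ψ ∘ (p 0 ∷_)) (extend u (ψ [])) (p ∘ suc) n)
           (cong (λ w → extend w (ψ (p ↾ suc (suc n)))) (sym (foldl-inits ψ u (p 0) ((p ∘ suc) ↾ n)))))

monotoniseᵣ : ∀ {ψ w} → Recursive {word ∷ Γ} {word} ψ → Recursive {Γ} {word} w →
              Recursive {Γ} {word} λ γ → monotonise (λ v → ψ (v , γ)) (w γ)
monotoniseᵣ {ψ = ψ} {w} rψ rw = ext (λ γ → trans (go γ (length (w γ))) (cong (monotonise (λ v → ψ (v , γ))) (sym (⊏-nth (w γ)))))
  (iterᵣ (lengthᵣ rw) (extendᵣ []ᵣ (letᵣ []ᵣ rψ))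
    (extendᵣ v₁ (letᵣ (tabulateᵣ (sucᵣ v₀) (nthᵣ (wk (wk (wk rw))) v₀)) (wk₁ (wk₁ rψ)))))
  where
  go : ∀ γ n → iter (extend [] (ψ ([] , γ))) (λ j u → extend u (ψ (nth (w γ) ↾ suc j , γ))) n ≡
               monotonise (λ v → ψ (v , γ)) (nth (w γ) ↾ n)
  go γ zero    = refl
  go γ (suc n) = trans (cong (λ u → extend u (ψ (nth (w γ) ↾ suc n , γ))) (go γ n))
                       (sym (monotonise-suc (λ v → ψ (v , γ)) (nth (w γ)) n))

-- Suprema

Computable-fun : ∀ {ψ} → Recursive {word ∷ []} {word} (λ (w , _) → ψ w) → ComputableWordFun ψ
Computable-fun (recursive e c) = e , λ w → c (w , tt)

-- Prefixes of one sequence are comparable, so `extend` keeps a longest one and loses no length.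
extend-⊏ : ∀ {u v} {p : Seq} → u ⊏ p → v ⊏ p → extend u v ⊏ p × length v ≤ length (extend u v)
extend-⊏ {u} {v} u⊏p v⊏p with prefix? _≟_ u v
... | yes u⊑v = v⊏p , ≤-refl
... | no  u⋢v = u⊏p , ≰⇒≥ λ u≤v → u⋢v (⊏-⊑ u⊏p v⊏p u≤v)

monotonise-⊏ : ∀ ψ p {r : Seq} n → (∀ m → m ≤ n → ψ (p ↾ m) ⊏ r) →
               monotonise ψ (p ↾ n) ⊏ r × length (ψ (p ↾ n)) ≤ length (monotonise ψ (p ↾ n))
monotonise-⊏ ψ p {r} zero    bound = extend-⊏ {[]} {ψ []} {r} refl (bound 0 z≤n)
monotonise-⊏ ψ p {r} (suc n) bound rewrite monotonise-suc ψ p n =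
  extend-⊏ (proj₁ (monotonise-⊏ ψ p {r} n λ m m≤n → bound m (m≤n⇒m≤1+n m≤n))) (bound (suc n) ≤-refl)

IsSup-monotonise : ∀ {ψ p r} → IsSup ψ p r → IsSup (monotonise ψ) p r
IsSup-monotonise {ψ} {p} {r} (bound , long) =
  (λ n → proj₁ (monotonise-⊏ ψ p {r} n λ m _ → bound m)) ,
  λ k → proj₁ (long k) ,
        ≤-trans (proj₂ (long k)) (proj₂ (monotonise-⊏ ψ p {r} (proj₁ (long k)) λ m _ → bound m))

supremum : (ψ : Word → Word) → PartialFun baire baire _
supremum ψ = record
  { multi  = record
    { graph = IsSup ψ
    ; respˡ = λ {r} {p} {q} eq → IsSup-resp ψ ψ p q (λ _ → refl) eq (λ _ → refl)
    ; respʳ = λ {p} eq → IsSup-resp ψ ψ p p (λ _ → refl) (λ _ → refl) eq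
    }
  ; single = λ {p} → IsSup-unique ψ p
  }

-- It is enough that `ψ` gives correct and arbitrarily long prefixes along points of the graph.
-- `monotonise` provides monotonicity everywhere and preserves these suprema.
supremum-computable : ∀ {ψ} → Recursive {word ∷ []} {word} (λ (w , _) → ψ w) → Computable (supremum ψ)
supremum-computable {ψ} rψ = monotonise ψ , monotonise-monotone ψ ,
  Computable-fun (monotoniseᵣ (wk₁ rψ) v₀) , IsSup-monotonise

-- The words may be wrong before stage `M₀` and need not extend each other. Both liberties are
-- needed for guessed choices, which are only eventually right; a supremum is obtained when `M₀` is
-- 0.
record Approximates (M₀ : ℕ) (W : ℕ → Word) (p : Seq) : Set where
  constructor approximates
  field
    below : ∀ m → M₀ ≤ m → W m ⊏ p
    long  : ∀ k → ∃ λ M → ∀ m → M ≤ m → k ≤ length (W m)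

open Approximates public

≤-approximates : ∀ {M N W p} → M ≤ N → Approximates M W p → Approximates N W p
≤-approximates M≤N (approximates b l) = approximates (λ m N≤m → b m (≤-trans M≤N N≤m)) l

approximates⇒sup : ∀ ψ p {r} → Approximates 0 (λ m → ψ (p ↾ m)) r → IsSup ψ p r
approximates⇒sup ψ p (approximates b l) = (λ m → b m z≤n) , λ k → proj₁ (l k) , proj₂ (l k) _ ≤-refl

↾-approximates : ∀ p → Approximates 0 (p ↾_) p
↾-approximates p = approximates (λ m _ → ↾-⊏ p m) λ k → k , λ m k≤m → subst (k ≤_) (sym (length-applyUpTo p m)) k≤m

approximates-resp : ∀ {M W p q} → p ≗ q → Approximates M W p → Approximates M W q
approximates-resp {W = W} eq (approximates b l) = approximates (λ m M≤m → ⊏-resp {w = W m} eq (b m M≤m)) l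

approximates-cong : ∀ {M V W p} → (∀ m → M ≤ m → V m ≡ W m) → Approximates M V p → Approximates M W p
approximates-cong {M} {V} {W} {p} eq (approximates b l) = approximates
  (λ m M≤m → subst (_⊏ p) (eq m M≤m) (b m M≤m))
  λ k → let N , kN = l k in M ⊔ N , λ m le → subst (λ w → k ≤ length w) (eq m (m⊔n≤o⇒m≤o M N le)) (kN m (m⊔n≤o⇒n≤o M N le))

sup∘approximates : ∀ {φ M W p r} → Monotone φ → IsSup φ p r → Approximates M W p → Approximates M (λ m → φ (W m)) r
sup∘approximates {φ} {M} {W} {p} {r} mono (bound , long′) (approximates b l) = approximates
  (λ m M≤m → subst (λ w → φ w ⊏ r) (sym (b m M≤m)) (bound (length (W m))))
  λ k → let n , k≤ = long′ k
            N , nN = l n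
        in M ⊔ N , λ m le → ≤-trans k≤ (⊑-length (mono (subst (p ↾ n ⊑_) (sym (b m (m⊔n≤o⇒m≤o M N le)))
                                                          (↾-⊑ p (nN m (m⊔n≤o⇒n≤o M N le))))))

collect-at? : ∀ k g {i n} → at? (collect k g) i ≡ suc n → g i ≡ suc n
collect-at? (suc k) g {i} eq with g 0 in eq₀
collect-at? (suc k) g {zero}  eq | suc n = trans eq₀ eq
collect-at? (suc k) g {suc i} eq | suc n = collect-at? k (g ∘ suc) eq

collect-⊏ : ∀ k g {p : Seq} → (∀ {i n} → g i ≡ suc n → n ≡ p i) → collect k g ⊏ p
collect-⊏ k g eq = at?⇒⊏ (collect k g) λ e → eq (collect-at? k g e)

collect-length : ∀ k g {l} {p : Seq} → l ≤ k → (∀ {i} → i < l → g i ≡ suc (p i)) → l ≤ length (collect k g)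
collect-length k       g {zero}  _         eq = z≤n
collect-length (suc k) g {suc l} (s≤s l≤k) eq rewrite eq {0} (s≤s z≤n) = s≤s (collect-length k (g ∘ suc) l≤k λ i<l → eq (s≤s i<l))

record Reads (M₀ : ℕ) (g : ℕ → ℕ) (y : ℕ) : Set where
  constructor reads
  field
    sound    : ∀ m → M₀ ≤ m → ∀ {n} → g m ≡ suc n → n ≡ y
    complete : ∃ λ M → ∀ m → M ≤ m → g m ≡ suc y

open Reads public

reads-at : ∀ {M W p} → Approximates M W p → ∀ i → Reads M (λ m → at? (W m) i) (p i)
reads-at {M} (approximates b l) i = reads (λ m M≤m → ⊏⇒at?≡ (b m M≤m))
  (M ⊔ proj₁ (l (suc i)) , λ m le → ⊏⇒at? (b m (m⊔n≤o⇒m≤o M _ le)) (proj₂ (l (suc i)) m (m⊔n≤o⇒n≤o M _ le)))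

reads-case : ∀ {M g y z} {h : ℕ → ℕ → ℕ} → Reads M g y → Reads M (λ m → h m y) z → Reads M (λ m → caseℕ (g m) 0 (h m)) z
reads-case {M} {g} {y} {z} {h} (reads s c) (reads s′ c′) = reads sd
  (proj₁ c ⊔ proj₁ c′ , λ m le → trans (cong (λ x → caseℕ x 0 (h m)) (proj₂ c m (m⊔n≤o⇒m≤o (proj₁ c) _ le)))
                                       (proj₂ c′ m (m⊔n≤o⇒n≤o (proj₁ c) _ le)))
  where
  sd : ∀ m → M ≤ m → ∀ {n} → caseℕ (g m) 0 (h m) ≡ suc n → n ≡ z
  sd m M≤m eq with g m in e
  ... | suc x rewrite s m M≤m e = s′ m M≤m eq

reads-suc : ∀ {M} y → Reads M (λ _ → suc y) y
reads-suc y = reads (λ { _ _ refl → refl }) (0 , λ _ _ → refl)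

eventually-all : ∀ {P : ℕ → ℕ → Set} k → (∀ {i} → i < k → ∃ λ M → ∀ m → M ≤ m → P i m) →
                 ∃ λ M → ∀ m → M ≤ m → ∀ {i} → i < k → P i m
eventually-all zero    _  = 0 , λ _ _ ()
eventually-all {P} (suc k) ev =
  let M , PM = eventually-all {P} k (ev ∘ m<n⇒m<1+n)
      N , PN = ev (n<1+n k)
  in M ⊔ N , λ m le {i} i<1+k → case m≤n⇒m<n∨m≡n (s≤s⁻¹ i<1+k) of λ where
       (inj₁ i<k)  → PM m (m⊔n≤o⇒m≤o M N le) i<k
       (inj₂ refl) → PN m (m⊔n≤o⇒n≤o M N le)

collect-approximates : ∀ {M} {g : ℕ → ℕ → ℕ} {p : Seq} (b : ℕ → ℕ) → (∀ k → ∃ λ N → ∀ m → N ≤ m → k ≤ b m) →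
                       (∀ i → Reads M (λ m → g m i) (p i)) → Approximates M (λ m → collect (b m) (g m)) p
collect-approximates {M} {g} {p} b bl rd = approximates
  (λ m M≤m → collect-⊏ (b m) (g m) λ {i} → sound (rd i) m M≤m)
  λ k → let N , bN = bl k
            N′ , gN = eventually-all {λ i m → g m i ≡ suc (p i)} k λ {i} _ → complete (rd i)
        in N ⊔ N′ , λ m le → collect-length (b m) (g m) {p = p} (bN m (m⊔n≤o⇒m≤o N N′ le)) (gN m (m⊔n≤o⇒n≤o N N′ le))

-- Interleaving

ev od : Seq → Seq
ev x i = x (i + i)
od x i = x (suc (i + i))

ev-⟨⟩ : ∀ q p → ev ⟨ q , p ⟩ ≗ q
od-⟨⟩ : ∀ q p → od ⟨ q , p ⟩ ≗ p
ev-⟨⟩ q p zero    = refl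
ev-⟨⟩ q p (suc i) = trans (cong ⟨ p , q ∘ suc ⟩ (+-suc i i)) (od-⟨⟩ p (q ∘ suc) i)
od-⟨⟩ q p i = ev-⟨⟩ p (q ∘ suc) i

⟨ev,od⟩ : ∀ x → x ≗ ⟨ ev x , od x ⟩
⟨ev,od⟩ x zero    = refl
⟨ev,od⟩ x (suc n) = trans (⟨ev,od⟩ (x ∘ suc) n)
  (⟨⟩-cong _ (od x) _ (ev x ∘ suc) (λ _ → refl) (λ i → cong (x ∘ suc) (sym (+-suc i i))) n)

half : ℕ → ℕ
half = iter 0 λ n h → n ∸ h

half-even : ∀ i → half (i + i) ≡ i
half-odd  : ∀ i → half (suc (i + i)) ≡ i
half-even zero    = refl
half-even (suc i) rewrite +-suc i i | half-even i | m+n∸n≡m i i = trans (cong (_∸ i) (sym (+-suc i i))) (m+n∸m≡n i (suc i))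
half-odd i rewrite half-even i = m+n∸n≡m i i

data Parity : ℕ → Set where
  even : ∀ i → Parity (i + i)
  odd  : ∀ i → Parity (suc (i + i))

evenOrOdd : ∀ n → Parity n
evenOrOdd zero = even 0
evenOrOdd (suc n) with evenOrOdd n
... | even i = odd i
... | odd  i = subst Parity (cong suc (+-suc i i)) (even (suc i))

⟨⟩-case : ∀ f g n → caseℕ (n ∸ (half n + half n)) (f (half n)) (λ _ → g (half n)) ≡ ⟨ f , g ⟩ n
⟨⟩-case f g n with evenOrOdd n
... | even i rewrite half-even i | n∸n≡0 (i + i) = sym (ev-⟨⟩ f g i)
... | odd  i rewrite half-odd i | m+n∸n≡m 1 (i + i) = sym (od-⟨⟩ f g i)

halfᵣ : ∀ {n} → Recursive {Γ} {nat} n → Recursive {Γ} {nat} λ γ → half (n γ)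
halfᵣ rn = iterᵣ rn zeroᵣ (v₀ ∸ᵣ v₁)

⟨_,_⟩ᵣ : ∀ {f g n} → Recursive {nat ∷ Γ} {nat} f → Recursive {nat ∷ Γ} {nat} g → Recursive {Γ} {nat} n →
         Recursive {Γ} {nat} λ γ → ⟨ (λ i → f (i , γ)) , (λ i → g (i , γ)) ⟩ (n γ)
⟨_,_⟩ᵣ {n = n} rf rg rn = ext (λ γ → ⟨⟩-case _ _ (n γ))
  (caseᵣ (rn ∸ᵣ (halfᵣ rn +ᵣ halfᵣ rn)) (letᵣ (halfᵣ rn) rf) (wk (letᵣ (halfᵣ rn) rg)))

evens odds : Word → Word
evens w = collect (length w) λ i → at? w (i + i)
odds  w = collect (length w) λ i → at? w (suc (i + i))

evensᵣ : ∀ {w} → Recursive {Γ} {word} w → Recursive {Γ} {word} λ γ → evens (w γ)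
evensᵣ rw = collectᵣ (lengthᵣ rw) (at?ᵣ (wk rw) (v₀ +ᵣ v₀))

oddsᵣ : ∀ {w} → Recursive {Γ} {word} w → Recursive {Γ} {word} λ γ → odds (w γ)
oddsᵣ rw = collectᵣ (lengthᵣ rw) (at?ᵣ (wk rw) (sucᵣ (v₀ +ᵣ v₀)))

zip : Word → Word → Word
zip u v = collect (length u) ⟨ at? u , at? v ⟩

zipᵣ : ∀ {u v} → Recursive {Γ} {word} u → Recursive {Γ} {word} v → Recursive {Γ} {word} λ γ → zip (u γ) (v γ)
zipᵣ ru rv = collectᵣ (lengthᵣ ru) (⟨ at?ᵣ (wk (wk ru)) v₀ , at?ᵣ (wk (wk rv)) v₀ ⟩ᵣ v₀)

evens-approximates : ∀ {M W x} → Approximates M W x → Approximates M (λ m → evens (W m)) (ev x)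
evens-approximates {W = W} ap = collect-approximates (length ∘ W) (long ap) λ i → reads-at ap (i + i)

odds-approximates : ∀ {M W x} → Approximates M W x → Approximates M (λ m → odds (W m)) (od x)
odds-approximates {W = W} ap = collect-approximates (length ∘ W) (long ap) λ i → reads-at ap (suc (i + i))

reads-resp : ∀ {M g h y z} → g ≗ h → y ≡ z → Reads M g y → Reads M h z
reads-resp eq refl (reads s c) = reads (λ m M≤m e → s m M≤m (trans (eq m) e))
                                       (proj₁ c , λ m N≤m → trans (sym (eq m)) (proj₂ c m N≤m))

zip-approximates : ∀ {M V W q p} → Approximates M V q → Approximates M W p →
                   Approximates M (λ m → zip (V m) (W m)) ⟨ q , p ⟩
zip-approximates {M} {V} {W} {q} {p} av aw = collect-approximates (length ∘ V) (long av) λ n → go n (evenOrOdd n)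
  where
  go : ∀ n → Parity n → Reads M (λ m → ⟨ at? (V m) , at? (W m) ⟩ n) (⟨ q , p ⟩ n)
  go _ (even i) = reads-resp (λ m → sym (ev-⟨⟩ (at? (V m)) (at? (W m)) i)) (sym (ev-⟨⟩ q p i)) (reads-at av i)
  go _ (odd i) = reads-resp (λ m → sym (od-⟨⟩ (at? (V m)) (at? (W m)) i)) (sym (od-⟨⟩ q p i)) (reads-at aw i)

-- Functionals whose n-th value only depends on the arguments up to n

Local : (ℕ → Word → ℕ) → Seq → Seq → Set
Local k p r = ∀ {n m} → n < m → k n (p ↾ m) ≡ r n

local-sup : ∀ {k p r} → Local k p r → IsSup (λ w → (λ n → k n w) ↾ length w) p r
local-sup {k} {p} {r} loc =
  (λ m → at?⇒⊏ (values m) λ {i} e → let i<m = subst (i <_) (len m) (at?⇒< (values m) e) in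
    trans (suc-injective (trans (sym e) (at?-↾ (λ n → k n (p ↾ m)) (subst (i <_) (sym (length-applyUpTo p m)) i<m)))) (loc i<m)) ,
  λ l → l , ≤-reflexive (sym (len l))
  where
  values : ℕ → Word
  values m = (λ n → k n (p ↾ m)) ↾ length (p ↾ m)
  len : ∀ m → length (values m) ≡ m
  len m = trans (length-applyUpTo (λ n → k n (p ↾ m)) (length (p ↾ m))) (length-applyUpTo p m)

-- Evaluating the universal function on words

encode-mono : ∀ {u v} → u ⊑ v → encode u ≤ encode v
encode-mono []           = z≤n
encode-mono {n ∷ _} (refl ∷ u⊑v) = s≤s (pair-mono (≤-refl {n}) (encode-mono u⊑v))

-- `Q` approximates a point of a loop, where the program occupies the even positions and the
-- instance the odd ones.
table : Word → ℕ → ℕ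
table Q c = nth Q (c + c)

-- A word that the prefix Q of a table does not reach is given the value [], which
-- extend ignores; as codes grow along prefixes, neither do longer words reach it.
evaluate : Word → Word → Word
evaluate Q = approx (table Q)

evaluateᵣ : ∀ {Q R} → Recursive {Γ} {word} Q → Recursive {Γ} {word} R →
            Recursive {Γ} {word} λ γ → evaluate (Q γ) (R γ)
evaluateᵣ {Q = Q} rQ rR = monotoniseᵣ {ψ = λ (v , γ) → decode (table (Q γ) (encode v))}
  (decodeᵣ (nthᵣ (wk rQ) (encodeᵣ v₀ +ᵣ encodeᵣ v₀))) rR

extend-[] : ∀ u → extend u [] ≡ u
extend-[] []      = refl
extend-[] (_ ∷ _) = refl

module _ {Q : Word} {x r s : Seq} (Q⊏x : Q ⊏ x) (sup : IsSup (approx (ev x)) r s) where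

  private
    Reached : Word → Set
    Reached v = encode v + encode v < length Q

    ψ : Word → Word
    ψ v = decode (table Q (encode v))

  reached-value : ∀ {v} → Reached v → ψ v ≡ decode (ev x (encode v))
  reached-value lt = cong decode (⊏⇒nth Q⊏x lt)

  unreached-value : ∀ {v} → ¬ Reached v → ψ v ≡ []
  unreached-value {v} ≮ rewrite at?-≥ Q {encode v + encode v} (≮⇒≥ ≮) = refl

  reached-pred : ∀ n → Reached (r ↾ suc n) → Reached (r ↾ n)
  reached-pred n = ≤-<-trans (+-mono-≤ le le)
    where le = encode-mono (↾-⊑ r (n≤1+n n))

  evaluate-reached : ∀ n → Reached (r ↾ n) → evaluate Q (r ↾ n) ≡ approx (ev x) (r ↾ n)
  evaluate-reached zero    re = cong (extend []) (reached-value {[]} re)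
  evaluate-reached (suc n) re = begin
    evaluate Q (r ↾ suc n)                                          ≡⟨ monotonise-suc ψ r n ⟩
    extend (evaluate Q (r ↾ n)) (ψ (r ↾ suc n))                     ≡⟨ cong₂ extend (evaluate-reached n (reached-pred n re)) (reached-value {r ↾ suc n} re) ⟩
    extend (approx (ev x) (r ↾ n)) (decode (ev x (encode (r ↾ suc n))))  ≡⟨ monotonise-suc _ r n ⟨
    approx (ev x) (r ↾ suc n)                                       ∎
    where open ≡-Reasoning

  evaluate-below : ∀ n → evaluate Q (r ↾ n) ⊏ s
  evaluate-below n with encode (r ↾ n) + encode (r ↾ n) <? length Q
  evaluate-below n       | yes re = subst (_⊏ s) (sym (evaluate-reached n re)) (proj₁ sup n)
  evaluate-below zero    | no  ¬r = subst (_⊏ s) (sym (trans (cong (extend []) (unreached-value {[]} ¬r)) (extend-[] []))) refl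
  evaluate-below (suc n) | no  ¬r = subst (_⊏ s)
    (sym (trans (monotonise-suc ψ r n) (trans (cong (extend (evaluate Q (r ↾ n))) (unreached-value {r ↾ suc n} ¬r)) (extend-[] (evaluate Q (r ↾ n))))))
    (evaluate-below n)

  evaluate-⊏ : ∀ {R} → R ⊏ r → evaluate Q R ⊏ s
  evaluate-⊏ {R} R⊏r = subst (λ w → evaluate Q w ⊏ s) (sym R⊏r) (evaluate-below (length R))

evaluate-approximates : ∀ {M Q R x r s} → Approximates M Q x → Approximates M R r → IsSup (approx (ev x)) r s →
                        Approximates M (λ m → evaluate (Q m) (R m)) s
evaluate-approximates {M} {Q} {R} {x} {r} {s} aQ aR sup = approximates
  (λ m M≤m → evaluate-⊏ (below aQ m M≤m) sup (below aR m M≤m))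
  λ k → let n , k≤ = proj₂ sup k
            -- The position in `x` of the table entry for `r ↾ n`; once `Q m` is longer, that entry
            -- is available.
            e = encode (r ↾ n) + encode (r ↾ n)
            N₁ , l₁ = long aQ (suc e)
            N₂ , l₂ = long aR n
        in M ⊔ (N₁ ⊔ N₂) , λ m le →
          let M≤m = m⊔n≤o⇒m≤o M (N₁ ⊔ N₂) le
              N≤m = m⊔n≤o⇒n≤o M (N₁ ⊔ N₂) le
          in ≤-trans k≤ (subst (λ w → length w ≤ length (evaluate (Q m) (R m)))
               (evaluate-reached (below aQ m M≤m) sup n (l₁ m (m⊔n≤o⇒m≤o N₁ N₂ N≤m)))
               (⊑-length (monotonise-monotone (λ v → decode (table (Q m) (encode v)))
                 (⊏-⊑ (↾-⊏ r n) (below aR m M≤m)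
                      (subst (_≤ length (R m)) (sym (length-applyUpTo r n)) (l₂ m (m⊔n≤o⇒n≤o N₁ N₂ N≤m)))))))

-- Weihrauch reductions given by word functions

∘ₚ-graph : {A : Setoid a ℓ₁} {B : Setoid b ℓ₂} {C : Setoid c ℓ₃} →
           ∀ {r s} (g : PartialFun B C s) (f : PartialFun A B r) {x y z} →
           graph (multi f) x y → graph (multi g) y z → graph (multi (g ∘ₚ f)) x z
∘ₚ-graph g f fxy gyz = (λ y′ fxy′ → _ , respˡ (multi g) (single f fxy fxy′) gyz) , _ , fxy , gyz

module _ {X : RepresentedSpace a ℓ₁} {Y : RepresentedSpace b ℓ₂} {r : Level} where

  named : Problem X Y r → MultiFun baire (space Y) _
  named f = fun f ∘ₘ multi (δ X)

module _ {a₁ ℓ₁ b₁ ℓ₂ a₂ ℓ₃ b₂ ℓ₄ : Level}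
         {X : RepresentedSpace a₁ ℓ₁} {Y : RepresentedSpace b₁ ℓ₂}
         {X′ : RepresentedSpace a₂ ℓ₃} {Y′ : RepresentedSpace b₂ ℓ₄} {r s : Level}
         {f : Problem X Y r} {g : Problem X′ Y′ s} where

  -- A realizer enters a reduction only through one name `t` of one correct answer at the single
  -- point `k`, so quantifying over such names replaces quantifying over realizers.
  reduction : ∀ {φ ψ} → Recursive {word ∷ []} {word} (λ (w , _) → φ w) →
              Recursive {word ∷ []} {word} (λ (w , _) → ψ w) →
              (∀ p → dom (named f) p → ∃ λ k → IsSup φ p k × dom (named g) k ×
                (∀ t y → graph (named g) k y → graph (multi (δ Y′)) t y →
                   ∃₂ λ r z → IsSup ψ ⟨ p , t ⟩ r × graph (multi (δ Y)) r z × graph (named f) p z)) →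
              f ≤W g
  reduction {φ} {ψ} rφ rψ red = H , K , supremum-computable rψ , supremum-computable rφ , λ G G⊢g p p∈ →
    let k , Kpk , k∈ , answer = red p p∈
        y , (_ , t , Gkt , δty) , gky = G⊢g k k∈
        r , z , Hr , δrz , fpz = answer t y gky δty
        GK = G ∘ₚ K
    in z , ∘ₚ-graph (δ Y) (H ∘ₚ ⟨id, GK ⟩)
             (∘ₚ-graph H ⟨id, GK ⟩ (t , ∘ₚ-graph G K Kpk Gkt , λ _ → refl) Hr) δrz , fpz
    where
    H = supremum ψ
    K = supremum φ

module _ {a₁ ℓ₁ b₁ ℓ₂ a₂ ℓ₃ b₂ ℓ₄ a₃ ℓ₅ b₃ ℓ₆ : Level}
         {X₁ : RepresentedSpace a₁ ℓ₁} {Y₁ : RepresentedSpace b₁ ℓ₂}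
         {X₂ : RepresentedSpace a₂ ℓ₃} {Y₂ : RepresentedSpace b₂ ℓ₄}
         {X₃ : RepresentedSpace a₃ ℓ₅} {Y₃ : RepresentedSpace b₃ ℓ₆} {r s t : Level}
         {f : Problem X₁ Y₁ r} {g : Problem X₂ Y₂ s} {h : Problem X₃ Y₃ t} where

  ≤W-trans : f ≤W g → g ≤W h → f ≤W h
  ≤W-trans (H , K , (η , η-mono , cη , η-sup) , (κ , κ-mono , cκ , κ-sup) , red)
           (H′ , K′ , (η′ , η′-mono , cη′ , η′-sup) , (κ′ , κ′-mono , cκ′ , κ′-sup) , red′) =
    H″ , K″ , supremum-computable rη″ , supremum-computable rκ″ , λ G G⊢h p p∈ →
      -- By the second reduction this is a realizer of `g`, so the first reduction may be applied to
      -- it.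
      let G′ = H′ ∘ₚ ⟨id, G ∘ₚ K′ ⟩
          y , (_ , u , (_ , v , (t , (_ , k , Kpk , _ , v′ , (t′ , (_ , k′ , K′kk′ , Gk′t′) , v′≗) , H′v′t) , v≗) , Hvu) , δuy) , fpy = red G′ (red′ G G⊢h) p p∈
          GK″ = G ∘ₚ K″
          ap : Approximates 0 (λ m → κ (p ↾ m)) k
          ap = sup∘approximates κ-mono (κ-sup Kpk) (↾-approximates p)
          K″pk′ : IsSup κ″ p k′
          K″pk′ = approximates⇒sup κ″ p (sup∘approximates κ′-mono (κ′-sup K′kk′) ap)
          H″ptu : IsSup η″ ⟨ p , t′ ⟩ u
          H″ptu =
            let ax = ↾-approximates ⟨ p , t′ ⟩
                aev = approximates-resp (ev-⟨⟩ p t′) (evens-approximates ax)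
                aod = approximates-resp (od-⟨⟩ p t′) (odds-approximates ax)
                ak = sup∘approximates κ-mono (κ-sup Kpk) aev
                at = sup∘approximates η′-mono (η′-sup (respˡ (multi H′) v′≗ H′v′t)) (zip-approximates ak aod)
            in approximates⇒sup η″ ⟨ p , t′ ⟩ (sup∘approximates η-mono (η-sup (respˡ (multi H) v≗ Hvu)) (zip-approximates aev at))
      in y , ∘ₚ-graph (δ Y₁) (H″ ∘ₚ ⟨id, GK″ ⟩)
               (∘ₚ-graph H″ ⟨id, GK″ ⟩ (t′ , ∘ₚ-graph G K″ K″pk′ Gk′t′ , λ _ → refl) H″ptu) δuy , fpy
    where
    apply : ∀ {φ} → ComputableWordFun φ → ∀ {w} →
            Recursive {word ∷ []} {word} w → Recursive {word ∷ []} {word} (λ γ → φ (w γ))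
    apply {φ} (e , c) rw = callᵣ (recursive {word ∷ []} {word} {λ (w , _) → φ w} e λ (w , _) → c w) (rw ∷ₐ []ₐ)

    κ″ η″ : Word → Word
    κ″ w = κ′ (κ w)
    η″ w = η (zip (evens w) (η′ (zip (κ (evens w)) (odds w))))

    rκ″ : Recursive {word ∷ []} {word} λ (w , _) → κ″ w
    rκ″ = apply cκ′ (apply cκ v₀)

    rη″ : Recursive {word ∷ []} {word} λ (w , _) → η″ w
    rη″ = apply cη (zipᵣ (evensᵣ v₀) (apply cη′ (zipᵣ (apply cκ (evensᵣ v₀)) (oddsᵣ v₀))))

    H″ K″ : PartialFun baire baire 0ℓ
    H″ = supremum η″
    K″ = supremum κ″

-- Problems on Baire space

module _ {ℓ : Level} {f : Problem (represented ℕ^ℕ) (represented ℕ^ℕ) ℓ} where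

  named⇒ : ∀ {p z} → graph (named f) p z → graph (fun f) p z
  named⇒ (_ , x , p≗x , fxz) = respˡ (fun f) (λ n → sym (p≗x n)) fxz

  named⇐ : ∀ {p z} → graph (fun f) p z → graph (named f) p z
  named⇐ fpz = (λ x p≗x → _ , respˡ (fun f) p≗x fpz) , _ , (λ _ → refl) , fpz

  realizer⇒ : ∀ {p z} → graph (realizerVersion f) p z → graph (fun f) p z
  realizer⇒ (_ , y , fpy , z≗y) = respʳ (fun f) (λ n → sym (z≗y n)) (named⇒ fpy)

  realizer⇐ : ∀ {p z} → graph (fun f) p z → graph (realizerVersion f) p z
  realizer⇐ fpz = (λ y _ → y , λ _ → refl) , _ , named⇐ fpz , λ _ → refl

-- The infinite loop

module _ {ℓ : Level} (f : MultiFun baire baire ℓ) where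

  private
    R = loopStep f

  Advance : Seq → Seq → Seq → Set
  Advance q r z = IsSup (approx (ev q)) r z

  advance-resp : ∀ {q q′ r r′ z z′} → q ≗ q′ → r ≗ r′ → z ≗ z′ → Advance q r z → Advance q′ r′ z′
  advance-resp {q} {q′} {r} {r′} q≗ r≗ z≗ = IsSup-resp (approx (ev q)) (approx (ev q′)) r r′ (approx-cong (λ i → q≗ (i + i))) r≗ z≗

  U⇒ : ∀ {x z} → graph (multi U) x z → IsSup (approx (ev x)) (od x) z
  U⇒ {x} (q , p , x≗ , sup) = IsSup-resp (approx q) (approx (ev x)) p (od x)
    (approx-cong λ i → trans (sym (ev-⟨⟩ q p i)) (sym (x≗ (i + i))))
    (λ i → trans (sym (od-⟨⟩ q p i)) (sym (x≗ (suc (i + i))))) (λ _ → refl) sup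

  id×⇒ : ∀ {q y} → graph ⟨id× f ⟩ q y → graph f (od q) (od y) × ev y ≗ ev q
  id×⇒ {q} {y} (a , p , r , q≗ , fpr , y≗) =
    respˡ f (λ i → trans (sym (od-⟨⟩ a p i)) (sym (q≗ (suc (i + i)))))
      (respʳ f (λ i → trans (sym (od-⟨⟩ a r i)) (sym (y≗ (suc (i + i))))) fpr) ,
    λ i → trans (y≗ (i + i)) (trans (ev-⟨⟩ a r i) (trans (sym (ev-⟨⟩ a p i)) (sym (q≗ (i + i)))))

  id×⇐ : ∀ {q r} → graph f (od q) r → graph ⟨id× f ⟩ q ⟨ ev q , r ⟩
  id×⇐ {q} {r} fr = ev q , od q , r , ⟨ev,od⟩ q , fr , λ _ → refl

  step⇒ : ∀ {q z} → graph R q z → ∃ λ r → graph f (od q) r × Advance q r z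
  step⇒ {q} {z} (_ , y , idy , Uyz) = let fr , ev≗ = id×⇒ {q} {y} idy in
    od y , fr , IsSup-resp (approx (ev y)) (approx (ev q)) (od y) (od y) (approx-cong ev≗) (λ _ → refl) (λ _ → refl) (U⇒ {y} Uyz)

  -- The domain of a composition asks that every answer lead into the domain of `U`, not only the
  -- answer `r` that is followed.
  step⇐ : ∀ {q} → (∀ r → graph f (od q) r → ∃ (Advance q r)) →
          ∀ {r z} → graph f (od q) r → Advance q r z → graph R q z
  step⇐ {q} total {r} {z} fr adv =
    (λ y idy → let fy , ev≗ = id×⇒ {q} {y} idy
                   z′ , adv′ = total (od y) fy
               in z′ , ev y , od y , ⟨ev,od⟩ y ,
                  IsSup-resp (approx (ev q)) (approx (ev y)) (od y) (od y) (approx-cong (λ i → sym (ev≗ i))) (λ _ → refl) (λ _ → refl) adv′) ,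
    ⟨ ev q , r ⟩ , id×⇐ {q} fr , ev q , r , (λ _ → refl) , adv

  total⇒ : ∀ {q} → dom R q → ∀ r → graph f (od q) r → ∃ (Advance q r)
  total⇒ {q} (_ , inc , _) r fr = let z , Uz = inc ⟨ ev q , r ⟩ (id×⇐ {q} fr) in
    z , IsSup-resp (approx (ev ⟨ ev q , r ⟩)) (approx (ev q)) (od ⟨ ev q , r ⟩) r
          (approx-cong (ev-⟨⟩ (ev q) r)) (od-⟨⟩ (ev q) r) (λ _ → refl) (U⇒ {⟨ ev q , r ⟩} Uz)

  -- Preservation of `I` under all answers puts every stage into the domain. Solvability of each
  -- instance under `I` then lets one actual run be picked, as membership in the graph requires.
  loop-intro : ∀ {ℓ′} (I : ℕ → Seq → Set ℓ′) → (∀ {i p q} → p ≗ q → I i p → I i q) →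
               (∀ {i q} → I i q → (∃ (graph f (od q))) × (∀ r → graph f (od q) r → ∃ λ z → Advance q r z × I (suc i) z)) →
               ∀ {q₀} → I 0 q₀ → dom (loop f) q₀
  loop-intro I I-resp progress {q₀} I₀ = ⟪ qs ⟫ , safe , qs , (λ _ → refl) , qs-step , λ _ → refl
    where
    total : ∀ {i q} → I i q → ∀ r → graph f (od q) r → ∃ (Advance q r)
    total Iq r fr = let z , adv , _ = proj₂ (progress Iq) r fr in z , adv

    stage : ∀ {i q} → Stage R q₀ i q → I i q
    stage (start q≗q₀) = I-resp (λ n → sym (q≗q₀ n)) I₀
    stage (step {p = p} st e) =
      let r , fr , adv = step⇒ e
          z , adv′ , Iz = proj₂ (progress (stage st)) r fr
      in I-resp (IsSup-unique (approx (ev p)) r adv′ adv) Iz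

    successor : ∀ {i q} → I i q → ∃ λ z → graph R q z × I (suc i) z
    successor {q = q} Iq =
      let (r , fr) , next = progress Iq
          z , adv , Iz = next r fr
      in z , step⇐ {q} (total Iq) fr adv , Iz

    safe : ∀ i q → Stage R q₀ i q → dom R q
    safe i q st = let z , Rqz , _ = successor (stage st) in z , Rqz

    run : ∀ i → ∃ (I i)
    run zero    = q₀ , I₀
    run (suc i) = let z , _ , Iz = successor (proj₂ (run i)) in z , Iz

    qs : ℕ → Seq
    qs i = proj₁ (run i)

    qs-step : ∀ i → graph R (qs i) (qs (suc i))
    qs-step i = proj₁ (proj₂ (successor (proj₂ (run i))))

-- Programs that output themselves

↾-cong-< : ∀ {p q : Seq} n → (∀ {i} → i < n → p i ≡ q i) → p ↾ n ≡ q ↾ n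
↾-cong-< zero    eq = refl
↾-cong-< (suc n) eq = cong₂ _∷_ (eq (s≤s z≤n)) (↾-cong-< n (eq ∘ s≤s))

⟨⟩-cong-< : ∀ {q q′ p p′} n → (∀ {i} → i < n → q i ≡ q′ i) → (∀ {i} → i < n → p i ≡ p′ i) →
            ∀ {i} → i < n → ⟨ q , p ⟩ i ≡ ⟨ q′ , p′ ⟩ i
⟨⟩-cong-< {q} {q′} {p} {p′} n eq eq′ {i} i<n with evenOrOdd i
... | even j = trans (ev-⟨⟩ q p j) (trans (eq (≤-<-trans (m≤m+n j j) i<n)) (sym (ev-⟨⟩ q′ p′ j)))
... | odd  j = trans (od-⟨⟩ q p j) (trans (eq′ (≤-<-trans (m≤n⇒m≤1+n (m≤m+n j j)) i<n)) (sym (od-⟨⟩ q′ p′ j)))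

-- For input `p` and answer `s`, the program is to output itself interleaved with the next instance
-- `T p s`. Symbol `i` of that instance may depend only on the symbols up to `i` of `p` and `s`;
-- thus a word of length `l` determines `l` symbols of output.
module Quine (t : ℕ → Word → Word → ℕ) (T : Seq → Seq → Seq)
             (rt : Recursive {nat ∷ word ∷ word ∷ []} {nat} λ (i , u , v , _) → t i u v)
             (t-local : ∀ {p s i m n} → i < m → i < n → t i (p ↾ m) (s ↾ n) ≡ T p s i) where

  -- The value of the program at the code n of a word w has length |w| ≤ n, so it
  -- only involves values of the program at numbers below n.
  entry : Word → Word → ℕ → ℕ
  entry A u n = encode (⟨ nth A , (λ i → t i u (decode n)) ⟩ ↾ length (decode n))

  -- Course-of-values recursion. Each stage tabulates the list anew with one more entry: among the
  -- indices up to `n`, the difference `n ∸ i` vanishes only at the new one.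
  entries : Word → ℕ → Word
  entries u = iter [] λ n A → (λ i → caseℕ (n ∸ i) (entry A u n) λ _ → nth A i) ↾ suc n

  programBelow : Word → ℕ → ℕ
  programBelow u n = nth (entries u (suc n)) n

  program : Seq → Seq
  program p n = programBelow (p ↾ n) n

  programBelowᵣ : ∀ {u n} → Recursive {Γ} {word} u → Recursive {Γ} {nat} n →
                  Recursive {Γ} {nat} λ γ → programBelow (u γ) (n γ)
  programBelowᵣ ru rn = nthᵣ (iterᵣ (sucᵣ rn) []ᵣ
    (tabulateᵣ (sucᵣ v₀) (caseᵣ (v₁ ∸ᵣ v₀) (entryᵣ v₂ (wk (wk (wk ru))) v₁) (nthᵣ v₃ v₁)))) rn
    where
    entryᵣ : ∀ {Γ A u n} → Recursive {Γ} {word} A → Recursive {Γ} {word} u → Recursive {Γ} {nat} n →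
             Recursive {Γ} {nat} λ γ → entry (A γ) (u γ) (n γ)
    entryᵣ rA ru rn = encodeᵣ (tabulateᵣ (lengthᵣ (decodeᵣ rn))
      (⟨ nthᵣ (wk (wk rA)) v₀ , callᵣ rt (v₀ ∷ₐ wk (wk ru) ∷ₐ wk (wk (decodeᵣ rn)) ∷ₐ []ₐ) ⟩ᵣ v₀))

  T-local : ∀ {p s s′ n} → s ↾ n ≡ s′ ↾ n → ∀ {i} → i < n → T p s i ≡ T p s′ i
  T-local {p} {s} {s′} {n} eq {i} i<n =
    trans (sym (t-local i<n i<n)) (trans (cong (t i (p ↾ n)) eq) (t-local i<n i<n))

  entry-value : ∀ {p m n} → n ≤ m →
                entry (program p ↾ n) (p ↾ m) n ≡ encode (⟨ program p , T p (nth (decode n)) ⟩ ↾ length (decode n))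
  entry-value {p} {m} {n} n≤m = cong encode (↾-cong-< l (⟨⟩-cong-< l
    (λ i<l → nth-↾ (program p) (<-≤-trans i<l l≤n))
    λ {i} i<l → trans (cong (t i (p ↾ m)) (⊏-nth (decode n))) (t-local (<-≤-trans i<l (≤-trans l≤n n≤m)) i<l)))
    where
    l = length (decode n)
    l≤n : l ≤ n
    l≤n = subst (l ≤_) (encode-decode n) (length≤encode (decode n))

  entries-value : ∀ {p} n {m} → n ≤ m → entries (p ↾ m) n ≡ program p ↾ n
  last-entry    : ∀ {p} n {m} → n ≤ m → programBelow (p ↾ m) n ≡ entry (program p ↾ n) (p ↾ m) n

  entries-value zero    _ = refl
  entries-value {p} (suc n) {m} n<m = ↾-cong-< (suc n) λ {i} i<1+n → case m≤n⇒m<n∨m≡n (s≤s⁻¹ i<1+n) of λ where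
      (inj₁ i<n) → trans (old i<n) (trans (cong (λ A → nth A i) (entries-value n (<⇒≤ n<m))) (nth-↾ (program p) i<n))
      (inj₂ refl) → new
    where
    prev = entries (p ↾ m) n
    e = entry prev (p ↾ m) n
    old : ∀ {i} → i < n → caseℕ (n ∸ i) e (λ _ → nth prev i) ≡ nth prev i
    old {i} i<n with n ∸ i in eq
    ... | zero  = contradiction (m∸n≡0⇒m≤n eq) (<⇒≱ i<n)
    ... | suc _ = refl
    new : caseℕ (n ∸ n) e (λ _ → nth prev n) ≡ program p n
    new rewrite n∸n≡0 n = begin
      entry prev (p ↾ m) n                    ≡⟨ cong (λ A → entry A (p ↾ m) n) (entries-value n (<⇒≤ n<m)) ⟩
      entry (program p ↾ n) (p ↾ m) n         ≡⟨ entry-value (<⇒≤ n<m) ⟩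
      _                                       ≡⟨ entry-value ≤-refl ⟨
      entry (program p ↾ n) (p ↾ n) n         ≡⟨ last-entry n ≤-refl ⟨
      program p n                             ∎
      where open ≡-Reasoning

  last-entry {p} n {m} n≤m = begin
    nth ((λ i → caseℕ (n ∸ i) e λ _ → nth prev i) ↾ suc n) n  ≡⟨ nth-↾ (λ i → caseℕ (n ∸ i) e λ _ → nth prev i) (n<1+n n) ⟩
    caseℕ (n ∸ n) e (λ _ → nth prev n)                     ≡⟨ cong (λ k → caseℕ k e λ _ → nth prev n) (n∸n≡0 n) ⟩
    entry prev (p ↾ m) n                                   ≡⟨ cong (λ A → entry A (p ↾ m) n) (entries-value n n≤m) ⟩
    entry (program p ↾ n) (p ↾ m) n                        ∎
    where
    open ≡-Reasoning
    prev = entries (p ↾ m) n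
    e = entry prev (p ↾ m) n

  programBelow-value : ∀ {p n m} → n ≤ m → programBelow (p ↾ m) n ≡ program p n
  programBelow-value {p} {n} n≤m =
    trans (last-entry n n≤m) (trans (entry-value n≤m) (sym (trans (last-entry n ≤-refl) (entry-value ≤-refl))))

  -- The fixed-point equation. At each prefix of `s` the table holds an equally long prefix of
  -- itself interleaved with the next instance, so the values along `s` have the required supremum.
  program-encode : ∀ p s n → decode (program p (encode (s ↾ n))) ≡ ⟨ program p , T p s ⟩ ↾ n
  program-encode p s n = begin
    decode (program p e)                                                     ≡⟨ cong decode (trans (last-entry e ≤-refl) (entry-value ≤-refl)) ⟩
    decode (encode (⟨ program p , T p (nth (decode e)) ⟩ ↾ length (decode e)))  ≡⟨ decode-encode _ ⟩
    ⟨ program p , T p (nth (decode e)) ⟩ ↾ length (decode e)                  ≡⟨ cong (λ w → ⟨ program p , T p (nth w) ⟩ ↾ length w) (decode-encode (s ↾ n)) ⟩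
    ⟨ program p , T p (nth (s ↾ n)) ⟩ ↾ length (s ↾ n)                        ≡⟨ cong (⟨ program p , T p (nth (s ↾ n)) ⟩ ↾_) (length-applyUpTo s n) ⟩
    ⟨ program p , T p (nth (s ↾ n)) ⟩ ↾ n                                     ≡⟨ ↾-cong-< n (⟨⟩-cong-< {program p} n (λ _ → refl) (T-local (↾-cong-< n (nth-↾ s)))) ⟩
    ⟨ program p , T p s ⟩ ↾ n                                                 ∎
    where
    open ≡-Reasoning
    e = encode (s ↾ n)

  program-advance : ∀ {p q r} → ev q ≗ program p → IsSup (approx (ev q)) r ⟨ program p , T p r ⟩
  program-advance {p} {q} {r} eq = IsSup-resp (approx (program p)) (approx (ev q)) r r
    (approx-cong λ i → sym (eq i)) (λ _ → refl) (λ _ → refl)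
    (IsSup-monotonise {λ w → decode (program p (encode w))} (
      (λ n → subst (_⊏ ⟨ program p , T p r ⟩) (sym (program-encode p r n)) (↾-⊏ ⟨ program p , T p r ⟩ n)) ,
      λ k → k , ≤-reflexive (sym (trans (cong length (program-encode p r k)) (length-applyUpTo ⟨ program p , T p r ⟩ k)))))

  program-unique : ∀ {p q r z} → ev q ≗ program p → IsSup (approx (ev q)) r z → z ≗ ⟨ program p , T p r ⟩
  program-unique {p} {q} {r} eq sup = IsSup-unique (approx (ev q)) r sup (program-advance {p} {q} {r} eq)

  module Initial (ι : ℕ → Word → ℕ) (I : Seq → Seq)
               (rι : Recursive {nat ∷ word ∷ []} {nat} λ (i , u , _) → ι i u)
               (ι-local : ∀ {p i m} → i < m → ι i (p ↾ m) ≡ I p i) where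

    initial : Word → Word
    initial w = (λ n → ⟨ programBelow w , (λ i → ι i w) ⟩ n) ↾ length w

    initialᵣ : Recursive {word ∷ []} {word} λ (w , _) → initial w
    initialᵣ = tabulateᵣ (lengthᵣ v₀) (⟨ programBelowᵣ v₂ v₀ , wk₁ rι ⟩ᵣ v₀)

    initial-sup : ∀ p → IsSup initial p ⟨ program p , I p ⟩
    initial-sup p = local-sup {λ n w → ⟨ programBelow w , (λ i → ι i w) ⟩ n}
      λ {_} {m} n<m → ⟨⟩-cong-< {programBelow (p ↾ m)} {program p} {λ i → ι i (p ↾ m)} {I p} m (λ i<m → programBelow-value (<⇒≤ i<m)) ι-local n<m

-- Problems that reduce to their infinite loop

≗⟨⟩⇒ev : ∀ {x q p} → x ≗ ⟨ q , p ⟩ → ev x ≗ q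
≗⟨⟩⇒ev {x} {q} {p} eq i = trans (eq (i + i)) (ev-⟨⟩ q p i)

≗⟨⟩⇒od : ∀ {x q p} → x ≗ ⟨ q , p ⟩ → od x ≗ p
≗⟨⟩⇒od {x} {q} {p} eq i = trans (eq (suc (i + i))) (od-⟨⟩ q p i)

loop⇒ : ∀ {f : MultiFun baire baire ℓ} {q₀ z} → graph (loop f) q₀ z → ∃ λ qs → qs 0 ≗ q₀ × z ≗ ⟪ qs ⟫ ×
        (∀ i → ∃ λ r → graph f (od (qs i)) r × Advance f (qs i) r (qs (suc i)))
loop⇒ {f = f} (_ , qs , eq , run , res) = qs , eq , res , λ i → step⇒ f {qs i} {qs (suc i)} (run i)

realizerVersion⇐ : ∀ {X : RepresentedSpace ℓ ℓ₁} {Y : RepresentedSpace ℓ₂ ℓ₃} {f : Problem X Y ℓ₄} {p r y} →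
                   graph (named f) p y → graph (multi (δ Y)) r y → graph (realizerVersion f) p r
realizerVersion⇐ {Y = Y} fpy δry = (λ y′ _ → surjective Y y′) , _ , fpy , δry

module _ {X : RepresentedSpace ℓ ℓ₁} {Y : RepresentedSpace ℓ₂ ℓ₃} {f : Problem X Y ℓ₄}
         {t : ℕ → Word → ℕ} {T : Seq → Seq} (rt : Recursive {nat ∷ word ∷ []} {nat} λ (i , v , _) → t i v)
         (t-local : ∀ {s i n} → i < n → t i (s ↾ n) ≡ T s i)
         {pos : ℕ → ℕ} {val : ℕ → ℕ → ℕ} (rpos : Recursive {nat ∷ []} {nat} λ (i , _) → pos i)
         (rval : Recursive {nat ∷ nat ∷ []} {nat} λ (i , n , _) → val i n) where

  private
    F = realizerVersion f
    module Q = Quine (λ i _ v → t i v) (λ _ → T) (wk₁ rt) (λ {p} {s} {i} {m} {n} _ → t-local {s} {i} {n})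
    module S = Q.Initial (λ i u → nth u i) id (nthᵣ v₁ v₀) (λ {p} {i} {m} → nth-↾ p {m} {i})

    -- The place of `T r (pos j)` in `⟨ p , z ⟩`: the odd half is the loop output `z`, its column 1
    -- is the point `q₁`, and the odd half of that point is `T r`.
    position : ℕ → ℕ
    position j = suc (k + k)
      where k = pair 1 (suc (pos j + pos j))

    answer : Word → Word
    answer v = collect (length v) λ j → caseℕ (at? v (position j)) 0 λ n → suc (val j n)

    answerᵣ : Recursive {word ∷ []} {word} λ (v , _) → answer v
    answerᵣ = collectᵣ (lengthᵣ v₀) (caseᵣ (at?ᵣ v₁ (sucᵣ (k +ᵣ k))) zeroᵣ (sucᵣ (callᵣ rval (v₁ ∷ₐ v₀ ∷ₐ []ₐ))))
      where
      pos′ : Recursive {nat ∷ word ∷ []} {nat} λ (j , _) → pos j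
      pos′ = callᵣ rpos (v₀ ∷ₐ []ₐ)
      k = pairᵣ (sucᵣ zeroᵣ) (sucᵣ (pos′ +ᵣ pos′))

  -- The first answer `r` has to be recovered from the instance `T r` of round 1. `T-dom` says that
  -- this instance is solvable again, which keeps all further rounds in the domain.
  ≤W-loop : (∀ {p r} → graph F p r → ∃ (graph F (T r))) →
            (∀ {p r} → graph F p r → ∀ j → val j (T r (pos j)) ≡ r j) → f ≤W f ^∞
  ≤W-loop T-dom recover = reduction {f = f} {g = f ^∞} {S.initial} {answer} S.initialᵣ answerᵣ λ p (y , fpy) →
    let q₀ = ⟨ Q.program p , p ⟩
        x , δxy = surjective Y y
    in q₀ , S.initial-sup p ,
       (let z , lz = loop-intro F (Invariant p) (λ {i} {q} {q′} → invariant-resp p i {q} {q′}) (λ {i} {q} → progress p i {q}) {q₀}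
                       (q₀-invariant p (realizerVersion⇐ {f = f} fpy δxy)) in z , named⇐ {f = f ^∞} lz) ,
       λ z y′ ly z≗y′ →
         let qs , qs₀ , y′≗ , run = loop⇒ {f = F} {q₀} {y′} (named⇒ {f = f ^∞} ly)
             r , Fr , adv = run 0
             Fpr = respˡ F (≗⟨⟩⇒od qs₀) Fr
             qs₁ = Q.program-unique {p} {qs 0} {r} (≗⟨⟩⇒ev qs₀) adv
             _ , y″ , fpy″ , δry″ = Fpr
             az = odds-approximates (↾-approximates ⟨ p , z ⟩)
         in r , y″ ,
            approximates⇒sup answer ⟨ p , z ⟩ (collect-approximates (length ∘ (⟨ p , z ⟩ ↾_)) (long (↾-approximates ⟨ p , z ⟩)) λ j →
              reads-resp (λ _ → refl) (trans (cong (val j) (value p z qs r y′≗ z≗y′ qs₁ j)) (recover Fpr j))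
                (reads-case (reads-at (↾-approximates ⟨ p , z ⟩) (position j)) (reads-suc (val j (⟨ p , z ⟩ (position j)))))) ,
            δry″ , fpy″
    where
    Invariant : Seq → ℕ → Seq → Set _
    Invariant p _ q = ev q ≗ Q.program p × ∃ (graph F (od q))

    invariant-resp : ∀ p i {q q′} → q ≗ q′ → Invariant p i q → Invariant p i q′
    invariant-resp p i eq (evq , r , Fr) =
      (λ n → trans (sym (eq (n + n))) (evq n)) , r , respˡ F (λ n → eq (suc (n + n))) Fr

    q₀-invariant : ∀ p {r} → graph F p r → Invariant p 0 ⟨ Q.program p , p ⟩
    q₀-invariant p Fpr = ev-⟨⟩ (Q.program p) p , _ , respˡ F (λ n → sym (od-⟨⟩ (Q.program p) p n)) Fpr

    progress : ∀ p i {q} → Invariant p i q →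
               ∃ (graph F (od q)) × (∀ r → graph F (od q) r → ∃ λ z → Advance F q r z × Invariant p (suc i) z)
    progress p i {q} (evq , Fq) = Fq , λ r Fr →
      let s , FTs = T-dom Fr in
      ⟨ Q.program p , T r ⟩ , Q.program-advance {p} {q} {r} evq ,
      ev-⟨⟩ (Q.program p) (T r) , s , respˡ F (λ n → sym (od-⟨⟩ (Q.program p) (T r) n)) FTs

    value : ∀ p z qs r {y} → y ≗ ⟪ qs ⟫ → z ≗ y → qs 1 ≗ ⟨ Q.program p , T r ⟩ → ∀ j →
            ⟨ p , z ⟩ (position j) ≡ T r (pos j)
    value p z qs r {y} y≗ z≗ qs₁ j = begin
      ⟨ p , z ⟩ (position j)             ≡⟨ od-⟨⟩ p z (pair 1 k) ⟩
      z (pair 1 k)                       ≡⟨ z≗ (pair 1 k) ⟩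
      y (pair 1 k)                       ≡⟨ y≗ (pair 1 k) ⟩
      ⟪ qs ⟫ (pair 1 k)                  ≡⟨ cong (λ (i , j) → qs i j) (unpair-pair 1 k) ⟩
      qs 1 k                             ≡⟨ qs₁ k ⟩
      ⟨ Q.program p , T r ⟩ k            ≡⟨ od-⟨⟩ (Q.program p) (T r) (pos j) ⟩
      T r (pos j)                        ∎
      where
      open ≡-Reasoning
      k = suc (pos j + pos j)

-- The limit map

lim⇒ : ∀ {p r} → graph (fun lim) p r → ∀ n → ∃ λ m → ∀ i → m ≤ i → p (pair i n) ≡ r n
lim⇒ {p} {r} (ps , p≗ , conv) n = let m , eq = conv (suc n) in m , λ i m≤i →
  trans (p≗ (pair i n)) (trans (cong (λ (i , j) → ps i j) (unpair-pair i n)) (↾-injective {p = ps i} {q = r} (suc n) (eq i m≤i) n (n<1+n n)))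

lim⇐ : ∀ {p r} → (∀ n → ∃ λ m → ∀ i → m ≤ i → p (pair i n) ≡ r n) → graph (fun lim) p r
lim⇐ {p} {r} conv = (λ i j → p (pair i j)) , (λ n → cong p (sym (pair-π n))) , λ k →
  let m , eq = eventually-all {λ n i → p (pair i n) ≡ r n} k (λ {n} _ → conv n)
  in m , λ i m≤i → ↾-cong-< k (eq i m≤i)

-- The next instance has `r` as each of its rows, hence it converges, and `r` can be read in row 0.
lim≤lim^∞ : lim ≤W lim ^∞
lim≤lim^∞ = ≤W-loop {f = lim} {λ i v → nth v (π₂ i)} {λ r i → r (π₂ i)} (nthᵣ v₁ (π₂ᵣ v₀))
  (λ {s} {i} i<n → nth-↾ s (≤-<-trans (π₂≤ i) i<n)) {pair 0} {λ _ n → n} (pairᵣ zeroᵣ v₀) v₁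
  (λ {_} {r} _ → r , realizer⇐ {f = lim} (lim⇐ λ n → 0 , λ i _ → cong r (π₂-pair i n)))
  λ {_} {r} _ j → cong r (π₂-pair 0 j)

-- Evaluating the infinite loop on words

column : Seq → ℕ → Seq
column x i j = x (pair i j)

columnW : Word → ℕ → Word
columnW w i = collect (length w) λ j → at? w (pair i j)

columnWᵣ : ∀ {w i} → Recursive {Γ} {word} w → Recursive {Γ} {nat} i → Recursive {Γ} {word} λ γ → columnW (w γ) (i γ)
columnWᵣ rw ri = collectᵣ (lengthᵣ rw) (at?ᵣ (wk rw) (pairᵣ (wk ri) v₀))

columnW-⊏ : ∀ {w x} i → w ⊏ x → columnW w i ⊏ column x i
columnW-⊏ {w} i w⊏x = collect-⊏ (length w) _ (⊏⇒at?≡ w⊏x)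

columnW-approximates : ∀ {M W x} i → Approximates M W x → Approximates M (λ m → columnW (W m) i) (column x i)
columnW-approximates {W = W} i ap = collect-approximates (length ∘ W) (long ap) λ j → reads-at ap (pair i j)

chain : Word → Word → ℕ → Word
chain v w = iter v λ i u → evaluate u (columnW w i)

chainᵣ : ∀ {v w i} → Recursive {Γ} {word} v → Recursive {Γ} {word} w → Recursive {Γ} {nat} i →
         Recursive {Γ} {word} λ γ → chain (v γ) (w γ) (i γ)
chainᵣ rv rw ri = iterᵣ ri rv (evaluateᵣ v₁ (columnWᵣ (wk (wk rw)) v₀))

-- The columns of `x` take the place of the answers without being required to be correct. This
-- separates recomputing a run from checking it.
data Run (q₀ x : Seq) : ℕ → Seq → Set where
  begin-run : ∀ {q} → q ≗ q₀ → Run q₀ x 0 q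
  continue-run : ∀ {i q z} → Run q₀ x i q → IsSup (approx (ev q)) (column x i) z → Run q₀ x (suc i) z

module _ {q₀ x : Seq} where

  chain-⊏ : ∀ {v w i q} → v ⊏ q₀ → w ⊏ x → Run q₀ x i q → chain v w i ⊏ q
  chain-⊏ {v} v⊏ w⊏ (begin-run eq) = ⊏-resp {w = v} (λ n → sym (eq n)) v⊏
  chain-⊏ {w = w} v⊏ w⊏ (continue-run {i} run sup) = evaluate-⊏ (chain-⊏ v⊏ w⊏ run) sup (columnW-⊏ {w} i w⊏)

  chain-approximates : ∀ {M V W i q} → Approximates M V q₀ → Approximates M W x → Run q₀ x i q →
                       Approximates M (λ m → chain (V m) (W m) i) q
  chain-approximates av aw (begin-run eq) = approximates-resp (λ n → sym (eq n)) av
  chain-approximates av aw (continue-run {i} run sup) =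
    evaluate-approximates (chain-approximates av aw run) (columnW-approximates i aw) sup

loopOutput : Word → Word → Word
loopOutput v w = collect (length v) λ n → at? (chain v w (π₁ n)) (π₂ n)

loopOutputᵣ : ∀ {v w} → Recursive {Γ} {word} v → Recursive {Γ} {word} w →
              Recursive {Γ} {word} λ γ → loopOutput (v γ) (w γ)
loopOutputᵣ rv rw = collectᵣ (lengthᵣ rv) (at?ᵣ (chainᵣ (wk rv) (wk rw) (π₁ᵣ v₀)) (π₂ᵣ v₀))

loopOutput-approximates : ∀ {M V W q₀ x qs} → Approximates M V q₀ → Approximates M W x → (∀ i → Run q₀ x i (qs i)) →
                          Approximates M (λ m → loopOutput (V m) (W m)) ⟪ qs ⟫
loopOutput-approximates {V = V} av aw run = collect-approximates (length ∘ V) (long av) λ n →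
  reads-at (chain-approximates av aw (run (π₁ n))) (π₂ n)

-- Closed choice

module _ {X : BasedSpace} where
  open Negative X

  named-choice⇒ : ∀ {p x} → graph (named (C X)) p x → ¬ Enumerated p x
  named-choice⇒ {x = x} (_ , B , names , B∋x) = Equivalence.to (names x) B∋x

  named-choice⇐ : ∀ {p x} → ¬ Enumerated p x → graph (named (C X)) p x
  named-choice⇐ {p} {x} ¬e =
    (λ B names → x , Equivalence.from (names x) ¬e) ,
    record { _∋_ = λ x → ¬ Enumerated p x ; enumeration = p , λ _ → mk⇔ id id } , (λ _ → mk⇔ id id) , ¬e

-- Cantor space and Baire space are treated alike: a name of a point is a sequence
-- of letters fixed by norm.
record SequenceSpace (X : BasedSpace) : Set₁ where
  field
    norm   : ℕ → ℕ
    norm-0 : norm 0 ≡ 0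
    norm-1 : norm 1 ≡ 1
    normᵣ  : ∀ {Γ n} → Recursive {Γ} {nat} n → Recursive {Γ} {nat} λ γ → norm (n γ)

  Valid : Seq → Set
  Valid r = ∀ n → norm (r n) ≡ r n

  field
    name⇒valid : ∀ {r x} → graph (multi (δ (represented X))) r x → Valid r
    valid⇒name : ∀ {r} → Valid r → ∃ (graph (multi (δ (represented X))) r)
    base⇔      : ∀ {r x} k → graph (multi (δ (represented X))) r x → BasedSpace.base X k x ⇔ map norm (decode k) ⊏ r

module ClosedChoice {X : BasedSpace} (S : SequenceSpace X) where
  open SequenceSpace S
  open Negative X using (Enumerated)

  F : MultiFun baire baire _
  F = realizerVersion (C X)

  Excludes : Seq → Seq → Set
  Excludes p r = ∃₂ λ n k → p n ≡ suc k × map norm (decode k) ⊏ r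

  excludes⇔ : ∀ {p r x} → graph (multi (δ (represented X))) r x → Enumerated p x ⇔ Excludes p r
  excludes⇔ δrx = mk⇔ (λ (n , k , eq , b) → n , k , eq , Equivalence.to (base⇔ k δrx) b)
                      (λ (n , k , eq , b) → n , k , eq , Equivalence.from (base⇔ k δrx) b)

  F⇒ : ∀ {p r} → graph F p r → Valid r × ¬ Excludes p r
  F⇒ (_ , x , np , δrx) = name⇒valid δrx , λ e → named-choice⇒ {X} np (Equivalence.from (excludes⇔ δrx) e)

  F⇐ : ∀ {p r} → Valid r → ¬ Excludes p r → graph F p r
  F⇐ v ¬e = let x , δrx = valid⇒name v in
    realizerVersion⇐ {f = C X} (named-choice⇐ {X} λ e → ¬e (Equivalence.to (excludes⇔ δrx) e)) δrx

  -- Carries the answer `r` to the next round. The first letter, after `norm`, differs from `r 0`,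
  -- so excluding this cylinder leaves `r` admissible; the second letter is the symbol transmitted.
  two-letters : ℕ → ℕ → Word
  two-letters m n = (1 ∸ m) ∷ n ∷ []

  ≤loop : C X ≤W C X ^∞
  ≤loop = ≤W-loop {f = C X} {λ i v → suc (encode (two-letters (nth v 0) (nth v i)))} {λ r i → suc (encode (two-letters (r 0) (r i)))}
    (sucᵣ (encodeᵣ ((sucᵣ zeroᵣ ∸ᵣ nthᵣ v₁ zeroᵣ) ∷ᵣ nthᵣ v₁ v₀ ∷ᵣ []ᵣ)))
    (λ {s} {i} i<n → cong₂ (λ m n → suc (encode (two-letters m n))) (nth-↾ s (≤-<-trans z≤n i<n)) (nth-↾ s i<n))
    {id} {λ _ n → nth (decode (pred n)) 1} v₀ (nthᵣ (decodeᵣ (predᵣ v₁)) (sucᵣ zeroᵣ))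
    (λ {_} {r} Fr → r , F⇐ (proj₁ (F⇒ Fr)) λ { (n , k , refl , b) →
      flipped (r 0) (cong (λ w → nth w 0) (trans (cong (map norm) (sym (decode-encode (two-letters (r 0) (r n))))) b)) })
    λ {_} {r} Fr j → cong (λ w → nth w 1) (decode-encode (two-letters (r 0) (r j)))
    where
    flipped : ∀ n → ¬ (norm (1 ∸ n) ≡ n)
    flipped zero    eq = case trans (sym norm-1) eq of λ ()
    flipped (suc n) eq = case trans (sym eq) (trans (cong norm (0∸n≡0 n)) norm-0) of λ ()

  normal : Word → Word
  normal = map norm

  normalᵣ : ∀ {w} → Recursive {Γ} {word} w → Recursive {Γ} {word} λ γ → normal (w γ)
  normalᵣ {w = w} rw = ext (λ γ → go (w γ)) (tabulateᵣ (lengthᵣ rw) (normᵣ (nthᵣ (wk rw) v₀)))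
    where
    go : ∀ w → (λ i → norm (nth w i)) ↾ length w ≡ normal w
    go []      = refl
    go (n ∷ w) = cong (norm n ∷_) (go w)

  -- The word w with code c is excluded if after m symbols of q₀ and i rounds fed
  -- with the columns of w, the j-th symbol of the current set excludes column i.
  excluded : Word → ℕ → ℕ → ℕ → ℕ
  excluded v c i j = caseℕ (at? (chain v w i) (suc (j + j))) 0 λ n → caseℕ n 0 λ k →
                     caseℕ (mismatch (normal (decode k)) (columnW w i)) (suc c) λ _ → 0
    where w = normal (decode c)

  excludedᵣ : ∀ {v c i j} → Recursive {Γ} {word} v → Recursive {Γ} {nat} c → Recursive {Γ} {nat} i → Recursive {Γ} {nat} j →
              Recursive {Γ} {nat} λ γ → excluded (v γ) (c γ) (i γ) (j γ)
  excludedᵣ {Γ} {c = c} rv rc ri rj = caseᵣ (at?ᵣ (chainᵣ rv rw ri) (sucᵣ (rj +ᵣ rj))) zeroᵣ (caseᵣ v₀ zeroᵣ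
    (caseᵣ (mismatchᵣ (normalᵣ (decodeᵣ v₀)) (columnWᵣ (wk (wk rw)) (wk (wk ri)))) (sucᵣ (wk (wk rc))) zeroᵣ))
    where
    rw : Recursive {Γ} {word} λ γ → normal (decode (c γ))
    rw = normalᵣ (decodeᵣ rc)

  excluded⇒ : ∀ v c i j {d} → excluded v c i j ≡ suc d → d ≡ c × (∃ λ k →
              at? (chain v (normal (decode c)) i) (suc (j + j)) ≡ suc (suc k) ×
              normal (decode k) ⊑ columnW (normal (decode c)) i)
  excluded⇒ v c i j eq with at? (chain v (normal (decode c)) i) (suc (j + j))
  excluded⇒ v c i j eq | suc (suc k) with mismatch (normal (decode k)) (columnW (normal (decode c)) i) in eq′
  excluded⇒ v c i j refl | suc (suc k) | zero = refl , k , refl ,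
    at?⇒⊑ _ _ λ lt → distance≡0⇒≡ (sumBelow≡0⇒ _ _ eq′ lt)

  excluded⇐ : ∀ v c i j {k} → at? (chain v (normal (decode c)) i) (suc (j + j)) ≡ suc (suc k) →
              normal (decode k) ⊑ columnW (normal (decode c)) i → excluded v c i j ≡ suc c
  excluded⇐ v c i j {k} eq le rewrite eq
    | ⇒sumBelow≡0 (λ l → distance (at? (normal (decode k)) l) (at? (columnW (normal (decode c)) i) l)) (length (normal (decode k)))
        (λ lt → ≡⇒distance≡0 (⊑⇒at? le lt)) = refl

  -- A name of the merged closed set. The index is read as `pair c (pair m (pair i j))`, so all
  -- words, stages, rounds and positions are searched.
  runs : Seq → Seq
  runs q n = excluded (q ↾ π₁ (π₂ n)) (π₁ n) (π₁ (π₂ (π₂ n))) (π₂ (π₂ (π₂ n)))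

  runsBelow : ℕ → Word → ℕ
  runsBelow n v = excluded (nth v ↾ π₁ (π₂ n)) (π₁ n) (π₁ (π₂ (π₂ n))) (π₂ (π₂ (π₂ n)))

  runsBelowᵣ : Recursive {nat ∷ word ∷ []} {nat} λ (n , v , _) → runsBelow n v
  runsBelowᵣ = excludedᵣ (tabulateᵣ (π₁ᵣ (π₂ᵣ v₀)) (nthᵣ v₂ v₀)) (π₁ᵣ v₀) (π₁ᵣ (π₂ᵣ (π₂ᵣ v₀))) (π₂ᵣ (π₂ᵣ (π₂ᵣ v₀)))

  runs-local : ∀ {q} → Local runsBelow q (runs q)
  runs-local {q} {n} {m} n<m = cong (λ v → excluded v (π₁ n) (π₁ (π₂ (π₂ n))) (π₂ (π₂ (π₂ n))))
    (↾-cong-< (π₁ (π₂ n)) λ i< → nth-↾ q (<-trans i< (≤-<-trans (≤-trans (π₁≤ (π₂ n)) (π₂≤ n)) n<m)))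

  column-valid : ∀ {x} → Valid x → ∀ i → Valid (column x i)
  column-valid v i j = v (pair i j)

  normal-⊏ : ∀ {w x} → Valid x → w ⊏ x → normal w ≡ w
  normal-⊏ {w} {x} v w⊏x = trans (cong normal w⊏x) (trans (go x (length w) v) (sym w⊏x))
    where
    go : ∀ x n → Valid x → normal (x ↾ n) ≡ x ↾ n
    go x zero    v = refl
    go x (suc n) v = cong₂ _∷_ (v 0) (go (x ∘ suc) n (v ∘ suc))

  R : MultiFun baire baire _
  R = loopStep F

  -- The answers of an actual run, taken as columns, survive: whatever `chain` computes from finite
  -- prefixes is a true part of the run, so an exclusion would contradict the correctness of some
  -- answer.
  runs-inhabited : ∀ {q₀ z} → graph (loop F) q₀ z → ∃ λ x → Valid x × ¬ Excludes (runs q₀) x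
  runs-inhabited {q₀} {z} lz = x , valid , λ (n , c , eq , c⊏x) →
      let i = π₁ (π₂ (π₂ n))
          c≡ , k , eq′ , le = excluded⇒ (q₀ ↾ π₁ (π₂ n)) (π₁ n) i (π₂ (π₂ (π₂ n))) eq
          w⊏x = subst (λ c → normal (decode c) ⊏ x) c≡ c⊏x
      in proj₂ (F⇒ (proj₁ (proj₂ (steps i)))) (π₂ (π₂ (π₂ n)) , k ,
           sym (⊏⇒at?≡ (chain-⊏ {v = q₀ ↾ π₁ (π₂ n)} (↾-⊏ q₀ (π₁ (π₂ n))) w⊏x (run i)) eq′) ,
           ⊏-resp {w = normal (decode k)} (column≗ i) (⊑-⊏ le (columnW-⊏ {normal (decode (π₁ n))} i w⊏x)))
    where
    qs = proj₁ (loop⇒ {f = F} lz)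
    qs₀ = proj₁ (proj₂ (loop⇒ {f = F} {q₀} {z} lz))
    steps = proj₂ (proj₂ (proj₂ (loop⇒ {f = F} {q₀} {z} lz)))

    x : Seq
    x = ⟪ (λ i → proj₁ (steps i)) ⟫

    column≗ : ∀ i → column x i ≗ proj₁ (steps i)
    column≗ i j = cong (λ (i , j) → proj₁ (steps i) j) (unpair-pair i j)

    valid : Valid x
    valid n = proj₁ (F⇒ (proj₁ (proj₂ (steps (π₁ n))))) (π₂ n)

    run : ∀ i → Run q₀ x i (qs i)
    run zero    = begin-run qs₀
    run (suc i) = continue-run (run i) (advance-resp F {qs i} {qs i} (λ _ → refl) (λ j → sym (column≗ i j)) (λ _ → refl) (proj₂ (proj₂ (steps i))))

  module _ {q₀ x : Seq} (v : Valid x) (¬e : ¬ Excludes (runs q₀) x) where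

    column∈ : ∀ {i q} → Run q₀ x i q → graph F (od q) (column x i)
    column∈ {i} {q} run = F⇐ (column-valid v i) λ (j , k , eq , w⊏) →
      let w = normal (decode k)
          ax = ↾-approximates x
          M , atM = complete (reads-at (chain-approximates (↾-approximates q₀) ax run) (suc (j + j)))
          N , longN = long (columnW-approximates i ax) (length w)
          -- One number serves as stage of `q₀` and as length of the prefix of `x`: far enough to
          -- produce the offending symbol of round `i`, and for column `i` to cover the excluded
          -- word.
          m = M ⊔ N
          c = encode (x ↾ m)
          normal≡ : normal (decode c) ≡ x ↾ m
          normal≡ = trans (cong normal (decode-encode (x ↾ m))) (normal-⊏ v (↾-⊏ x m))
          n = pair c (pair m (pair i j))
      in ¬e (n , c ,
         trans (cong (λ (c , n) → excluded (q₀ ↾ π₁ n) c (π₁ (π₂ n)) (π₂ (π₂ n))) (unpair-pair c (pair m (pair i j))))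
         (trans (cong (λ (m , n) → excluded (q₀ ↾ m) c (π₁ n) (π₂ n)) (unpair-pair m (pair i j)))
         (trans (cong (λ (i , j) → excluded (q₀ ↾ m) c i j) (unpair-pair i j))
         (excluded⇐ (q₀ ↾ m) c i j
           (trans (cong (λ w → at? (chain (q₀ ↾ m) w i) (suc (j + j))) normal≡) (trans (atM m (m≤m⊔n M N)) (cong suc eq)))
           (subst (λ u → w ⊑ columnW u i) (sym normal≡) (⊏-⊑ w⊏ (columnW-⊏ {x ↾ m} i (↾-⊏ x m)) (longN m (m≤n⊔m M N))))))) ,
         subst (_⊏ x) (sym normal≡) (↾-⊏ x m))

    -- Column `i` is a correct answer at a reachable point, and the domain condition of the loop
    -- makes the program defined on every such answer.
    continue : ∀ {z₀} → graph (loop F) q₀ z₀ → ∀ {i q} → Run q₀ x i q → Stage R q₀ i q →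
               ∃ λ z → graph R q z × Run q₀ x (suc i) z
    continue (safe , _) {i} {q} run st =
      let total = total⇒ F {q} (safe i q st)
          z , adv = total (column x i) (column∈ run)
      in z , step⇐ F {q} total (column∈ run) adv , continue-run run adv

    follow : ∀ {z₀} → graph (loop F) q₀ z₀ → ∀ i → ∃ λ q → Run q₀ x i q × Stage R q₀ i q
    follow l zero    = q₀ , begin-run (λ _ → refl) , start (λ _ → refl)
    follow l (suc i) = let q , run , st = follow l i
                           z , Rqz , run′ = continue l run st in z , run′ , step st Rqz

  loop≤ : C X ^∞ ≤W C X
  loop≤ = reduction {f = C X ^∞} {g = C X} {λ v → (λ n → runsBelow n v) ↾ length v} {λ v → loopOutput (evens v) (odds v)}
    (tabulateᵣ (lengthᵣ v₀) runsBelowᵣ) (loopOutputᵣ (evensᵣ v₀) (oddsᵣ v₀))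
    λ q₀ (z₀ , nz₀) →
      let l = named⇒ {f = C X ^∞} nz₀
          x , vx , ¬ex = runs-inhabited l
          pt , δx = valid⇒name vx
      in runs q₀ , local-sup {runsBelow} (λ {n} {m} → runs-local {q₀} {n} {m}) , (pt , named-choice⇐ {X} λ e → ¬ex (Equivalence.to (excludes⇔ δx) e)) ,
         λ t y ny δt →
           let vt = name⇒valid δt
               ¬et = λ e → named-choice⇒ {X} ny (Equivalence.from (excludes⇔ δt) e)
               qs = λ i → proj₁ (follow vt ¬et l i)
               at = ↾-approximates ⟨ q₀ , t ⟩
           in ⟪ qs ⟫ , ⟪ qs ⟫ ,
              approximates⇒sup (λ v → loopOutput (evens v) (odds v)) ⟨ q₀ , t ⟩
                (loopOutput-approximates (approximates-resp (ev-⟨⟩ q₀ t) (evens-approximates at))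
                  (approximates-resp (od-⟨⟩ q₀ t) (odds-approximates at)) (λ i → proj₁ (proj₂ (follow vt ¬et l i)))) ,
              (λ _ → refl) ,
              named⇐ {f = C X ^∞} (proj₁ l , qs , (λ _ → refl) ,
                (λ i → let q , run , st = follow vt ¬et l i in proj₁ (proj₂ (continue vt ¬et l run st))) , λ _ → refl)

-- Baire space and Cantor space as instances

Baire : SequenceSpace ℕ^ℕ
Baire = record
  { norm = id ; norm-0 = refl ; norm-1 = refl ; normᵣ = id
  ; name⇒valid = λ _ _ → refl
  ; valid⇒name = λ {r} _ → r , λ _ → refl
  ; base⇔ = λ k eq → mk⇔
      (λ b → subst (_⊏ _) (sym (map-id (decode k))) (⊏-resp {w = decode k} (λ n → sym (eq n)) b))
      (λ b → ⊏-resp {w = decode k} eq (subst (_⊏ _) (map-id (decode k)) b))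
  }

Cantor : SequenceSpace 2^ℕ
Cantor = record
  { norm = bit ∘ nonzero ; norm-0 = refl ; norm-1 = refl
  ; normᵣ = λ {_} {n} rn → ext (λ γ → norm-case (n γ)) (caseᵣ rn zeroᵣ (sucᵣ zeroᵣ))
  ; name⇒valid = λ {r} {x} eq n → trans (cong (bit ∘ nonzero) (eq n)) (trans (cong bit (nonzero-bit (x n))) (sym (eq n)))
  ; valid⇒name = λ {r} v → nonzero ∘ r , λ n → sym (v n)
  ; base⇔ = λ {r} {x} k eq → mk⇔ (to eq (decode k)) (from eq (decode k))
  }
  where
  norm-case : ∀ n → caseℕ n 0 (λ _ → 1) ≡ bit (nonzero n)
  norm-case zero    = refl
  norm-case (suc n) = refl

  nonzero-bit : ∀ b → nonzero (bit b) ≡ b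
  nonzero-bit false = refl
  nonzero-bit true  = refl

  to : ∀ {r x} → r ≗ bit ∘ x → ∀ w → map nonzero w ⊏ x → map (bit ∘ nonzero) w ⊏ r
  to eq []      _ = refl
  to eq (n ∷ w) b = cong₂ _∷_ (trans (cong bit (∷-injectiveˡ b)) (sym (eq 0))) (to (eq ∘ suc) w (∷-injectiveʳ b))

  from : ∀ {r x} → r ≗ bit ∘ x → ∀ w → map (bit ∘ nonzero) w ⊏ r → map nonzero w ⊏ x
  from eq []      _ = refl
  from eq (n ∷ w) b = cong₂ _∷_ (bit-injective (trans (∷-injectiveˡ b) (eq 0))) (from (eq ∘ suc) w (∷-injectiveʳ b))

-- Closed choice on the natural numbers

member : Word → ℕ → ℕ
member u n = iter 0 (λ j b → caseℕ (distance (at? u j) (suc n)) 1 λ _ → b) (length u)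

memberᵣ : ∀ {u n} → Recursive {Γ} {word} u → Recursive {Γ} {nat} n → Recursive {Γ} {nat} λ γ → member (u γ) (n γ)
memberᵣ ru rn = iterᵣ (lengthᵣ ru) zeroᵣ (caseᵣ (distanceᵣ (at?ᵣ (wk (wk ru)) v₀) (sucᵣ (wk (wk rn)))) (sucᵣ zeroᵣ) v₂)

caseℕ-distance-≢ : ∀ {A : Set} {m n} {y z : A} → ¬ (m ≡ n) → caseℕ (distance m n) y (λ _ → z) ≡ z
caseℕ-distance-≢ {m = m} {n} m≢n with distance m n in eq
... | zero  = contradiction (distance≡0⇒≡ eq) m≢n
... | suc _ = refl

caseℕ-distance-≡ : ∀ {A : Set} {m n} {y z : A} → m ≡ n → caseℕ (distance m n) y (λ _ → z) ≡ y
caseℕ-distance-≡ {m = m} refl rewrite n∸n≡0 m = refl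

member≡0 : ∀ u n → (∀ i → ¬ (at? u i ≡ suc n)) → member u n ≡ 0
member≡0 u n ∉u = go (length u)
  where
  go : ∀ l → iter 0 (λ j b → caseℕ (distance (at? u j) (suc n)) 1 λ _ → b) l ≡ 0
  go zero    = refl
  go (suc l) = trans (caseℕ-distance-≢ (∉u l)) (go l)

member≡suc : ∀ u n {i} → at? u i ≡ suc n → member u n ≡ 1
member≡suc u n {i} eq = go (length u) (at?⇒< u eq)
  where
  go : ∀ l → i < l → iter 0 (λ j b → caseℕ (distance (at? u j) (suc n)) 1 λ _ → b) l ≡ 1
  go (suc l) i<1+l with m≤n⇒m<n∨m≡n (s≤s⁻¹ i<1+l)
  ... | inj₂ refl = caseℕ-distance-≡ eq
  ... | inj₁ i<l rewrite go l i<l with distance (at? u l) (suc n)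
  ...   | zero  = refl
  ...   | suc _ = refl

-- Entry `suc n` is the one that excludes `n`. The search makes at most `length u` moves, which
-- suffices in the limit: the word grows while the least missing number stays fixed.
least : Word → ℕ
least u = iter 0 (λ _ n → caseℕ (member u (suc n)) n λ _ → suc n) (length u)

leastᵣ : ∀ {u} → Recursive {Γ} {word} u → Recursive {Γ} {nat} λ γ → least (u γ)
leastᵣ ru = iterᵣ (lengthᵣ ru) zeroᵣ (caseᵣ (memberᵣ (wk (wk ru)) (sucᵣ v₁)) v₁ (sucᵣ v₂))

least-value : ∀ u n → n ≤ length u → (∀ i → ¬ (at? u i ≡ suc (suc n))) →
              (∀ {k} → k < n → ∃ λ i → at? u i ≡ suc (suc k)) → least u ≡ n
least-value u n n≤u ∉u ∈u = trans (go (length u)) (m≥n⇒m⊓n≡n n≤u)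
  where
  go : ∀ l → iter 0 (λ _ n → caseℕ (member u (suc n)) n λ _ → suc n) l ≡ l ⊓ n
  go zero = refl
  go (suc l) rewrite go l with l <? n
  ... | yes l<n rewrite m≤n⇒m⊓n≡m (<⇒≤ l<n) | member≡suc u (suc l) (proj₂ (∈u l<n)) = sym (m≤n⇒m⊓n≡m l<n)
  ... | no  l≮n rewrite m≥n⇒m⊓n≡n (≮⇒≥ l≮n) | member≡0 u (suc n) ∉u = sym (m≥n⇒m⊓n≡n (m≤n⇒m≤1+n (≮⇒≥ l≮n)))

infix 4 _∈ₑ_

_∈ₑ_ : ℕ → Seq → Set
n ∈ₑ p = ∃ λ i → p i ≡ suc n

Least : Seq → ℕ → Set
Least p n = ¬ (n ∈ₑ p) × (∀ {k} → k < n → k ∈ₑ p)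

enumerated⇔ : ∀ {p n} → Negative.Enumerated ℕᴿ p n ⇔ n ∈ₑ p
enumerated⇔ = mk⇔ (λ { (i , k , eq , refl) → i , eq }) (λ (i , eq) → i , _ , eq , refl)

least-exists : ExcludedMiddle 0ℓ → ∀ {p n} → ¬ (n ∈ₑ p) → ∃ (Least p)
least-exists em {p} {n} n∉ = case go (suc n) of λ where
    (inj₁ l) → l
    (inj₂ below) → contradiction (below (n<1+n n)) n∉
  where
  go : ∀ N → ∃ (Least p) ⊎ (∀ {k} → k < N → k ∈ₑ p)
  go zero = inj₂ λ ()
  go (suc N) with go N | em {N ∈ₑ p}
  ... | inj₁ l     | _       = inj₁ l
  ... | inj₂ below | no N∉   = inj₁ (N , N∉ , below)
  ... | inj₂ below | yes N∈  = inj₂ λ k<1+N → case m≤n⇒m<n∨m≡n (s≤s⁻¹ k<1+N) of λ where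
    (inj₁ k<N)  → below k<N
    (inj₂ refl) → N∈

least-limit : ∀ {M W p n} → Approximates M W p → Least p n → ∃ λ N → ∀ m → N ≤ m → least (W m) ≡ n
least-limit {M} {W} {p} {n} ap (n∉ , below∈) =
  let N₁ , l = long ap n
      N₂ , ev∈ = eventually-all {λ k m → ∃ λ i → at? (W m) i ≡ suc (suc k)} n λ k<n →
        let i , eq = below∈ k<n
            N , at = complete (reads-at ap i)
        in N , λ m N≤m → i , trans (at m N≤m) (cong suc eq)
  in M ⊔ (N₁ ⊔ N₂) , λ m le →
     let M≤m = m⊔n≤o⇒m≤o M (N₁ ⊔ N₂) le
         N≤m = m⊔n≤o⇒n≤o M (N₁ ⊔ N₂) le
     in least-value (W m) n (l m (m⊔n≤o⇒m≤o N₁ N₂ N≤m)) (λ i eq → n∉ (i , sym (⊏⇒at?≡ (below ap m M≤m) eq)))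
          (ev∈ m (m⊔n≤o⇒n≤o N₁ N₂ N≤m))

lim-unique : ∀ {p r s} → graph (fun lim) p r → graph (fun lim) p s → r ≗ s
lim-unique lr ls n =
  let M , eqr = lim⇒ lr n
      N , eqs = lim⇒ ls n
  in trans (sym (eqr (M ⊔ N) (m≤m⊔n M N))) (eqs (M ⊔ N) (m≤n⊔m M N))

-- Choice on the numbers and its loop are below the limit map

Fℕ : MultiFun baire baire _
Fℕ = realizerVersion (C ℕᴿ)

Fℕ⇒ : ∀ {p r} → graph Fℕ p r → ¬ (r 0 ∈ₑ p)
Fℕ⇒ (_ , x , np , refl) e = named-choice⇒ {ℕᴿ} np (Equivalence.from enumerated⇔ e)

Fℕ⇐ : ∀ {p r} → ¬ (r 0 ∈ₑ p) → graph Fℕ p r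
Fℕ⇐ {r = r} ¬e = realizerVersion⇐ {f = C ℕᴿ} {r = r} (named-choice⇐ {ℕᴿ} λ e → ¬e (Equivalence.to enumerated⇔ e)) refl

C-ℕ≤lim : ExcludedMiddle 0ℓ → C ℕᴿ ≤W lim
C-ℕ≤lim em = reduction {f = C ℕᴿ} {g = lim} {λ v → (λ n → below-stage n v) ↾ length v} {odds}
  (tabulateᵣ (lengthᵣ v₀) (leastᵣ (tabulateᵣ (π₁ᵣ v₀) (nthᵣ v₂ v₀)))) (oddsᵣ v₀)
  λ p (x , np) →
    let n , least-n = least-exists em {p} {x} (λ e → named-choice⇒ {ℕᴿ} np (Equivalence.from enumerated⇔ e))
        guesses : Seq
        guesses i = least (p ↾ π₁ i)
        guesses→n : graph (fun lim) guesses (λ _ → n)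
        guesses→n = lim⇐ λ j → let N , eq = least-limit (↾-approximates p) least-n in
          N , λ i N≤i → trans (cong (λ s → least (p ↾ s)) (π₁-pair i j)) (eq i N≤i)
    in guesses , local-sup {below-stage} {p} {guesses}
         (λ {i} i<m → cong least (↾-cong-< (π₁ i) λ j< → nth-↾ p (<-trans j< (≤-<-trans (π₁≤ i) i<m)))) ,
       ((λ _ → n) , named⇐ {f = lim} guesses→n) ,
       λ t y ny t≗y → t , n ,
         approximates⇒sup odds ⟨ p , t ⟩ (approximates-resp (od-⟨⟩ p t) (odds-approximates (↾-approximates ⟨ p , t ⟩))) ,
         trans (t≗y 0) (lim-unique (named⇒ {f = lim} ny) guesses→n 0) ,
         named-choice⇐ {ℕᴿ} (λ e → proj₁ least-n (Equivalence.to enumerated⇔ e))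
  where
  below-stage : ℕ → Word → ℕ
  below-stage n v = least (nth v ↾ π₁ n)

-- The guess for round i stabilises once those for the earlier rounds have.
guess : Word → ℕ → Word
guess v = iter v λ _ u → evaluate u ((λ _ → least (odds u)) ↾ length v)

guessᵣ : ∀ {v i} → Recursive {Γ} {word} v → Recursive {Γ} {nat} i → Recursive {Γ} {word} λ γ → guess (v γ) (i γ)
guessᵣ rv ri = iterᵣ ri rv (evaluateᵣ v₁ (tabulateᵣ (lengthᵣ (wk (wk rv))) (leastᵣ (oddsᵣ v₂))))

module _ (em : ExcludedMiddle 0ℓ) {q₀ z₀ : Seq} (l : graph (loop Fℕ) q₀ z₀) where

  private
    R = loopStep Fℕ

  Round : ℕ → Seq → Set _
  Round i q = Stage R q₀ i q × ∃ λ M → Approximates M (λ m → guess (q₀ ↾ m) i) q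

  choose : ∀ {i q} → Stage R q₀ i q → ∃ (Least (od q))
  choose {i} {q} st = let r , Fr , _ = step⇒ Fℕ {q} (proj₂ (proj₁ l i q st)) in least-exists em (Fℕ⇒ {r = r} Fr)

  advance-round : ∀ {i q} → (round : Round i q) → ∃ λ z →
                  IsSup (approx (ev q)) (λ _ → proj₁ (choose (proj₁ round))) z × graph R q z × Round (suc i) z
  advance-round {i} {q} (st , M , ap) =
    let n , least-n = choose st
        total = total⇒ Fℕ {q} (proj₁ l i q st)
        Fn = Fℕ⇐ {od q} {λ _ → n} (proj₁ least-n)
        z , adv = total (λ _ → n) Fn
        N , eq = least-limit (odds-approximates ap) least-n
        Rqz = step⇐ Fℕ {q} total Fn adv
        constant : Approximates N (λ m → (λ _ → least (odds (guess (q₀ ↾ m) i))) ↾ length (q₀ ↾ m)) (λ _ → n)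
        constant = approximates-cong
          (λ m N≤m → trans (↾-cong (λ _ → sym (eq m N≤m)) m) (cong ((λ _ → least (odds (guess (q₀ ↾ m) i))) ↾_) (sym (length-applyUpTo q₀ m))))
          (≤-approximates z≤n (↾-approximates λ _ → n))
    in z , adv , Rqz , step st Rqz , M ⊔ N ,
       evaluate-approximates (≤-approximates (m≤m⊔n M N) ap) (≤-approximates (m≤n⊔m M N) constant) adv

  rounds : ∀ i → ∃ (Round i)
  rounds zero    = q₀ , start (λ _ → refl) , 0 , ↾-approximates q₀
  rounds (suc i) = let z , _ , _ , round = advance-round (proj₂ (rounds i)) in z , round

  choices : Seq
  choices i = proj₁ (choose (proj₁ (proj₂ (rounds i))))

  choices-run : ∀ {x} → (∀ i → column x i ≗ λ _ → choices i) → ∀ i → Run q₀ x i (proj₁ (rounds i))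
  choices-run eq zero    = begin-run λ _ → refl
  choices-run eq (suc i) = let q , round = rounds i in continue-run (choices-run eq i)
    (advance-resp Fℕ {q} {q} (λ _ → refl) (λ j → sym (eq i j)) (λ _ → refl) (proj₁ (proj₂ (advance-round round))))

  choices-loop : graph (loop Fℕ) q₀ ⟪ (λ i → proj₁ (rounds i)) ⟫
  choices-loop = proj₁ l , (λ i → proj₁ (rounds i)) , (λ _ → refl) ,
    (λ i → proj₁ (proj₂ (proj₂ (advance-round (proj₂ (rounds i)))))) , λ _ → refl

  choices-limit : graph (fun lim) (λ n → least (odds (guess (q₀ ↾ π₁ n) (π₂ n)))) choices
  choices-limit = lim⇐ λ i →
    let q , st , M , ap = rounds i
        N , eq = least-limit (odds-approximates ap) (proj₂ (choose st))
    in N , λ m N≤m → trans (cong (λ (m , i) → least (odds (guess (q₀ ↾ m) i))) (unpair-pair m i)) (eq m N≤m)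

-- The limit yields one number per round. `columns` repeats number `i` along column `i`, making it a
-- name of the answer to round `i`, and the loop is replayed.
C-ℕ^∞≤lim : ExcludedMiddle 0ℓ → C ℕᴿ ^∞ ≤W lim
C-ℕ^∞≤lim em = reduction {f = C ℕᴿ ^∞} {g = lim} {λ v → (λ n → guesses n v) ↾ length v} {λ v → loopOutput (evens v) (columns (odds v))}
  (tabulateᵣ (lengthᵣ v₀) (leastᵣ (oddsᵣ (guessᵣ (tabulateᵣ (π₁ᵣ v₀) (nthᵣ v₂ v₀)) (π₂ᵣ v₀)))))
  (loopOutputᵣ (evensᵣ v₀) (collectᵣ (lengthᵣ (oddsᵣ v₀)) (at?ᵣ (oddsᵣ v₁) (π₁ᵣ v₀))))
  λ q₀ (z₀ , nz₀) →
    let l = named⇒ {f = C ℕᴿ ^∞} nz₀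
        k : Seq
        k n = least (odds (guess (q₀ ↾ π₁ n) (π₂ n)))
    in k , local-sup {guesses} {q₀} {k}
         (λ {n} n<m → cong (λ v → least (odds (guess v (π₂ n)))) (↾-cong-< (π₁ n) λ i< →
           nth-↾ q₀ (<-trans i< (≤-<-trans (π₁≤ n) n<m)))) ,
       (choices em l , named⇐ {f = lim} (choices-limit em l)) ,
       λ t y ny t≗y →
         let t≗ : t ≗ choices em l
             t≗ n = trans (t≗y n) (lim-unique (named⇒ {f = lim} ny) (choices-limit em l) n)
             at = ↾-approximates ⟨ q₀ , t ⟩
             aod = approximates-resp (od-⟨⟩ q₀ t) (odds-approximates at)
             acol : Approximates 0 (λ m → columns (odds (⟨ q₀ , t ⟩ ↾ m))) (λ n → t (π₁ n))
             acol = collect-approximates (λ m → length (odds (⟨ q₀ , t ⟩ ↾ m))) (long aod) λ n → reads-at aod (π₁ n)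
         in _ , _ ,
            approximates⇒sup (λ v → loopOutput (evens v) (columns (odds v))) ⟨ q₀ , t ⟩
              (loopOutput-approximates (approximates-resp (ev-⟨⟩ q₀ t) (evens-approximates at)) acol
                (choices-run em l λ i j → trans (cong t (π₁-pair i j)) (t≗ i))) ,
            (λ _ → refl) , named⇐ {f = C ℕᴿ ^∞} (choices-loop em l)
  where
  guesses : ℕ → Word → ℕ
  guesses n v = least (odds (guess (nth v ↾ π₁ n) (π₂ n)))

  columns : Word → Word
  columns w = collect (length w) λ n → at? w (π₁ n)

-- The limit map reduces to the infinite loop of choice on the natural numbers

-- Entry number pair y j + 1 of a name of the set of all y = pair m t for which
-- column t of p is constant from row m on; here a and b are p y and p j.
unstable : ℕ → ℕ → ℕ → ℕ → ℕ → ℕ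
unstable t y j a b =
  caseℕ (distance (π₂ y) t)
    (caseℕ (distance (π₂ j) t + (π₁ y ∸ π₁ j)) (caseℕ (distance b a) 0 λ _ → suc y) λ _ → 0)
    λ _ → suc y

-- The number that entry 0 excludes serves to transmit the preceding choice.
stableName : Seq → ℕ → ℕ → Seq
stableName p t e n = caseℕ n e λ k → unstable t (π₁ k) (π₂ k) (p (π₁ k)) (p (π₂ k))

stableNameᵣ : ∀ {u t e n} → Recursive {Γ} {word} u → Recursive {Γ} {nat} t → Recursive {Γ} {nat} e →
              Recursive {Γ} {nat} n → Recursive {Γ} {nat} λ γ → stableName (nth (u γ)) (t γ) (e γ) (n γ)
stableNameᵣ ru rt re rn = caseᵣ rn re (caseᵣ (distanceᵣ (π₂ᵣ y) (wk rt))
  (caseᵣ (distanceᵣ (π₂ᵣ j) (wk rt) +ᵣ (π₁ᵣ y ∸ᵣ π₁ᵣ j))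
    (caseᵣ (distanceᵣ (nthᵣ (wk ru) j) (nthᵣ (wk ru) y)) zeroᵣ (sucᵣ (wk y))) zeroᵣ)
  (sucᵣ (wk y)))
  where
  y = π₁ᵣ v₀
  j = π₂ᵣ v₀

stableName-local : ∀ {p t e n m} → n < m → stableName (nth (p ↾ m)) t e n ≡ stableName p t e n
stableName-local {n = zero}  _ = refl
stableName-local {p} {t} {n = suc k} {m} k<m = cong₂ (unstable t (π₁ k) (π₂ k)) (read (π₁≤ k)) (read (π₂≤ k))
  where
  read : ∀ {i} → i ≤ k → nth (p ↾ m) i ≡ p i
  read i≤k = nth-↾ p (<-trans (s≤s i≤k) k<m)

stableName-pair : ∀ p t e y j → stableName p t e (suc (pair y j)) ≡ unstable t y j (p y) (p j)
stableName-pair p t e y j = cong (λ (y , j) → unstable t y j (p y) (p j)) (unpair-pair y j)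

unstable-≢ : ∀ {t y} j a b → ¬ (π₂ y ≡ t) → unstable t y j a b ≡ suc y
unstable-≢ j a b ≢t = caseℕ-distance-≢ ≢t

unstable⇒ : ∀ {t y j a b n} → unstable t y j a b ≡ suc n → n ≡ y × (π₂ y ≡ t → π₂ j ≡ t × π₁ y ≤ π₁ j × ¬ (b ≡ a))
unstable⇒ {t} {y} {j} {a} {b} eq with distance (π₂ y) t in e₁
unstable⇒ {t} {y} {j} {a} {b} eq | zero with distance (π₂ j) t + (π₁ y ∸ π₁ j) in e₂
unstable⇒ {t} {y} {j} {a} {b} eq | zero | zero with distance b a in e₃
unstable⇒ {t} {y} {j} {a} {b} refl | zero | zero | suc _ = refl , λ _ →
  distance≡0⇒≡ (m+n≡0⇒m≡0 (distance (π₂ j) t) e₂) ,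
  m∸n≡0⇒m≤n (m+n≡0⇒n≡0 (distance (π₂ j) t) e₂) ,
  λ b≡a → case trans (sym e₃) (≡⇒distance≡0 b≡a) of λ ()
unstable⇒ refl | suc _ = refl , λ y≡t → case trans (sym e₁) (≡⇒distance≡0 y≡t) of λ ()

unstable⇐ : ∀ {t y j a b} → π₂ y ≡ t → π₂ j ≡ t → π₁ y ≤ π₁ j → ¬ (b ≡ a) → unstable t y j a b ≡ suc y
unstable⇐ {t} {y} {j} {a} {b} y≡t j≡t y≤j b≢a
  rewrite ≡⇒distance≡0 y≡t | ≡⇒distance≡0 j≡t | m≤n⇒m∸n≡0 y≤j = caseℕ-distance-≢ b≢a

module StableNames {p r : Seq} (conv : graph (fun lim) p r) where

  -- A row past the modulus of convergence at `t` is never refuted, and entry 0 excludes at most a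
  -- number belonging to another index.
  stable-exists : ∀ t {e} → (∀ {x} → e ≡ suc x → ¬ (π₂ x ≡ t)) → ∃ λ y → ¬ (y ∈ₑ stableName p t e)
  stable-exists t {e} e≢ = y , λ where
      (zero  , eq) → e≢ eq (π₂-pair m t)
      (suc k , eq) →
        let y≡ , why = unstable⇒ {t} {π₁ k} {π₂ k} eq
            j≡t , y≤j , ≢ = why (trans (cong π₂ (sym y≡)) (π₂-pair m t))
        in ≢ (trans (value (π₂ k) j≡t (subst (_≤ π₁ (π₂ k)) (trans (cong π₁ (sym y≡)) (π₁-pair m t)) y≤j))
                    (sym (value (π₁ k) (trans (cong π₂ (sym y≡)) (π₂-pair m t))
                      (≤-reflexive (trans (sym (π₁-pair m t)) (cong π₁ y≡))))))
    where
    m = proj₁ (lim⇒ conv t)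
    y = pair m t
    value : ∀ j → π₂ j ≡ t → m ≤ π₁ j → p j ≡ r t
    value j j≡t m≤ = trans (cong p (trans (sym (pair-π j)) (cong (pair (π₁ j)) j≡t))) (proj₂ (lim⇒ conv t) (π₁ j) m≤)

  stable-index : ∀ {t e y} → ¬ (y ∈ₑ stableName p t e) → π₂ y ≡ t
  stable-index {t} {e} {y} y∉ with π₂ y ≟ t
  ... | yes eq = eq
  ... | no  ≢t = contradiction (suc (pair y 0) , trans (stableName-pair p t e y 0) (unstable-≢ 0 (p y) (p 0) ≢t)) y∉

  stable-value : ∀ {t e y} → ¬ (y ∈ₑ stableName p t e) → p y ≡ r t
  stable-value {t} {e} {y} y∉ with p j ≟ p y
    where
    j = pair (proj₁ (lim⇒ conv t) ⊔ π₁ y) t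
  ... | yes eq = trans (sym eq) (proj₂ (lim⇒ conv t) _ (m≤m⊔n _ (π₁ y)))
  ... | no  ≢ = contradiction (suc (pair y j) , trans (stableName-pair p t e y j)
                  (unstable⇐ {j = j} (stable-index y∉) (π₂-pair i t) (subst (π₁ y ≤_) (sym (π₁-pair i t)) (m≤n⊔m (proj₁ (lim⇒ conv t)) (π₁ y))) ≢)) y∉
    where
    i = proj₁ (lim⇒ conv t) ⊔ π₁ y
    -- Index `t` in a row beyond both the modulus of convergence and the row of `y`: there `p` has
    -- its limit value, so a different `p y` would be refuted by `j`.
    j = pair i t

private
  -- An answer `y` to round `t` satisfies `π₂ y ≡ t`, so the next index is read off the answer and
  -- no round counter is kept. Excluding `y` is harmless afterwards, since in round `suc t` it has
  -- the wrong index.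
  nextName : Seq → Seq → Seq
  nextName p s = stableName p (suc (π₂ (s 0))) (suc (s 0))

  module Stable = Quine (λ i u v → stableName (nth u) (suc (π₂ (nth v 0))) (suc (nth v 0)) i) nextName
    (stableNameᵣ v₁ (sucᵣ (π₂ᵣ (nthᵣ v₂ zeroᵣ))) (sucᵣ (nthᵣ v₂ zeroᵣ)) v₀)
    (λ {p} {s} {i} {m} {n} i<m i<n → trans (cong (λ x → stableName (nth (p ↾ m)) (suc (π₂ x)) (suc x) i) (nth-↾ s (≤-<-trans z≤n i<n)))
                                           (stableName-local {p} {suc (π₂ (s 0))} {suc (s 0)} {i} i<m))

  module StableStart = Stable.Initial (λ i u → stableName (nth u) 0 0 i) (λ p → stableName p 0 0) (stableNameᵣ v₁ zeroᵣ zeroᵣ v₀)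
    (λ {p} {i} {m} → stableName-local {p} {0} {0} {i} {m})

  -- Entry 0 of the instance of round `suc t`, found at index 1 of that point, is the successor of
  -- the choice `y` of round `t`. `limitW` then looks up `p y`, which lies at position `y + y` of
  -- `⟨ p , z ⟩` and is the limit at `t`.
  choice-position : ℕ → ℕ
  choice-position t = suc (k + k)
    where k = pair (suc t) 1

  limitW : Word → Word
  limitW v = collect (length v) λ t → caseℕ (at? v (choice-position t)) 0 λ n → at? v (pred n + pred n)

  limitWᵣ : Recursive {word ∷ []} {word} λ (v , _) → limitW v
  limitWᵣ = collectᵣ (lengthᵣ v₀) (caseᵣ (at?ᵣ v₁ (sucᵣ (k +ᵣ k))) zeroᵣ (at?ᵣ v₂ (predᵣ v₀ +ᵣ predᵣ v₀)))
    where
    k : ∀ {Γ} → Recursive {nat ∷ Γ} {nat} λ (t , _) → pair (suc t) 1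
    k = pairᵣ (sucᵣ v₀) (sucᵣ zeroᵣ)

lim≤C-ℕ^∞ : lim ≤W C ℕᴿ ^∞
lim≤C-ℕ^∞ = reduction {f = lim} {g = C ℕᴿ ^∞} {StableStart.initial} {limitW} StableStart.initialᵣ limitWᵣ λ p (r , nr) →
  let conv = named⇒ {f = lim} nr
      q₀ = ⟨ Stable.program p , stableName p 0 0 ⟩
      z , lz = loop-intro Fℕ (Invariant p) (λ {i} {q} {q′} → invariant-resp p i {q} {q′}) (λ {i} {q} → progress conv i {q}) {q₀}
                 (ev-⟨⟩ (Stable.program p) _ , 0 , od-⟨⟩ (Stable.program p) _ , λ ())
  in q₀ , StableStart.initial-sup p , (z , named⇐ {f = C ℕᴿ ^∞} lz) , λ t y ny t≗y →
     let qs , qs₀ , y≗ , run = loop⇒ {f = Fℕ} {q₀} {y} (named⇒ {f = C ℕᴿ ^∞} ny)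
         invariant : ∀ i → Invariant p i (qs i)
         invariant = iterate {qs = qs} conv qs₀ run
         at = ↾-approximates ⟨ p , t ⟩
     in r , r ,
        approximates⇒sup limitW ⟨ p , t ⟩ (collect-approximates (length ∘ (⟨ p , t ⟩ ↾_)) (long at) λ i →
          let s , Fs , adv = run i
              evq , e , odq , e≢ = invariant i
              y∉ = λ (n , eq) → Fℕ⇒ {r = s} Fs (n , trans (odq n) eq)
              chosen : ⟨ p , t ⟩ (choice-position i) ≡ suc (s 0)
              chosen = trans (od-⟨⟩ p t (pair (suc i) 1)) (trans (t≗y (pair (suc i) 1)) (trans (y≗ (pair (suc i) 1))
                (trans (cong (λ (i , j) → qs i j) (unpair-pair (suc i) 1)) (Stable.program-unique {p} {qs i} {s} evq adv 1))))
          in reads-case (reads-at at (choice-position i))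
               (reads-resp (λ m → cong (λ n → at? (⟨ p , t ⟩ ↾ m) (pred n + pred n)) (sym chosen))
                  (trans (ev-⟨⟩ p t (s 0)) (StableNames.stable-value conv y∉))
                  (reads-at at (s 0 + s 0)))) ,
        (λ _ → refl) , named⇐ {f = lim} conv
  where
  Invariant : Seq → ℕ → Seq → Set
  Invariant p i q = ev q ≗ Stable.program p × ∃ λ e → od q ≗ stableName p i e × (∀ {x} → e ≡ suc x → ¬ (π₂ x ≡ i))

  invariant-resp : ∀ p i {q q′} → q ≗ q′ → Invariant p i q → Invariant p i q′
  invariant-resp p i eq (evq , e , odq , e≢) =
    (λ n → trans (sym (eq (n + n))) (evq n)) , e , (λ n → trans (sym (eq (suc (n + n)))) (odq n)) , e≢

  successor : ∀ {p r} → graph (fun lim) p r → ∀ i {q} → Invariant p i q → ∀ s → graph Fℕ (od q) s →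
              Invariant p (suc i) ⟨ Stable.program p , nextName p s ⟩
  successor {p} conv i (evq , e , odq , e≢) s Fs =
    let i≡ = StableNames.stable-index conv λ (n , eq) → Fℕ⇒ {r = s} Fs (n , trans (odq n) eq)
    in ev-⟨⟩ (Stable.program p) (nextName p s) , suc (s 0) ,
       (λ n → trans (od-⟨⟩ (Stable.program p) (nextName p s) n) (cong (λ t → stableName p (suc t) (suc (s 0)) n) i≡)) ,
       λ { refl eq → case trans (sym eq) i≡ of λ () }

  progress : ∀ {p r} → graph (fun lim) p r → ∀ i {q} → Invariant p i q →
             ∃ (graph Fℕ (od q)) × (∀ s → graph Fℕ (od q) s → ∃ λ z → Advance Fℕ q s z × Invariant p (suc i) z)
  progress {p} conv i {q} inv@(evq , e , odq , e≢) =
    (let y , y∉ = StableNames.stable-exists conv i e≢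
     in (λ _ → y) , Fℕ⇐ {od q} {λ _ → y} λ (n , eq) → y∉ (n , trans (sym (odq n)) eq)) ,
    λ s Fs → ⟨ Stable.program p , nextName p s ⟩ , Stable.program-advance {p} {q} {s} evq , successor conv i {q} inv s Fs

  iterate : ∀ {p r qs} → graph (fun lim) p r → qs 0 ≗ ⟨ Stable.program p , stableName p 0 0 ⟩ →
            (∀ i → ∃ λ s → graph Fℕ (od (qs i)) s × Advance Fℕ (qs i) s (qs (suc i))) → ∀ i → Invariant p i (qs i)
  iterate {p} conv qs₀ run zero = (λ n → trans (qs₀ (n + n)) (ev-⟨⟩ (Stable.program p) _ n)) , 0 ,
    (λ n → trans (qs₀ (suc (n + n))) (od-⟨⟩ (Stable.program p) _ n)) , λ ()
  iterate {p} {qs = qs} conv qs₀ run (suc i) =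
    let s , Fs , adv = run i
        inv = iterate {qs = qs} conv qs₀ run i
    in invariant-resp p (suc i) (λ n → sym (Stable.program-unique {p} {qs i} {s} (proj₁ inv) adv n)) (successor conv i {qs i} inv s Fs)

-- Finite extension

Agree : ℕ → Seq → Seq → Set
Agree l x y = ∀ {i} → i < l → x i ≡ y i

-- Only the first `l` symbols of `x` count as fixed. Each requirement is met by fixing finitely many
-- more, and every sequence through the later condition inherits it; so the limit of the conditions
-- meets all of them.
module _ {P : ℕ → Seq → Set}
         (force : ∀ m x l → ∃₂ λ x′ l′ → Agree l x x′ × l < l′ × (∀ y → Agree l′ x′ y → P m y)) where

  private
    stage : ℕ → Seq × ℕ
    stage zero    = (λ _ → 0) , 0
    stage (suc m) = let x′ , l′ , _ = force m (proj₁ (stage m)) (proj₂ (stage m)) in x′ , l′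

    x : ℕ → Seq
    x m = proj₁ (stage m)

    l : ℕ → ℕ
    l m = proj₂ (stage m)

    agree-suc : ∀ m → Agree (l m) (x m) (x (suc m))
    agree-suc m = proj₁ (proj₂ (proj₂ (force m (x m) (l m))))

    l<l : ∀ m → l m < l (suc m)
    l<l m = proj₁ (proj₂ (proj₂ (proj₂ (force m (x m) (l m)))))

    m≤l : ∀ m → m ≤ l m
    m≤l zero    = z≤n
    m≤l (suc m) = ≤-<-trans (m≤l m) (l<l m)

    agree : ∀ m d → Agree (l m) (x m) (x (d + m)) × l m ≤ l (d + m)
    agree m zero    = (λ _ → refl) , ≤-refl
    agree m (suc d) = let eq , le = agree m d in
      (λ i<l → trans (eq i<l) (agree-suc (d + m) (<-≤-trans i<l le))) , ≤-trans le (<⇒≤ (l<l (d + m)))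

    agree-≤ : ∀ {m n} → m ≤ n → Agree (l m) (x m) (x n)
    agree-≤ {m} {n} m≤n = subst (λ n → Agree (l m) (x m) (x n)) (m∸n+n≡m m≤n) (proj₁ (agree m (n ∸ m)))

    -- Lengths grow strictly, so stage `suc i` has fixed more than `i` symbols.
    limit : Seq
    limit i = x (suc i) i

    agree-limit : ∀ m → Agree (l m) (x m) limit
    agree-limit m {i} i<l with ≤-total m (suc i)
    ... | inj₁ m≤i = agree-≤ m≤i i<l
    ... | inj₂ i<m = sym (agree-≤ i<m (m≤l (suc i)))

  generic : ∃ λ y → ∀ m → P m y
  generic = limit , λ m → proj₂ (proj₂ (proj₂ (proj₂ (force m (x m) (l m))))) limit (agree-limit (suc m))

splice : ℕ → Seq → Seq → Seq
splice l x y i with i <? l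
... | yes _ = x i
... | no  _ = y i

splice-< : ∀ l x y → Agree l x (splice l x y)
splice-< l x y {i} i<l with i <? l
... | yes _   = refl
... | no  i≮l = contradiction i<l i≮l

splice-≥ : ∀ l x y {i} → l ≤ i → splice l x y i ≡ y i
splice-≥ l x y {i} l≤i with i <? l
... | yes i<l = contradiction i<l (≤⇒≯ l≤i)
... | no  _   = refl

agree-↾ : ∀ {l x y} n → n ≤ l → Agree l x y → x ↾ n ≡ y ↾ n
agree-↾ n n≤l eq = ↾-cong-< n λ i<n → eq (<-≤-trans i<n n≤l)

module _ (em : ExcludedMiddle 0ℓ) where

  truth : Set → ℕ
  truth P = bit (does (em {P}))

  truth-yes : ∀ {P} → P → truth P ≡ 1
  truth-yes {P} p with em {P}
  ... | yes _  = refl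
  ... | no  ¬p = contradiction p ¬p

  truth-no : ∀ {P} → ¬ P → truth P ≡ 0
  truth-no {P} ¬p with em {P}
  ... | yes p = contradiction p ¬p
  ... | no  _ = refl

  truth-cong : ∀ {P Q} → (P → Q) → (Q → P) → truth P ≡ truth Q
  truth-cong {P} to from with em {P}
  ... | yes p  = sym (truth-yes (to p))
  ... | no  ¬p = sym (truth-no (¬p ∘ from))

  -- The limit map does not reduce to choice on the natural numbers

  -- A reduction has to cope with every realizer, in particular with the one that
  -- answers m whenever m is correct.
  prefer : ℕ → PartialFun baire baire 0ℓ
  prefer m = record
    { multi = record
      { graph = λ p r → ∃ λ n → (r ≗ λ _ → n) × ¬ (n ∈ₑ p) × (n ≡ m ⊎ (m ∈ₑ p × Least p n))
      ; respˡ = λ eq (n , r≗ , n∉ , w) → n , r≗ , n∉ ∘ resp (λ i → sym (eq i)) ,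
          (case w of λ where
            (inj₁ n≡m)            → inj₁ n≡m
            (inj₂ (m∈ , n∉ , <∈)) → inj₂ (resp eq m∈ , n∉ ∘ resp (λ i → sym (eq i)) , λ {k} lt → resp eq (<∈ {k} lt)))
      ; respʳ = λ eq (n , r≗ , w) → n , (λ i → trans (sym (eq i)) (r≗ i)) , w
      }
    ; single = λ (n , r≗ , n∉ , w) (n′ , s≗ , n′∉ , w′) i → trans (r≗ i) (trans (unique n∉ n′∉ w w′) (sym (s≗ i)))
    }
    where
    resp : ∀ {p q n} → p ≗ q → n ∈ₑ p → n ∈ₑ q
    resp eq (i , e) = i , trans (sym (eq i)) e

    unique : ∀ {p n n′} → ¬ (n ∈ₑ p) → ¬ (n′ ∈ₑ p) → n ≡ m ⊎ (m ∈ₑ p × Least p n) → n′ ≡ m ⊎ (m ∈ₑ p × Least p n′) → n ≡ n′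
    unique n∉ n′∉ (inj₁ refl)     (inj₁ refl)      = refl
    unique n∉ n′∉ (inj₁ refl)     (inj₂ (m∈ , _))  = contradiction m∈ n∉
    unique n∉ n′∉ (inj₂ (m∈ , _)) (inj₁ refl)      = contradiction m∈ n′∉
    unique {n = n} {n′} n∉ n′∉ (inj₂ (_ , _ , <∈)) (inj₂ (_ , _ , <∈′)) =
      ≤-antisym (≮⇒≥ λ lt → n′∉ (<∈ lt)) (≮⇒≥ λ lt → n∉ (<∈′ lt))

  prefer⊢ : ∀ m → prefer m ⊢ C ℕᴿ
  prefer⊢ m p (x , np) =
    let n , n∉ , w = answer
    in n , ∘ₚ-graph (δ (represented ℕᴿ)) (prefer m) (n , (λ _ → refl) , n∉ , w) refl ,
       named-choice⇐ {ℕᴿ} λ e → n∉ (Equivalence.to enumerated⇔ e)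
    where
    answer : ∃ λ n → ¬ (n ∈ₑ p) × (n ≡ m ⊎ (m ∈ₑ p × Least p n))
    answer with em {m ∈ₑ p}
    ... | no  m∉ = m , m∉ , inj₁ refl
    ... | yes m∈ = let n , least-n = least-exists em {p} {x} λ e → named-choice⇒ {ℕᴿ} np (Equivalence.from enumerated⇔ e)
                   in n , proj₁ least-n , inj₂ (m∈ , least-n)

  -- Row `s` shows what `x` has enumerated by stage `s`; the limit is the characteristic function of
  -- the enumerated set. The bound by `π₁ n` makes entry `n` depend only on symbols of `x` up to
  -- `n`.
  rangeStages : Seq → Seq
  rangeStages x n = truth (∃ λ i → i ≤ π₁ n × x i ≡ suc (π₂ n))

  rangeStages-limit : ∀ x → graph (fun lim) (rangeStages x) (λ j → truth (j ∈ₑ x))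
  rangeStages-limit x = lim⇐ λ j → case em {j ∈ₑ x} of λ where
    (yes (i , eq)) → i , λ s i≤s → trans (truth-yes (i , subst (i ≤_) (sym (π₁-pair s j)) i≤s , trans eq (cong suc (sym (π₂-pair s j)))))
                                         (sym (truth-yes (i , eq)))
    (no  j∉)       → 0 , λ s _ → trans (truth-no λ (i , _ , eq) → j∉ (i , trans eq (cong suc (π₂-pair s j)))) (sym (truth-no j∉))

  rangeStages-agree : ∀ {l x y} → Agree l x y → Agree l (rangeStages x) (rangeStages y)
  rangeStages-agree eq {n} n<l = truth-cong
    (λ (i , i≤ , e) → i , i≤ , trans (sym (eq (≤-<-trans (≤-trans i≤ (π₁≤ n)) n<l))) e)
    (λ (i , i≤ , e) → i , i≤ , trans (eq (≤-<-trans (≤-trans i≤ (π₁≤ n)) n<l)) e)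

  -- What a reduction gives when answered by `prefer m`: the answer is `m` itself unless the
  -- instance excludes `m`.
  module _ {η κ : Word → Word} (facts : ∀ x m → ∃ λ k → ∃₂ λ n h →
             IsSup κ (rangeStages x) k × ¬ (n ∈ₑ k) × (n ≡ m ⊎ m ∈ₑ k) ×
             IsSup η ⟨ rangeStages x , (λ _ → n) ⟩ h × (∀ j → h j ≡ truth (j ∈ₑ x))) where

    private
      Excluded : ℕ → Seq → Set
      Excluded m y = ∃₂ λ N i → at? (κ (rangeStages y ↾ N)) i ≡ suc (suc m)

      force : ∀ m x l → ∃₂ λ x′ l′ → Agree l x x′ × l < l′ × (∀ y → Agree l′ x′ y → Excluded m y)
      force m x l with em {∃₂ λ x′ N → Agree l x x′ × ∃ λ i → at? (κ (rangeStages x′ ↾ N)) i ≡ suc (suc m)}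
      ... | yes (x′ , N , eq , i , e) = x′ , suc (l ⊔ N) , eq , s≤s (m≤m⊔n l N) , λ y eq′ → N , i ,
              trans (cong (λ w → at? (κ w) i) (sym (agree-↾ N (m≤n⇒m≤1+n (m≤n⊔m l N)) (rangeStages-agree eq′)))) e
      -- If no extension gets `m` excluded, then `m` is a correct answer for all of them. With this
      -- constant answer `η` alone would compute the limit, from finitely many symbols of the
      -- instance.
      ... | no none = contradiction (trans (sym h₁j) (trans (sym h≡h₁) h₀j)) λ ()
        where
        correct : ∀ x′ → Agree l x x′ → ∃ λ h → IsSup η ⟨ rangeStages x′ , (λ _ → m) ⟩ h × (∀ j → h j ≡ truth (j ∈ₑ x′))
        correct x′ eq with facts x′ m
        ... | k , n , h , Kk , n∉ , inj₁ refl , Hh , h≡ = h , Hh , h≡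
        ... | k , n , h , Kk , n∉ , inj₂ (i , e) , Hh , h≡ =
          let N , i< = proj₂ Kk (suc i)
          in contradiction (x′ , N , (λ {i} → eq {i}) , i , trans (⊏⇒at? (proj₁ Kk N) i<) (cong suc e)) none

        -- The sum bounds every symbol fixed so far, so `suc j` is not among them and membership of
        -- `j` is still open.
        j : ℕ
        j = sumBelow x l

        bound : ∀ n {i} → i < n → x i ≤ sumBelow x n
        bound (suc n) i<1+n = case m≤n⇒m<n∨m≡n (s≤s⁻¹ i<1+n) of λ where
          (inj₁ i<n)  → ≤-trans (bound n i<n) (m≤m+n (sumBelow x n) (x n))
          (inj₂ refl) → m≤n+m (x n) (sumBelow x n)

        x₀ : Seq
        x₀ = splice l x λ _ → 0

        correct₀ = correct x₀ (splice-< l x _)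
        h₀ = proj₁ correct₀
        sup₀ = proj₁ (proj₂ correct₀)

        j∉ : ¬ (j ∈ₑ x₀)
        j∉ (i , e) with i <? l
        ... | yes i<l = <⇒≱ (≤-reflexive (sym e)) (bound l i<l)
        j∉ (i , ()) | no _

        h₀j : h₀ j ≡ 0
        h₀j = trans (proj₂ (proj₂ correct₀) j) (truth-no j∉)

        N = proj₁ (proj₂ sup₀ (suc j))

        -- `j` is enumerated only after the part of the instance from which `η` has already answered
        -- that it is absent.
        x₁ : Seq
        x₁ = splice (l ⊔ N) x₀ λ _ → suc j

        correct₁ = correct x₁ λ i<l → trans (splice-< l x _ i<l) (splice-< (l ⊔ N) x₀ _ (<-≤-trans i<l (m≤m⊔n l N)))
        h₁ = proj₁ correct₁
        sup₁ = proj₁ (proj₂ correct₁)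

        h₁j : h₁ j ≡ 1
        h₁j = trans (proj₂ (proj₂ correct₁) j) (truth-yes (l ⊔ N , splice-≥ (l ⊔ N) x₀ _ ≤-refl))

        h≡h₁ : h₀ j ≡ h₁ j
        h≡h₁ = suc-injective (trans (sym (⊏⇒at? (proj₁ sup₀ N) (proj₂ (proj₂ sup₀ (suc j)))))
          (trans (cong (λ w → at? (η w) j) eq) (⊏⇒at? (proj₁ sup₁ N) (subst (λ w → j < length (η w)) eq (proj₂ (proj₂ sup₀ (suc j)))))))
          where
          eq : ⟨ rangeStages x₀ , (λ _ → m) ⟩ ↾ N ≡ ⟨ rangeStages x₁ , (λ _ → m) ⟩ ↾ N
          eq = ↾-cong-< N (⟨⟩-cong-< N (λ i<N → rangeStages-agree (splice-< (l ⊔ N) x₀ _) (<-≤-trans i<N (m≤n⊔m l N))) λ _ → refl)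

    range-undetermined : ⊥
    range-undetermined = conclude (generic {Excluded} force)
      where
      conclude : ¬ (∃ λ y → ∀ m → Excluded m y)
      conclude (y , forced) =
        let k , n , h , Kk , n∉ , _ = facts y 0
            N , i , eq = forced n
        in n∉ (i , sym (⊏⇒at?≡ (proj₁ Kk N) eq))

  lim≰C-ℕ : ¬ (lim ≤W C ℕᴿ)
  lim≰C-ℕ (H , K , (η , _ , _ , η-sup) , (κ , _ , _ , κ-sup) , red) = range-undetermined {η} {κ} λ x m →
      let y , (_ , h , (_ , w , (g , (_ , k , Kk , (n , g≗ , n∉ , which)) , w≗) , Hwh) , h≗y) , ly =
            red (prefer m) (prefer⊢ m) (rangeStages x) (_ , named⇐ {f = lim} (rangeStages-limit x))
          w≗′ : w ≗ ⟨ rangeStages x , (λ _ → n) ⟩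
          w≗′ i = trans (w≗ i) (⟨⟩-cong (rangeStages x) (rangeStages x) g (λ _ → n) (λ _ → refl) g≗ i)
      in k , n , h , κ-sup Kk , n∉ , (case which of λ { (inj₁ eq) → inj₁ eq ; (inj₂ (m∈ , _)) → inj₂ m∈ }) ,
         IsSup-resp η η w ⟨ rangeStages x , (λ _ → n) ⟩ (λ _ → refl) w≗′ (λ _ → refl) (η-sup Hwh) ,
         λ j → trans (h≗y j) (lim-unique (named⇒ {f = lim} ly) (rangeStages-limit x) j)

  -- The infinite loop of the limit map does not reduce to the limit map

  private
    -- Each answer becomes the next instance unchanged, so the loop iterates `lim`.
    module Iterator = Quine (λ i _ v → nth v i) (λ _ s → s) (nthᵣ v₂ v₀) (λ {_} {s} _ i<n → nth-↾ s i<n)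

    iterator : Seq
    iterator = Iterator.program λ _ → 0

  ZeroFrom : Seq → ℕ → Set
  ZeroFrom y n = ∃ λ i → n ≤ i × y i ≡ 0

  -- Each limit removes one bound: the first drops the upper bound on the zero searched for, the
  -- second lets the lower bound tend to infinity, and later rounds are constant. At round 0, the
  -- bound by `π₁ n` confines entry `n` to symbols of `y` up to `n`.
  iterates : Seq → ℕ → Seq
  iterates y zero          n = truth (∃ λ i → π₁ (π₂ n) ≤ i × i ≤ π₁ n × y i ≡ 0)
  iterates y (suc zero)    n = truth (ZeroFrom y (π₁ n))
  iterates y (suc (suc _)) _ = truth (∀ n → ZeroFrom y n)

  iterates-limit : ∀ y i → graph (fun lim) (iterates y i) (iterates y (suc i))
  iterates-limit y zero = lim⇐ λ n → case em {ZeroFrom y (π₁ n)} of λ where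
    (yes (i , n≤i , e)) → i , λ s i≤s → trans
      (truth-yes (i , subst (λ n → π₁ n ≤ i) (sym (π₂-pair s n)) n≤i , subst (i ≤_) (sym (π₁-pair s n)) i≤s , e))
      (sym (truth-yes (i , n≤i , e)))
    (no none) → 0 , λ s _ → trans
      (truth-no λ (i , n≤i , _ , e) → none (i , subst (λ n → π₁ n ≤ i) (π₂-pair s n) n≤i , e))
      (sym (truth-no none))
  iterates-limit y (suc zero) = lim⇐ λ n → case em {∃ λ m → ¬ ZeroFrom y m} of λ where
      (yes (m , none)) → m , λ s m≤s → trans
        (truth-no λ (i , s≤i , e) → none (i , ≤-trans m≤s (subst (_≤ i) (π₁-pair s n) s≤i) , e))
        (sym (truth-no λ all → none (all m)))
      (no ¬none) → 0 , λ s _ → trans (truth-yes (all ¬none _)) (sym (truth-yes (all ¬none)))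
    where
    all : ¬ (∃ λ m → ¬ ZeroFrom y m) → ∀ n → ZeroFrom y n
    all ¬none n with em {ZeroFrom y n}
    ... | yes z = z
    ... | no ¬z = contradiction (n , ¬z) ¬none
  iterates-limit y (suc (suc i)) = lim⇐ λ n → 0 , λ _ _ → refl

  input : Seq → Seq
  input y = ⟨ iterator , iterates y 0 ⟩

  input-agree : ∀ {l x y} → Agree l x y → Agree l (input x) (input y)
  input-agree {l} {x} {y} eq = ⟨⟩-cong-< l (λ _ → refl) λ {n} n<l → truth-cong
    (λ (i , n≤i , i≤ , e) → i , n≤i , i≤ , trans (sym (eq (≤-<-trans (≤-trans i≤ (π₁≤ n)) n<l))) e)
    (λ (i , n≤i , i≤ , e) → i , n≤i , i≤ , trans (eq (≤-<-trans (≤-trans i≤ (π₁≤ n)) n<l)) e)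

  private
    Flim : MultiFun baire baire _
    Flim = realizerVersion lim

    Invariant : Seq → ℕ → Seq → Set
    Invariant y i q = ev q ≗ iterator × od q ≗ iterates y i

  iterates-unique : ∀ {y i q r} → Invariant y i q → graph Flim (od q) r → r ≗ iterates y (suc i)
  iterates-unique {y} {i} (_ , odq) Fr = lim-unique (respˡ (fun lim) odq (realizer⇒ {f = lim} Fr)) (iterates-limit y i)

  iterates-loop : ∀ y → dom (loop Flim) (input y)
  iterates-loop y = loop-intro Flim (Invariant y)
    (λ eq (evq , odq) → (λ n → trans (sym (eq (n + n))) (evq n)) , λ n → trans (sym (eq (suc (n + n)))) (odq n))
    (λ {i} {q} inv@(evq , odq) →
      (iterates y (suc i) , realizer⇐ {f = lim} (respˡ (fun lim) (λ n → sym (odq n)) (iterates-limit y i))) ,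
      λ r Fr → ⟨ iterator , r ⟩ , Iterator.program-advance {λ _ → 0} {q} {r} evq ,
               ev-⟨⟩ iterator r , λ n → trans (od-⟨⟩ iterator r n) (iterates-unique {y} {i} {q} inv Fr n))
    (ev-⟨⟩ iterator (iterates y 0) , od-⟨⟩ iterator (iterates y 0))

  -- Column 2 of the output is the point after two rounds, and its index 1 is the first symbol of
  -- the instance there.
  loop-value : ∀ {y z} → graph (loop Flim) (input y) z → z (pair 2 1) ≡ truth (∀ n → ZeroFrom y n)
  loop-value {y} {z} lz = trans (z≗ (pair 2 1)) (trans (cong (λ (i , j) → qs i j) (unpair-pair 2 1)) (proj₂ (invariant 2) 0))
    where
    unfolded = loop⇒ {f = Flim} {input y} {z} lz
    qs = proj₁ unfolded
    qs₀ = proj₁ (proj₂ unfolded)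
    z≗ = proj₁ (proj₂ (proj₂ unfolded))
    run = proj₂ (proj₂ (proj₂ unfolded))
    invariant : ∀ i → Invariant y i (qs i)
    invariant zero = (λ n → trans (qs₀ (n + n)) (ev-⟨⟩ iterator (iterates y 0) n)) ,
                     (λ n → trans (qs₀ (suc (n + n))) (od-⟨⟩ iterator (iterates y 0) n))
    invariant (suc i) =
      let r , Fr , adv = run i
          inv = invariant i
          eq = Iterator.program-unique {λ _ → 0} {qs i} {r} (proj₁ inv) adv
      in (λ n → trans (eq (n + n)) (ev-⟨⟩ iterator r n)) ,
         λ n → trans (eq (suc (n + n))) (trans (od-⟨⟩ iterator r n) (iterates-unique {y} {i} {qs i} inv Fr n))

  limit-realizer : PartialFun baire baire 0ℓ
  limit-realizer = record { multi = fun lim ; single = lim-unique }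

  limit-realizer⊢ : limit-realizer ⊢ lim
  limit-realizer⊢ p (z , nz) = z , ∘ₚ-graph (δ (represented ℕ^ℕ)) limit-realizer (named⇒ {f = lim} nz) (λ _ → refl) , nz

  private
    position : ℕ
    position = pair 2 1

    row : Seq → ℕ → Seq
    row k s j = k (pair s j)

  module _ {η κ : Word → Word} (facts : ∀ y → ∃ λ k → IsSup κ (input y) k × ∃ λ S → ∀ s → S ≤ s →
             at? (η (⟨ input y , row k s ⟩ ↾ s)) position ≡ suc (truth (∀ n → ZeroFrom y n))) where

    private
      -- The value `1` reports the truth value 0: at stage `s` the approximation denies infinitely
      -- many zeros. The row `u` is part of the requirement because finitely many symbols of `y`
      -- already determine the part of it that is used.
      Forced : ℕ → Seq → Set
      Forced m y = ZeroFrom y m × ∃₂ λ s u → m ≤ s × (∀ k → IsSup κ (input y) k → Agree s u (row k s)) ×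
                   at? (η (⟨ input y , u ⟩ ↾ s)) position ≡ 1

      -- Continued by ones, the condition has only finitely many zeros, so the approximation must
      -- eventually deny infinitely many. The finite evidence for this is frozen, and only then is a
      -- zero added, at `L`.
      force : ∀ m x l → ∃₂ λ x′ l′ → Agree l x x′ × l < l′ × (∀ y → Agree l′ x′ y → Forced m y)
      force m x l = x₂ , suc L , (λ i<l → trans (splice-< l x _ i<l) (splice-< L x₁ _ (<-≤-trans i<l l≤L))) , s≤s l≤L ,
        λ y eq →
          let eq₁ : Agree L x₁ y
              eq₁ i<L = trans (splice-< L x₁ _ i<L) (eq (m<n⇒m<1+n i<L))
              eqN : input x₁ ↾ N ≡ input y ↾ N
              eqN = agree-↾ N N≤L (input-agree eq₁)
          in (L , ≤-trans m≤s s≤L , trans (sym (eq (n<1+n L))) (splice-≥ L x₁ _ ≤-refl)) ,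
             s , row k s , m≤s ,
             (λ k′ Kk′ {j} j<s → let p<  = <-≤-trans (≤-<-trans (pair-mono (≤-refl {s}) (<⇒≤ j<s)) (n<1+n (pair s s))) len in
               suc-injective (trans (sym (⊏⇒at? (proj₁ Kk N) p<)) (trans (cong (λ w → at? (κ w) (pair s j)) eqN)
                 (⊏⇒at? (proj₁ Kk′ N) (subst (λ w → pair s j < length (κ w)) eqN p<))))) ,
             trans (cong (λ w → at? (η w) position) (↾-cong-< s (⟨⟩-cong-< s
               (λ i<s → sym (input-agree eq₁ (<-≤-trans i<s s≤L))) λ _ → refl)))
               (trans (value s (m≤m⊔n S m)) (cong suc (truth-no λ all → no-zeros (all l))))
        where
        x₁ : Seq
        x₁ = splice l x λ _ → 1

        no-zeros : ¬ ZeroFrom x₁ l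
        no-zeros (i , l≤i , e) = case trans (sym (splice-≥ l x _ l≤i)) e of λ ()

        k = proj₁ (facts x₁)
        Kk = proj₁ (proj₂ (facts x₁))
        S = proj₁ (proj₂ (proj₂ (facts x₁)))
        value = proj₂ (proj₂ (proj₂ (facts x₁)))
        s = S ⊔ m
        m≤s = m≤n⊔m S m
        -- The first `s` symbols of row `s` lie at indices `pair s j` below `pair s s`; this many
        -- symbols of the input determine them.
        N = proj₁ (proj₂ Kk (suc (pair s s)))
        len = proj₂ (proj₂ Kk (suc (pair s s)))
        L = l ⊔ (s ⊔ N)
        l≤L = m≤m⊔n l (s ⊔ N)
        s≤L = ≤-trans (m≤m⊔n s N) (m≤n⊔m l (s ⊔ N))
        N≤L = ≤-trans (m≤n⊔m s N) (m≤n⊔m l (s ⊔ N))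

        x₂ : Seq
        x₂ = splice L x₁ λ _ → 0

    zeros-undetermined : ⊥
    zeros-undetermined = conclude (generic {Forced} force)
      where
      conclude : ¬ (∃ λ y → ∀ m → Forced m y)
      conclude (y , forced) =
        let k , Kk , S , eq = facts y
            -- The modulus of `y` itself selects the requirement, so a denial falls at a stage where
            -- the approximation must already be right.
            _ , s , u , S≤s , u≡ , e = forced S
            all : ∀ n → ZeroFrom y n
            all n = proj₁ (forced n)
            e′ = trans (cong (λ w → at? (η w) position) (↾-cong-< s (⟨⟩-cong-< s (λ _ → refl) λ i<s → sym (u≡ k Kk i<s)))) e
        in contradiction (trans (sym e′) (trans (eq s S≤s) (cong suc (truth-yes all)))) λ ()

  lim^∞≰lim : ¬ (lim ^∞ ≤W lim)
  lim^∞≰lim (H , K , (η , η-mono , _ , η-sup) , (κ , _ , _ , κ-sup) , red) = zeros-undetermined {η} {κ} facts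
    where
    open ≡-Reasoning

    -- Approximating lim by the rows of its argument decides in the limit whether y
    -- has infinitely many zeros.
    facts : ∀ y → ∃ λ k → IsSup κ (input y) k × ∃ λ S → ∀ s → S ≤ s →
            at? (η (⟨ input y , row k s ⟩ ↾ s)) position ≡ suc (truth (∀ n → ZeroFrom y n))
    facts y =
      let z , lz = iterates-loop y
          z′ , (_ , h , (_ , w , (g , (_ , k , Kk , lg) , w≗) , Hwh) , h≗z′) , lz′ =
            red limit-realizer limit-realizer⊢ (input y) (z , named⇐ {f = lim ^∞} lz)
          bound , long′ = IsSup-resp η η w ⟨ input y , g ⟩ (λ _ → refl) w≗ (λ _ → refl) (η-sup Hwh)
          N , pos< = long′ (suc position)
          M , row≡ = eventually-all {λ j s → row k s j ≡ g j} N (λ {j} _ → lim⇒ lg j)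
      in k , κ-sup Kk , M ⊔ N , λ s le →
         let eq : ⟨ input y , row k s ⟩ ↾ N ≡ ⟨ input y , g ⟩ ↾ N
             eq = ↾-cong-< N (⟨⟩-cong-< N (λ _ → refl) (row≡ s (m⊔n≤o⇒m≤o M N le)))
             pos<′ = subst (λ w → position < length (η w)) (sym eq) pos<
         in begin
           at? (η (⟨ input y , row k s ⟩ ↾ s)) position  ≡⟨ ⊑⇒at? (η-mono (↾-⊑ ⟨ input y , row k s ⟩ (m⊔n≤o⇒n≤o M N le))) pos<′ ⟨
           at? (η (⟨ input y , row k s ⟩ ↾ N)) position  ≡⟨ cong (λ w → at? (η w) position) eq ⟩
           at? (η (⟨ input y , g ⟩ ↾ N)) position        ≡⟨ ⊏⇒at? (bound N) pos< ⟩
           suc (h position)                              ≡⟨ cong suc (trans (h≗z′ position) (loop-value (named⇒ {f = lim ^∞} lz′))) ⟩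
           suc (truth (∀ n → ZeroFrom y n))              ∎

theorem1 : ExcludedMiddle 0ℓ →
    ((C 2^ℕ ^∞ ≡W C 2^ℕ) × (C ℕ^ℕ ^∞ ≡W C ℕ^ℕ)) ×
    ((C ℕᴿ <W lim) × (lim ≡W C ℕᴿ ^∞) × (C ℕᴿ ^∞ <W lim ^∞))
theorem1 em =
  ((ClosedChoice.loop≤ Cantor , ClosedChoice.≤loop Cantor) , (ClosedChoice.loop≤ Baire , ClosedChoice.≤loop Baire)) ,
  (C-ℕ≤lim em , lim≰C-ℕ em) ,
  (lim≤C-ℕ^∞ , C-ℕ^∞≤lim em) ,
  ≤W-trans {f = C ℕᴿ ^∞} {g = lim} {h = lim ^∞} (C-ℕ^∞≤lim em) lim≤lim^∞ ,
  λ lim^∞≤C-ℕ^∞ → lim^∞≰lim em (≤W-trans {f = lim ^∞} {g = C ℕᴿ ^∞} {h = lim} lim^∞≤C-ℕ^∞ (C-ℕ^∞≤lim em))
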